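{- For all integers $n\ge0$ and $c\ge1$, \begin{align*} t_n^{(c)}=&\ \frac{n!}{12}\sum_{k=0}^{n-1}(-1)^k\frac{c^{n-k}(n-k-1)(3n+k)}{k!}\\ &+n!\sum_{k=0}^{n}\frac{(-1)^k}{k!}\sum_{i=0}^{(n-k)(c-1)} i\sum_{j=0}^{n-k}(-1)^j\binom{n-k}{j}\binom{i-cj+n-k-1}{n-k-1}\\ &+\frac{n!(c-1)}{2}\sum_{k=0}^{n}\frac{(-1)^k c^{n-k}}{k!}\binom{n-k}{2}\\ &+\frac{n!(c-1)}{6}\sum_{k=1}^{n-1}\frac{(-1)^k c^{n-k}(2(n-k)+1)}{(k-1)!}. \end{align*}
   Context: For integers $n\ge0$, $c\ge1$, let $G_{c,n}$ be the set of colored permutations: words $\sigma=\sigma_1^{[c_1]}\cdots\sigma_n^{[c_n]}$ where $|\sigma|=\sigma_1\cdots\sigma_n$ is a permutation of $[n]$ and each color $c_i\in\{0,\dots,c-1\}$. For a permutation $\pi$ of $[n]$, $\mathrm{inv}(\pi)=|\{(i,j):i<j,\ \pi_i>\pi_j\}|$. Let $\mathrm{col}(\sigma)=c_1+\cdots+c_n$ and $\mathrm{inv}_c(\sigma)=\mathrm{inv}(|\sigma|)+\mathrm{col}(\sigma)+c\cdot|\{(i,j):1\le i<j\le n,\ \sigma_i<\sigma_j,\ c_j\ne0\}|$. A colored derangement is a $\sigma\in G_{c,n}$ having no index $i$ with $\sigma_i=i$ and $c_i=0$ (i.e. fixed points of the underlying permutation must carry a nonzero color). $t_n^{(c)}=\sum\mathrm{inv}_c(\sigma)$,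 summed over all colored derangements $\sigma\in G_{c,n}$. Binomial coefficients follow the convention $\binom{m}{r}=0$ unless $0\le r\le m$. -}

module Defs where

open import Data.Nat as ℕ using (ℕ; zero; suc; _≤_; _<_; _∸_; _!)
open import Data.Nat.Properties using (_!≢0)
open import Data.Nat.Combinatorics using (_C_)
open import Data.Nat.ListAction using (sum)
open import Data.Bool.ListAction using (and)
open import Data.Integer as ℤ using (ℤ; +_; -[1+_])
open import Data.Rational as ℚ using (ℚ; 0ℚ; 1ℚ; _/_)
open import Data.Fin using (Fin; toℕ)
open import Data.Fin.Properties using (_≟_)
open import Data.Vec using (Vec; []; _∷_; lookup)
open import Data.List using (List; []; _∷_; concatMap; map; allFin)
open import Data.List.Relation.Unary.All using (All)
open import Data.Bool using (Bool; true; false; if_then_else_; _∧_; not)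
open import Relation.Nullary.Decidable using (⌊_⌋)
open import Relation.Binary.PropositionalEquality using (_≢_)

allWords : {A : Set} → List A → (n : ℕ) → List (Vec A n)
allWords xs zero    = [] ∷ []
allWords xs (suc n) = concatMap (λ x → map (x ∷_) (allWords xs n)) xs

count : {n : ℕ} → (Fin n → Bool) → ℕ
count {n} p = Data.List.length (Data.List.filter (λ i → Data.Bool.Properties.T? (p i)) (allFin n))
  where import Data.List ; import Data.Bool.Properties

allB : {n : ℕ} → (Fin n → Bool) → Bool
allB {n} p = and (map p (allFin n))

-- Colored permutations of [n] with c colors.
-- A word sigma = (w , col) : the underlying word w (values in Fin n, value
-- v standing for v+1 ∈ [n]) and the colors col (in Fin c = {0,…,c-1}).

isPerm : {n : ℕ} → Vec (Fin n) n → Bool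
isPerm {n} w = allB (λ i → allB (λ j →
  if ⌊ toℕ i ℕ.<? toℕ j ⌋ then not ⌊ lookup w i ≟ lookup w j ⌋ else true))

isColDerangement : {n c : ℕ} → Vec (Fin n) n → Vec (Fin c) n → Bool
isColDerangement {n} w col = allB (λ i →
  not (⌊ lookup w i ≟ i ⌋ ∧ ⌊ toℕ (lookup col i) ℕ.≟ 0 ⌋))

inv : {n : ℕ} → Vec (Fin n) n → ℕ
inv {n} w = sum (map (λ i → count (λ j →
  ⌊ toℕ i ℕ.<? toℕ j ⌋ ∧ ⌊ toℕ (lookup w j) ℕ.<? toℕ (lookup w i) ⌋)) (allFin n))

colSum : {n c : ℕ} → Vec (Fin c) n → ℕ
colSum {n} col = sum (map (λ i → toℕ (lookup col i)) (allFin n))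

ascNZ : {n c : ℕ} → Vec (Fin n) n → Vec (Fin c) n → ℕ
ascNZ {n} w col = sum (map (λ i → count (λ j →
  ⌊ toℕ i ℕ.<? toℕ j ⌋ ∧ ⌊ toℕ (lookup w i) ℕ.<? toℕ (lookup w j) ⌋
    ∧ not ⌊ toℕ (lookup col j) ℕ.≟ 0 ⌋)) (allFin n))

invc : {n : ℕ} (c : ℕ) → Vec (Fin n) n → Vec (Fin c) n → ℕ
invc c w col = inv w ℕ.+ colSum col ℕ.+ c ℕ.* ascNZ w col

t : (n c : ℕ) → ℕ
t n c = sum (map (λ w → sum (map (λ col →
          if isPerm w ∧ isColDerangement w col then invc c w col else 0)
        (allWords (allFin c) n)))
      (allWords (allFin n) n))

ℕ→ℚ : ℕ → ℚ
ℕ→ℚ m = + m / 1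

ℤ→ℚ : ℤ → ℚ
ℤ→ℚ z = z / 1

inv! : ℕ → ℚ
inv! k = _/_ (+ 1) (k !) {{k !≢0}}

sgn : ℕ → ℚ
sgn zero    = 1ℚ
sgn (suc k) = ℚ.- sgn k

-- Σ_{lo ≤ k < hi} f k  (empty if hi ≤ lo)
sumBetween : ℕ → ℕ → (ℕ → ℚ) → ℚ
sumBetween lo hi f = go (hi ∸ lo)
  where
  go : ℕ → ℚ
  go zero    = 0ℚ
  go (suc m) = go m ℚ.+ f (lo ℕ.+ m)

-- binomial coefficient with integer arguments: binom m r = 0 unless 0 ≤ r ≤ m
binomℤ : ℤ → ℤ → ℕ
binomℤ (+ m) (+ r) = m C r
binomℤ (+ m) -[1+ r ] = 0
binomℤ -[1+ m ] r = 0

rhs : (n c : ℕ) → ℚ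
rhs n c = term1 ℚ.+ term2 ℚ.+ term3 ℚ.+ term4
  where
  nf = ℕ→ℚ (n !)
  cq = ℕ→ℚ c
  term1 = nf ℚ.* (+ 1 / 12) ℚ.* sumBetween 0 n (λ k →
            sgn k ℚ.* ℕ→ℚ (c ℕ.^ (n ∸ k))
              ℚ.* (ℕ→ℚ n ℚ.- ℕ→ℚ k ℚ.- 1ℚ)
              ℚ.* (ℕ→ℚ 3 ℚ.* ℕ→ℚ n ℚ.+ ℕ→ℚ k) ℚ.* inv! k)
  term2 = nf ℚ.* sumBetween 0 (suc n) (λ k →
            sgn k ℚ.* inv! k ℚ.*
            sumBetween 0 (suc ((n ∸ k) ℕ.* (c ∸ 1))) (λ i →
              ℕ→ℚ i ℚ.* sumBetween 0 (suc (n ∸ k)) (λ j →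
                sgn j ℚ.* ℕ→ℚ ((n ∸ k) C j)
                  ℚ.* ℕ→ℚ (binomℤ (+ i ℤ.- + (c ℕ.* j) ℤ.+ + (n ∸ k) ℤ.- + 1)
                                  (+ (n ∸ k) ℤ.- + 1)))))
  term3 = nf ℚ.* (cq ℚ.- 1ℚ) ℚ.* (+ 1 / 2) ℚ.* sumBetween 0 (suc n) (λ k →
            sgn k ℚ.* ℕ→ℚ (c ℕ.^ (n ∸ k)) ℚ.* inv! k ℚ.* ℕ→ℚ ((n ∸ k) C 2))
  term4 = nf ℚ.* (cq ℚ.- 1ℚ) ℚ.* (+ 1 / 6) ℚ.* sumBetween 1 n (λ k →
            sgn k ℚ.* ℕ→ℚ (c ℕ.^ (n ∸ k))
              ℚ.* (ℕ→ℚ 2 ℚ.* ℕ→ℚ (n ∸ k) ℚ.+ 1ℚ) ℚ.* inv! (k ∸ 1))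

{-# OPTIONS --safe #-}
module Submission where

open import Defs
open import Algebra.Bundles using (CommutativeRing)
import Algebra.Properties.CommutativeMonoid.Sum
import Algebra.Solver.Ring
open import Algebra.Solver.Ring.AlmostCommutativeRing using (fromCommutativeRing; _-Raw-AlmostCommutative⟶_)
open import Data.Bool using (Bool; true; false; if_then_else_; _∧_; _∨_; not)
open import Data.Bool.Properties using (T?; ∨-identityʳ; ∨-zeroʳ)
open import Data.Fin using (Fin; zero; suc; toℕ)
open import Data.Fin.Permutation using (Permutation′; _⟨$⟩ʳ_; _⟨$⟩ˡ_; inverseˡ; inverseʳ; transpose)
open import Data.Fin.Properties using (_≟_; toℕ-injective; toℕ≤pred[n])
open import Data.Integer as ℤ using (ℤ; -[1+_])
import Data.Integer.Properties as ℤₚ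
open import Data.List using (List; []; _∷_; _++_; map; concatMap; foldr; filter; length; tabulate; allFin)
open import Data.Nat as ℕ using (ℕ; zero; suc; _∸_; _!; _≤_; _<_; z≤n; s≤s)
open import Data.Nat.Combinatorics using (_C_; nCk≡n!/k![n-k]!; k![n∸k]!∣n!; nC1≡n; nCn≡1; k>n⇒nCk≡0; nCk+nC[k+1]≡[n+1]C[k+1])
open import Data.Nat.DivMod using (m/n*n≡m)
import Data.Nat.ListAction as ℕL
import Data.Nat.Properties as ℕₚ
open import Data.Nat.Properties using (_!≢0; _!*_!≢0)
open import Data.Product using (∃; _,_)
open import Data.Rational as ℚ using (ℚ; 0ℚ; 1ℚ; ½)
import Data.Rational.Properties as ℚₚ
import Data.Rational.Unnormalised as ℚᵘ
import Data.Rational.Unnormalised.Properties as ℚᵘₚ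
open import Data.Vec as Vec using (Vec; []; _∷_; lookup)
open import Data.Vec.Properties using (lookup-map; lookup∘tabulate)
open import Function using (_∘_; id)
open import Level using (0ℓ)
open import Relation.Binary.Definitions using (tri<; tri≈; tri>)
open import Relation.Binary.PropositionalEquality
open import Relation.Nullary using (Dec; yes; no; ¬_; contradiction)
open import Relation.Nullary.Decidable using (⌊_⌋; isYes≗does; dec-true; dec-false; dec⇒maybe)
open import Algebra.Structures {A = ℚ} _≡_ using (IsCommutativeRing)

-- Expand the indicator of a colored derangement by inclusion–exclusion over the sets S of
-- positions forced to be fixed points of color 0; write m = n - |S|.  Colors off S are
-- independent, so summing over them leaves c^m times a sum over pairs i < j of words.  Swapping
-- values shows that the permutations fixing S with one (two) more positions prescribed number
-- (m-1)! ((m-2)!), whatever the prescribed free values are.  What remains depends on S only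
-- through Σ_{s ∈ S} L_s G_s and Σ_{s ∈ S} G_s², where L_s and G_s count the elements below and
-- above s outside S; over the S of size k their averages are k m (m-1) / 6 and k m (2m+1) / 6.
-- The second line of the formula is the total of the colors, because the inner sum over j is the
-- coefficient of x^i in ((1 - x^c) / (1 - x))^m.

-- The averages are a rank argument. Fix the other k - 1 elements of S: the remaining m + 1
-- positions contain s, and over all choices of s its rank r runs through 0, ..., m. So L_s G_s has
-- mean Σ r (m - r) / (m + 1) = m (m - 1) / 6, and G_s² has mean Σ r² / (m + 1) = m (2m + 1) / 6.
-- Elements of S are fixed points, so free positions and free values form the same set; this is why
-- L_s and G_s count both. With d = c - 1, an inversion costs 1. A non-inverted pair costs c exactly
-- when its right end has a nonzero color; at a free right end this happens for d of the c colors,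
-- so its mean cost is d. The first term of the formula collects the inversions. The third and
-- fourth collect the color-weighted ascents: those between two free positions, and those whose left
-- end lies in S. Cancelling (m - 1)! m = m! is illegitimate at m = 0. The summand k = n is
-- therefore shown to vanish separately, which explains the upper limits n - 1 in the formula.

private variable
  A B : Set
  n : ℕ

-- Sealed rational arithmetic and finite sums.

infixl 6 _+_ _-_
infixl 7 _*_
infix  8 -_

-- Opaque copies of ℕ→ℚ and of the operations of ℚ: the originals do not unify well,
-- since they reduce (or are blocked on metavariables) instead of being compared argumentwise.
abstract
  _+_ _*_ : ℚ → ℚ → ℚ
  _+_ = ℚ._+_
  _*_ = ℚ._*_

  -_ : ℚ → ℚ
  -_ = ℚ.-_

  # : ℕ → ℚ
  # = ℕ→ℚ

_-_ : ℚ → ℚ → ℚ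
p - q = p + - q

abstract
  isCommutativeRing : IsCommutativeRing _+_ _*_ -_ 0ℚ 1ℚ
  isCommutativeRing = ℚₚ.+-*-isCommutativeRing

commutativeRing : CommutativeRing 0ℓ 0ℓ
commutativeRing = record { isCommutativeRing = isCommutativeRing }

module R = CommutativeRing commutativeRing

open Algebra.Properties.CommutativeMonoid.Sum R.+-commutativeMonoid using (sum; sum-permute)

abstract
  ℚ+ : ∀ p q → p ℚ.+ q ≡ p + q
  ℚ+ p q = refl

  ℚ* : ∀ p q → p ℚ.* q ≡ p * q
  ℚ* p q = refl

  ℚ- : ∀ p → ℚ.- p ≡ - p
  ℚ- p = refl

-- The solver computes with constants such as ½ in the transparent ℚ, while terms use the sealed
-- operations; the identity map links the two.
coefficients : ℚₚ.+-*-rawRing -Raw-AlmostCommutative⟶ fromCommutativeRing commutativeRing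
coefficients = record
  { ⟦_⟧    = id
  ; +-homo = ℚ+
  ; *-homo = ℚ*
  ; -‿homo = ℚ-
  ; 0-homo = refl
  ; 1-homo = refl
  }

open Algebra.Solver.Ring ℚₚ.+-*-rawRing (fromCommutativeRing commutativeRing) coefficients
  (λ p q → dec⇒maybe (p ℚₚ.≟ q))
  using (solve; con) renaming (_:+_ to _⊕_; _:*_ to _⊗_; :-_ to ⊝_; _:-_ to _⊖_; _:=_ to _⊜_)

abstract
  -- Sealed so that unification compares sums argumentwise; `∑-[]`, `∑-∷`, `∑-allFin-0` and
  -- `∑-words-0` serve as computation rules outside the block.
  ∑ : List A → (A → ℚ) → ℚ
  ∑ []       f = 0ℚ
  ∑ (x ∷ xs) f = f x + ∑ xs f

  ∑-cong : (xs : List A) {f g : A → ℚ} → (∀ x → f x ≡ g x) → ∑ xs f ≡ ∑ xs g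
  ∑-cong []       f≗g = refl
  ∑-cong (x ∷ xs) f≗g = cong₂ _+_ (f≗g x) (∑-cong xs f≗g)

  ∑-+ : (xs : List A) (f g : A → ℚ) → ∑ xs (λ x → f x + g x) ≡ ∑ xs f + ∑ xs g
  ∑-+ []       f g = sym (R.+-identityʳ 0ℚ)
  ∑-+ (x ∷ xs) f g = trans (cong (f x + g x +_) (∑-+ xs f g))
    (solve 4 (λ a b c d → a ⊕ b ⊕ (c ⊕ d) ⊜ a ⊕ c ⊕ (b ⊕ d)) refl (f x) (g x) _ _)

  ∑-*ˡ : (c : ℚ) (xs : List A) (f : A → ℚ) → ∑ xs (λ x → c * f x) ≡ c * ∑ xs f
  ∑-*ˡ c []       f = sym (R.zeroʳ c)
  ∑-*ˡ c (x ∷ xs) f = trans (cong (c * f x +_) (∑-*ˡ c xs f)) (sym (R.distribˡ c (f x) _))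

  ∑-*ʳ : (xs : List A) (f : A → ℚ) (c : ℚ) → ∑ xs (λ x → f x * c) ≡ ∑ xs f * c
  ∑-*ʳ xs f c = trans (∑-cong xs (λ x → R.*-comm (f x) c)) (trans (∑-*ˡ c xs f) (R.*-comm c _))

  ∑-0 : (xs : List A) {f : A → ℚ} → (∀ x → f x ≡ 0ℚ) → ∑ xs f ≡ 0ℚ
  ∑-0 []       f≗0 = refl
  ∑-0 (x ∷ xs) f≗0 = trans (cong₂ _+_ (f≗0 x) (∑-0 xs f≗0)) (R.+-identityʳ 0ℚ)

  ∑-swap : (xs : List A) (ys : List B) (f : A → B → ℚ) →
           ∑ xs (λ x → ∑ ys (f x)) ≡ ∑ ys (λ y → ∑ xs (λ x → f x y))
  ∑-swap []       ys f = sym (∑-0 ys {λ _ → 0ℚ} (λ _ → refl))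
  ∑-swap (x ∷ xs) ys f = trans (cong (∑ ys (f x) +_) (∑-swap xs ys f)) (sym (∑-+ ys (f x) _))

  ∑-++ : (xs ys : List A) (f : A → ℚ) → ∑ (xs ++ ys) f ≡ ∑ xs f + ∑ ys f
  ∑-++ []       ys f = sym (R.+-identityˡ _)
  ∑-++ (x ∷ xs) ys f = trans (cong (f x +_) (∑-++ xs ys f)) (sym (R.+-assoc (f x) _ _))

  ∑-map : (h : A → B) (xs : List A) (f : B → ℚ) → ∑ (map h xs) f ≡ ∑ xs (f ∘ h)
  ∑-map h []       f = refl
  ∑-map h (x ∷ xs) f = cong (f (h x) +_) (∑-map h xs f)

  ∑-concatMap : (h : A → List B) (xs : List A) (f : B → ℚ) →
                ∑ (concatMap h xs) f ≡ ∑ xs (λ x → ∑ (h x) f)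
  ∑-concatMap h []       f = refl
  ∑-concatMap h (x ∷ xs) f = trans (∑-++ (h x) _ f) (cong (∑ (h x) f +_) (∑-concatMap h xs f))

  ∑-tabulate : (h : Fin n → A) (f : A → ℚ) → ∑ (tabulate h) f ≡ ∑ (allFin n) (f ∘ h)
  ∑-tabulate {zero}  h f = refl
  ∑-tabulate {suc n} h f = cong (f (h zero) +_)
    (trans (∑-tabulate (h ∘ suc) f) (sym (∑-tabulate suc (f ∘ h))))

  ∑-allFin-suc : (f : Fin (suc n) → ℚ) → ∑ (allFin (suc n)) f ≡ f zero + ∑ (allFin n) (f ∘ suc)
  ∑-allFin-suc f = cong (f zero +_) (∑-tabulate suc f)

  ∑-words-suc : (xs : List A) (n : ℕ) (f : Vec A (suc n) → ℚ) →
                ∑ (allWords xs (suc n)) f ≡ ∑ xs (λ x → ∑ (allWords xs n) (λ w → f (x ∷ w)))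
  ∑-words-suc xs n f = trans (∑-concatMap _ xs f) (∑-cong xs (λ x → ∑-map (x ∷_) (allWords xs n) f))

  ∑-[] : (f : A → ℚ) → ∑ [] f ≡ 0ℚ
  ∑-[] f = refl

  ∑-∷ : (x : A) (xs : List A) (f : A → ℚ) → ∑ (x ∷ xs) f ≡ f x + ∑ xs f
  ∑-∷ x xs f = refl

  ∑-allFin-0 : (f : Fin 0 → ℚ) → ∑ (allFin 0) f ≡ 0ℚ
  ∑-allFin-0 f = refl

  ∑-words-0 : (xs : List A) (f : Vec A 0 → ℚ) → ∑ (allWords xs 0) f ≡ f []
  ∑-words-0 xs f = R.+-identityʳ _

  ∑-pair : (x y : A) (f : A → ℚ) → ∑ (x ∷ y ∷ []) f ≡ f x + f y
  ∑-pair x y f = cong (f x +_) (R.+-identityʳ _)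

-- Finite products.

∏ : (Fin n → ℚ) → ℚ
∏ {zero}  f = 1ℚ
∏ {suc n} f = f zero * ∏ (f ∘ suc)

∏-cong : {f g : Fin n → ℚ} → (∀ i → f i ≡ g i) → ∏ f ≡ ∏ g
∏-cong {zero}  f≗g = refl
∏-cong {suc n} f≗g = cong₂ _*_ (f≗g zero) (∏-cong (f≗g ∘ suc))

∏-1 : {f : Fin n → ℚ} → (∀ i → f i ≡ 1ℚ) → ∏ f ≡ 1ℚ
∏-1 {zero}  f≗1 = refl
∏-1 {suc n} f≗1 = trans (cong₂ _*_ (f≗1 zero) (∏-1 (f≗1 ∘ suc))) (R.*-identityˡ 1ℚ)

∏-* : (f g : Fin n → ℚ) → ∏ (λ i → f i * g i) ≡ ∏ f * ∏ g
∏-* {zero}  f g = sym (R.*-identityˡ 1ℚ)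
∏-* {suc n} f g = trans (cong (f zero * g zero *_) (∏-* (f ∘ suc) (g ∘ suc)))
  (solve 4 (λ a b c d → a ⊗ b ⊗ (c ⊗ d) ⊜ a ⊗ c ⊗ (b ⊗ d)) refl (f zero) (g zero) _ _)

-- The factors will be indicators: an equation valid under one of several conditions may be used
-- under their conjunction.
∏-at : (f : Fin n → ℚ) (i : Fin n) {x y : ℚ} → f i * x ≡ f i * y → ∏ f * x ≡ ∏ f * y
∏-at f zero {x} {y} e = begin
  f zero * p * x    ≡⟨ solve 3 (λ a b c → a ⊗ b ⊗ c ⊜ b ⊗ (a ⊗ c)) refl (f zero) p x ⟩
  p * (f zero * x)  ≡⟨ cong (p *_) e ⟩
  p * (f zero * y)  ≡⟨ solve 3 (λ a b c → b ⊗ (a ⊗ c) ⊜ a ⊗ b ⊗ c) refl (f zero) p y ⟩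
  f zero * p * y    ∎
  where
  open ≡-Reasoning
  p = ∏ (f ∘ suc)
∏-at f (suc i) {x} {y} e = begin
  f zero * p * x    ≡⟨ R.*-assoc (f zero) p x ⟩
  f zero * (p * x)  ≡⟨ cong (f zero *_) (∏-at (f ∘ suc) i e) ⟩
  f zero * (p * y)  ≡⟨ R.*-assoc (f zero) p y ⟨
  f zero * p * y    ∎
  where
  open ≡-Reasoning
  p = ∏ (f ∘ suc)

∏-update : (f g : Fin n → ℚ) (i : Fin n) (x : ℚ) →
           g i ≡ f i * x → (∀ j → j ≢ i → g j ≡ f j) → ∏ g ≡ ∏ f * x
∏-update f g zero x eᵢ eⱼ = trans (cong₂ _*_ eᵢ (∏-cong (λ j → eⱼ (suc j) (λ ()))))
  (solve 3 (λ a b c → a ⊗ b ⊗ c ⊜ a ⊗ c ⊗ b) refl (f zero) x _)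
∏-update f g (suc i) x eᵢ eⱼ = trans
  (cong₂ _*_ (eⱼ zero (λ ())) (∏-update (f ∘ suc) (g ∘ suc) i x eᵢ (λ j j≢i → eⱼ (suc j) (λ { refl → j≢i refl }))))
  (sym (R.*-assoc (f zero) _ x))

-- Indicators, and naturals and factorials as rationals.

ι : Bool → ℚ
ι true  = 1ℚ
ι false = 0ℚ

ι-∧ : ∀ a b → ι (a ∧ b) ≡ ι a * ι b
ι-∧ true  b = sym (R.*-identityˡ (ι b))
ι-∧ false b = sym (R.zeroˡ (ι b))

ι-not : ∀ a → ι (not a) ≡ 1ℚ - ι a
ι-not true  = solve 0 (con 0ℚ ⊜ con 1ℚ ⊖ con 1ℚ) refl
ι-not false = solve 0 (con 1ℚ ⊜ con 1ℚ ⊖ con 0ℚ) refl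

allB-suc : (p : Fin (suc n) → Bool) → allB p ≡ p zero ∧ allB (p ∘ suc)
allB-suc p = cong (λ l → p zero ∧ foldr _∧_ true l) (map-tab suc p)
  where
  map-tab : ∀ {m} {A : Set} (h : Fin m → A) (q : A → Bool) → map q (tabulate h) ≡ map (q ∘ h) (allFin m)
  map-tab {zero}  h q = refl
  map-tab {suc m} h q = cong (q (h zero) ∷_) (trans (map-tab (h ∘ suc) q) (sym (map-tab suc (q ∘ h))))

ι-allB : (p : Fin n → Bool) → ι (allB p) ≡ ∏ (ι ∘ p)
ι-allB {zero}  p = refl
ι-allB {suc n} p = trans (cong ι (allB-suc p))
  (trans (ι-∧ (p zero) (allB (p ∘ suc))) (cong (ι (p zero) *_) (ι-allB (p ∘ suc))))

abstract
  #≡ : ∀ a → ℕ→ℚ a ≡ # a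
  #≡ a = refl

  #-0 : # 0 ≡ 0ℚ
  #-0 = refl

  #-1 : # 1 ≡ 1ℚ
  #-1 = refl

  #-+ : ∀ a b → # (a ℕ.+ b) ≡ # a + # b
  #-+ a b = ℚₚ.toℚᵘ-injective (begin
    ℚ.toℚᵘ (ℕ→ℚ (a ℕ.+ b))             ≈⟨ ℚₚ.toℚᵘ-fromℚᵘ (q (a ℕ.+ b)) ⟩
    q (a ℕ.+ b)                      ≈⟨ ℚᵘ.*≡* (cong (ℤ._* ℤ.1ℤ) (sym (cong₂ ℤ._+_ (ℤ*1 a) (ℤ*1 b)))) ⟩
    q a ℚᵘ.+ q b                     ≈⟨ ℚᵘₚ.+-cong (ℚₚ.toℚᵘ-fromℚᵘ (q a)) (ℚₚ.toℚᵘ-fromℚᵘ (q b)) ⟨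
    ℚ.toℚᵘ (ℕ→ℚ a) ℚᵘ.+ ℚ.toℚᵘ (ℕ→ℚ b)   ≈⟨ ℚₚ.toℚᵘ-homo-+ (ℕ→ℚ a) (ℕ→ℚ b) ⟨
    ℚ.toℚᵘ (ℕ→ℚ a ℚ.+ ℕ→ℚ b)             ∎)
    where
    open ℚᵘₚ.≃-Reasoning
    q : ℕ → ℚᵘ.ℚᵘ
    q m = ℚᵘ.mkℚᵘ (ℤ.+ m) 0
    ℤ*1 : ∀ m → ℤ.+ m ℤ.* ℤ.1ℤ ≡ ℤ.+ m
    ℤ*1 m = ℤₚ.*-identityʳ (ℤ.+ m)

#-suc : ∀ a → # (suc a) ≡ 1ℚ + # a
#-suc a = trans (#-+ 1 a) (cong (_+ # a) #-1)

#-* : ∀ a b → # (a ℕ.* b) ≡ # a * # b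
#-* zero    b = trans #-0 (sym (trans (cong (_* # b) #-0) (R.zeroˡ (# b))))
#-* (suc a) b = begin
  # (b ℕ.+ a ℕ.* b)     ≡⟨ #-+ b (a ℕ.* b) ⟩
  # b + # (a ℕ.* b)     ≡⟨ cong (# b +_) (#-* a b) ⟩
  # b + # a * # b       ≡⟨ solve 2 (λ x y → y ⊕ x ⊗ y ⊜ (con 1ℚ ⊕ x) ⊗ y) refl (# a) (# b) ⟩
  (1ℚ + # a) * # b      ≡⟨ cong (_* # b) (#-suc a) ⟨
  # (suc a) * # b       ∎
  where open ≡-Reasoning

#-sum : (xs : List A) (f : A → ℕ) → # (ℕL.sum (map f xs)) ≡ ∑ xs (λ x → # (f x))
#-sum []       f = trans #-0 (sym (∑-[] _))
#-sum (x ∷ xs) f = trans (#-+ (f x) _) (trans (cong (# (f x) +_) (#-sum xs f)) (sym (∑-∷ x xs _)))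

#-if : ∀ b m → # (if b then m else 0) ≡ ι b * # m
#-if true  m = sym (R.*-identityˡ _)
#-if false m = trans #-0 (sym (R.zeroˡ (# m)))

#-count : (p : Fin n → Bool) → # (count p) ≡ ∑ (allFin n) (λ i → ι (p i))
#-count {n} p = go (allFin n)
  where
  go : ∀ xs → # (length (filter (λ i → T? (p i)) xs)) ≡ ∑ xs (λ i → ι (p i))
  go []       = trans #-0 (sym (∑-[] _))
  go (x ∷ xs) rewrite ∑-∷ x xs (λ i → ι (p i)) with p x
  ... | true  = trans (#-suc (length (filter (λ i → T? (p i)) xs))) (cong (1ℚ +_) (go xs))
  ... | false = trans (go xs) (sym (R.+-identityˡ _))

sgn-suc : ∀ k → sgn (suc k) ≡ - sgn k
sgn-suc k = ℚ- (sgn k)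

abstract
  inv!-inverse : ∀ k → inv! k * # (k !) ≡ 1ℚ
  inv!-inverse k = inverse (k !) {{k !≢0}}
    where
    open ℚᵘₚ.≃-Reasoning
    -- `k !` does not compute to a successor, so the claim is made for every nonzero number.
    inverse : ∀ m .{{_ : ℕ.NonZero m}} → (ℤ.+ 1 ℚ./ m) ℚ.* ℕ→ℚ m ≡ 1ℚ
    inverse (suc m) = ℚₚ.toℚᵘ-injective (begin
      ℚ.toℚᵘ ((ℤ.+ 1 ℚ./ suc m) ℚ.* ℕ→ℚ (suc m))           ≈⟨ ℚₚ.toℚᵘ-homo-* (ℤ.+ 1 ℚ./ suc m) (ℕ→ℚ (suc m)) ⟩
      ℚ.toℚᵘ (ℤ.+ 1 ℚ./ suc m) ℚᵘ.* ℚ.toℚᵘ (ℕ→ℚ (suc m))   ≈⟨ ℚᵘₚ.*-cong (ℚₚ.toℚᵘ-fromℚᵘ (ℚᵘ.mkℚᵘ (ℤ.+ 1) m))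
                                                                          (ℚₚ.toℚᵘ-fromℚᵘ (ℚᵘ.mkℚᵘ (ℤ.+ suc m) 0)) ⟩
      ℚᵘ.mkℚᵘ (ℤ.+ 1) m ℚᵘ.* ℚᵘ.mkℚᵘ (ℤ.+ suc m) 0         ≈⟨ ℚᵘ.*≡* (ℤₚ.*-assoc (ℤ.+ 1) (ℤ.+ suc m) (ℤ.+ 1)) ⟩
      ℚᵘ.1ℚᵘ                                               ∎)

-- The right-hand side in sealed arithmetic.

module _ (n c : ℕ) where
  private
    nf = # (n !)

  term₁ term₂ term₃ term₄ : ℚ
  term₁ = nf * (ℤ.+ 1 ℚ./ 12) * sumBetween 0 n (λ k →
    sgn k * # (c ℕ.^ (n ∸ k)) * (# n - # k - 1ℚ) * (# 3 * # n + # k) * inv! k)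
  term₂ = nf * sumBetween 0 (suc n) (λ k → sgn k * inv! k *
    sumBetween 0 (suc ((n ∸ k) ℕ.* (c ∸ 1))) (λ i → # i *
      sumBetween 0 (suc (n ∸ k)) (λ j → sgn j * # ((n ∸ k) C j) *
        # (binomℤ (ℤ.+ i ℤ.- ℤ.+ (c ℕ.* j) ℤ.+ ℤ.+ (n ∸ k) ℤ.- ℤ.+ 1) (ℤ.+ (n ∸ k) ℤ.- ℤ.+ 1)))))
  term₃ = nf * (# c - 1ℚ) * (ℤ.+ 1 ℚ./ 2) * sumBetween 0 (suc n) (λ k →
    sgn k * # (c ℕ.^ (n ∸ k)) * inv! k * # ((n ∸ k) C 2))
  term₄ = nf * (# c - 1ℚ) * (ℤ.+ 1 ℚ./ 6) * sumBetween 1 n (λ k →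
    sgn k * # (c ℕ.^ (n ∸ k)) * (# 2 * # (n ∸ k) + 1ℚ) * inv! (k ∸ 1))

  abstract
    -- Within `abstract` the sealed operations unfold, and both spellings agree by computation.
    rhs-terms : rhs n c ≡ term₁ + term₂ + term₃ + term₄
    rhs-terms = refl

open ≡-Reasoning

-- Inclusion-exclusion over prescribed fixed points.

infix 4 _<ᶠ_ _≡ᶠ_
_<ᶠ_ _≡ᶠ_ : Fin n → Fin n → Bool
i <ᶠ j = ⌊ toℕ i ℕ.<? toℕ j ⌋
i ≡ᶠ j = ⌊ i ≟ j ⌋

isZero : Fin n → Bool
isZero x = ⌊ toℕ x ℕ.≟ 0 ⌋

bools : List Bool
bools = false ∷ true ∷ []

subsets : (n : ℕ) → List (Vec Bool n)
subsets = allWords bools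

∑-subsets-suc : (n : ℕ) (f : Vec Bool (suc n) → ℚ) →
  ∑ (subsets (suc n)) f ≡ ∑ (subsets n) (λ v → f (false ∷ v)) + ∑ (subsets n) (λ v → f (true ∷ v))
∑-subsets-suc n f = trans (∑-words-suc bools n f) (∑-pair false true _)

ones : Vec Bool n → ℕ
ones []          = 0
ones (true ∷ v)  = suc (ones v)
ones (false ∷ v) = ones v

-- Multiplying out: the subset records the factors from which -x is chosen rather than 1.
∏-1- : (x : Fin n → ℚ) → ∏ (λ l → 1ℚ - x l) ≡
  ∑ (subsets n) (λ v → sgn (ones v) * ∏ (λ l → if lookup v l then x l else 1ℚ))
∏-1- {zero}  x = sym (trans (∑-words-0 bools _) (R.*-identityˡ 1ℚ))
∏-1- {suc n} x = begin
  (1ℚ - x zero) * ∏ (λ l → 1ℚ - x (suc l))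
    ≡⟨ cong ((1ℚ - x zero) *_) (∏-1- (x ∘ suc)) ⟩
  (1ℚ - x zero) * Σ
    ≡⟨ solve 2 (λ a s → (con 1ℚ ⊖ a) ⊗ s ⊜ s ⊕ (⊝ a) ⊗ s) refl (x zero) Σ ⟩
  Σ + - x zero * Σ
    ≡⟨ cong (Σ +_) (∑-*ˡ (- x zero) (subsets n) _) ⟨
  Σ + ∑ (subsets n) (λ v → - x zero * (sgn (ones v) * p v))
    ≡⟨ cong₂ _+_ (∑-cong (subsets n) (λ v → cong (sgn (ones v) *_) (sym (R.*-identityˡ (p v)))))
         (∑-cong (subsets n) (λ v → trans (solve 3 (λ a s q → (⊝ a) ⊗ (s ⊗ q) ⊜ (⊝ s) ⊗ (a ⊗ q))
             refl (x zero) (sgn (ones v)) (p v))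
           (cong (_* (x zero * p v)) (sym (sgn-suc (ones v)))))) ⟩
  ∑ (subsets n) (λ v → sgn (ones v) * (1ℚ * p v)) + ∑ (subsets n) (λ v → sgn (suc (ones v)) * (x zero * p v))
    ≡⟨ ∑-subsets-suc n _ ⟨
  _ ∎
  where
  p : Vec Bool n → ℚ
  p v = ∏ (λ l → if lookup v l then x (suc l) else 1ℚ)
  Σ = ∑ (subsets n) (λ v → sgn (ones v) * p v)

-- A weight rather than a filter, so that conditions multiply and a single one can be isolated by
-- `∏-at` or added by `∏-update`.
fix : (Fin n → Bool) → Vec (Fin n) n → ℚ
fix S w = ∏ (λ l → if S l then ι (lookup w l ≡ᶠ l) else 1ℚ)

uncoloured : {c : ℕ} → (Fin n → Bool) → Vec (Fin c) n → ℚ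
uncoloured S col = ∏ (λ l → if S l then ι (isZero (lookup col l)) else 1ℚ)

derangement-expansion : {c : ℕ} (w : Vec (Fin n) n) (col : Vec (Fin c) n) →
  ι (isColDerangement w col) ≡
  ∑ (subsets n) (λ v → sgn (ones v) * (fix (lookup v) w * uncoloured (lookup v) col))
derangement-expansion {n} w col = begin
  ι (isColDerangement w col)
    ≡⟨ ι-allB {n} _ ⟩
  ∏ (λ l → ι (not ((lookup w l ≡ᶠ l) ∧ isZero (lookup col l))))
    ≡⟨ ∏-cong (λ l → trans (ι-not ((lookup w l ≡ᶠ l) ∧ isZero (lookup col l)))
         (cong (λ y → 1ℚ - y) (ι-∧ (lookup w l ≡ᶠ l) (isZero (lookup col l))))) ⟩
  ∏ (λ l → 1ℚ - ι (lookup w l ≡ᶠ l) * ι (isZero (lookup col l)))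
    ≡⟨ ∏-1- {n} _ ⟩
  _ ≡⟨ ∑-cong (subsets n) (λ v → cong (sgn (ones v) *_)
         (trans (∏-cong (λ l → split (lookup v l))) (∏-* {n} _ _))) ⟩
  _ ∎
  where
  split : ∀ b {x y : ℚ} → (if b then x * y else 1ℚ) ≡ (if b then x else 1ℚ) * (if b then y else 1ℚ)
  split true  = refl
  split false = sym (R.*-identityˡ 1ℚ)

-- Summation over the colors.

cnt : (Fin n → Bool) → ℕ
cnt {zero}  S = 0
cnt {suc n} S = if S zero then cnt (S ∘ suc) else suc (cnt (S ∘ suc))

#-cnt : (S : Fin n → Bool) → # (cnt S) ≡ ∑ (allFin n) (λ j → ι (not (S j)))
#-cnt {zero}  S = trans #-0 (sym (∑-allFin-0 _))
#-cnt {suc n} S = trans (lem (S zero)) (sym (∑-allFin-suc (λ j → ι (not (S j)))))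
  where
  lem : ∀ b → # (if b then cnt (S ∘ suc) else suc (cnt (S ∘ suc))) ≡
              ι (not b) + ∑ (allFin n) (λ j → ι (not (S (suc j))))
  lem true  = trans (#-cnt (S ∘ suc)) (sym (R.+-identityˡ _))
  lem false = trans (#-suc (cnt (S ∘ suc))) (cong (1ℚ +_) (#-cnt (S ∘ suc)))

∑-const : (n : ℕ) (x : ℚ) → ∑ (allFin n) (λ _ → x) ≡ # n * x
∑-const zero    x = trans (∑-allFin-0 _) (sym (trans (cong (_* x) #-0) (R.zeroˡ x)))
∑-const (suc n) x = begin
  ∑ (allFin (suc n)) (λ _ → x)   ≡⟨ ∑-allFin-suc {n} (λ _ → x) ⟩
  x + ∑ (allFin n) (λ _ → x)     ≡⟨ cong (x +_) (∑-const n x) ⟩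
  x + # n * x                    ≡⟨ solve 2 (λ x m → x ⊕ m ⊗ x ⊜ (con 1ℚ ⊕ m) ⊗ x) refl x (# n) ⟩
  (1ℚ + # n) * x                 ≡⟨ cong (_* x) (#-suc n) ⟨
  # (suc n) * x                  ∎

∑-toℕ : (n : ℕ) → ∑ (allFin n) (λ x → # (toℕ x)) ≡ ½ * (# n * (# n - 1ℚ))
∑-toℕ zero    = trans (∑-allFin-0 _) (trans (solve 0 (con 0ℚ ⊜ con ½ ⊗ (con 0ℚ ⊗ (con 0ℚ ⊖ con 1ℚ))) refl)
  (sym (cong (λ m → ½ * (m * (m - 1ℚ))) #-0)))
∑-toℕ (suc n) = begin
  ∑ (allFin (suc n)) (λ x → # (toℕ x))
    ≡⟨ ∑-allFin-suc {n} (λ x → # (toℕ x)) ⟩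
  # 0 + ∑ (allFin n) (λ x → # (suc (toℕ x)))
    ≡⟨ cong₂ _+_ #-0 (trans (∑-cong (allFin n) (λ x → #-suc (toℕ x))) (∑-+ (allFin n) _ _)) ⟩
  0ℚ + (∑ (allFin n) (λ _ → 1ℚ) + ∑ (allFin n) (λ x → # (toℕ x)))
    ≡⟨ cong (0ℚ +_) (cong₂ _+_ (∑-const n 1ℚ) (∑-toℕ n)) ⟩
  0ℚ + (# n * 1ℚ + ½ * (# n * (# n - 1ℚ)))
    ≡⟨ solve 1 (λ m → con 0ℚ ⊕ (m ⊗ con 1ℚ ⊕ con ½ ⊗ (m ⊗ (m ⊖ con 1ℚ))) ⊜
                      con ½ ⊗ ((con 1ℚ ⊕ m) ⊗ (con 1ℚ ⊕ m ⊖ con 1ℚ))) refl (# n) ⟩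
  ½ * ((1ℚ + # n) * (1ℚ + # n - 1ℚ))
    ≡⟨ cong (λ m → ½ * (m * (m - 1ℚ))) (#-suc n) ⟨
  ½ * (# (suc n) * (# (suc n) - 1ℚ)) ∎

module _ (d : ℕ) where
  private
    c = suc d
    colours = allFin c

  -- Colors are independent. On S the color is forced to 0, where `φ` vanishes; off S each position
  -- gives a factor c and the mean `ψ`. `K` absorbs the letters already treated by the induction.
  colour-sum : (n : ℕ) (S : Fin n → Bool) (K : ℚ) (φ : Fin n → Fin c → ℚ) (ψ : Fin n → ℚ) →
    (∀ j → φ j zero ≡ 0ℚ) → (∀ j → ∑ colours (φ j) ≡ # c * ψ j) →
    ∑ (allWords colours n) (λ col → uncoloured S col * (K + ∑ (allFin n) (λ j → φ j (lookup col j)))) ≡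
    # (c ℕ.^ cnt S) * (K + ∑ (allFin n) (λ j → ι (not (S j)) * ψ j))
  colour-sum zero    S K φ ψ φ0 φψ = trans (∑-words-0 colours _) (trans (R.*-identityˡ _)
    (trans (cong (K +_) (trans (∑-allFin-0 _) (sym (∑-allFin-0 _))))
      (trans (sym (R.*-identityˡ _)) (R.*-congʳ (sym #-1)))))
  colour-sum (suc n) S K φ ψ φ0 φψ = begin
    ∑ (allWords colours (suc n)) (λ col → uncoloured S col * (K + ∑ (allFin (suc n)) (λ j → φ j (lookup col j))))
      ≡⟨ ∑-words-suc colours n _ ⟩
    ∑ colours (λ x → ∑ (allWords colours n) (λ col →
      h (S zero) x * U col * (K + ∑ (allFin (suc n)) (λ j → φ j (lookup (x ∷ col) j)))))
      ≡⟨ ∑-cong colours (λ x → trans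
           (∑-cong (allWords colours n) (λ col → trans
             (cong (λ y → h (S zero) x * U col * (K + y)) (∑-allFin-suc (λ j → φ j (lookup (x ∷ col) j))))
             (solve 5 (λ h u k a b → h ⊗ u ⊗ (k ⊕ (a ⊕ b)) ⊜ h ⊗ (u ⊗ (k ⊕ a ⊕ b))) refl
               (h (S zero) x) (U col) K (φ zero x) _)))
           (trans (∑-*ˡ (h (S zero) x) (allWords colours n) _)
             (cong (h (S zero) x *_) (colour-sum n (S ∘ suc) (K + φ zero x) (φ ∘ suc) (ψ ∘ suc) (φ0 ∘ suc)
                 (φψ ∘ suc))))) ⟩
    ∑ colours (λ x → h (S zero) x * (cᵐ * (K + φ zero x + Ψ)))
      ≡⟨ first (S zero) ⟩
    # (c ℕ.^ (if S zero then m else suc m)) * (K + (ι (not (S zero)) * ψ zero + Ψ))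
      ≡⟨ cong (λ y → # (c ℕ.^ cnt S) * (K + y)) (∑-allFin-suc (λ j → ι (not (S j)) * ψ j)) ⟨
    # (c ℕ.^ cnt S) * (K + ∑ (allFin (suc n)) (λ j → ι (not (S j)) * ψ j)) ∎
    where
    h : Bool → Fin c → ℚ
    h b x = if b then ι (isZero x) else 1ℚ
    U = uncoloured {n} {c} (S ∘ suc)
    m = cnt (S ∘ suc)
    cᵐ = # (c ℕ.^ m)
    Ψ = ∑ (allFin n) (λ j → ι (not (S (suc j))) * ψ (suc j))
    first : ∀ b → ∑ colours (λ x → h b x * (cᵐ * (K + φ zero x + Ψ))) ≡
            # (c ℕ.^ (if b then m else suc m)) * (K + (ι (not b) * ψ zero + Ψ))
    first true = begin
      ∑ colours (λ x → h true x * (cᵐ * (K + φ zero x + Ψ)))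
        ≡⟨ ∑-allFin-suc {d} (λ x → h true x * (cᵐ * (K + φ zero x + Ψ))) ⟩
      1ℚ * (cᵐ * (K + φ zero zero + Ψ)) + ∑ (allFin d) (λ x → 0ℚ * (cᵐ * (K + φ zero (suc x) + Ψ)))
        ≡⟨ cong₂ _+_ (cong (λ y → 1ℚ * (cᵐ * (K + y + Ψ))) (φ0 zero)) (∑-0 (allFin d) (λ x → R.zeroˡ _)) ⟩
      1ℚ * (cᵐ * (K + 0ℚ + Ψ)) + 0ℚ
        ≡⟨ solve 4 (λ c k p q → con 1ℚ ⊗ (c ⊗ (k ⊕ con 0ℚ ⊕ p)) ⊕ con 0ℚ ⊜ c ⊗ (k ⊕ (con 0ℚ ⊗ q ⊕ p)))
            refl cᵐ K Ψ (ψ zero) ⟩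
      cᵐ * (K + (0ℚ * ψ zero + Ψ)) ∎
    first false = begin
      ∑ colours (λ x → 1ℚ * (cᵐ * (K + φ zero x + Ψ)))
        ≡⟨ ∑-cong colours (λ x → solve 4 (λ c k f p → con 1ℚ ⊗ (c ⊗ (k ⊕ f ⊕ p)) ⊜ c ⊗ (k ⊕ p) ⊕ c ⊗ f)
            refl cᵐ K (φ zero x) Ψ) ⟩
      ∑ colours (λ x → cᵐ * (K + Ψ) + cᵐ * φ zero x)
        ≡⟨ ∑-+ colours _ _ ⟩
      ∑ colours (λ x → cᵐ * (K + Ψ)) + ∑ colours (λ x → cᵐ * φ zero x)
        ≡⟨ cong₂ _+_ (∑-const c _) (trans (∑-*ˡ cᵐ colours (φ zero)) (cong (cᵐ *_) (φψ zero))) ⟩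
      # c * (cᵐ * (K + Ψ)) + cᵐ * (# c * ψ zero)
        ≡⟨ solve 5 (λ a cᵐ k p s → a ⊗ (cᵐ ⊗ (k ⊕ p)) ⊕ cᵐ ⊗ (a ⊗ s) ⊜ a ⊗ cᵐ ⊗ (k ⊕ (con 1ℚ ⊗ s ⊕ p)))
            refl (# c) cᵐ K Ψ (ψ zero) ⟩
      # c * cᵐ * (K + (1ℚ * ψ zero + Ψ))
        ≡⟨ cong (_* (K + (1ℚ * ψ zero + Ψ))) (#-* c (c ℕ.^ m)) ⟨
      # (c ℕ.^ suc m) * (K + (1ℚ * ψ zero + Ψ)) ∎

  -- Mean cost of positions i < j with values x and y; `b` tells whether j is in S. An ascent costs
  -- c for the d nonzero colors at j out of c, hence `# d` on average, and nothing when j is in S.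
  κ : Bool → Fin n → Fin n → ℚ
  κ b x y = ι (y <ᶠ x) + # d * (ι (not b) * ι (x <ᶠ y))

  pairSum : (Fin n → Bool) → Vec (Fin n) n → ℚ
  pairSum {n} S w = ∑ (allFin n) (λ i → ∑ (allFin n) (λ j → ι (i <ᶠ j) * κ (S j) (lookup w i) (lookup w j)))

  -- For a fixed word, grouping the ascents by their right end j makes `invc` a constant plus a sum
  -- of functions of single colors, so `colour-sum` applies.
  invc-colour-sum : (S : Fin n → Bool) (w : Vec (Fin n) n) →
    ∑ (allWords colours n) (λ col → uncoloured S col * # (invc c w col)) ≡
    # (c ℕ.^ cnt S) * (½ * (# (cnt S) * # d) + pairSum S w)
  invc-colour-sum {n} S w = begin
    ∑ (allWords colours n) (λ col → uncoloured S col * # (invc c w col))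
      ≡⟨ ∑-cong (allWords colours n) (λ col → cong (uncoloured S col *_) (expand col)) ⟩
    ∑ (allWords colours n) (λ col → uncoloured S col * (K + ∑ F (λ j → φ j (lookup col j))))
      ≡⟨ colour-sum n S K φ ψ φ0 φψ ⟩
    # (c ℕ.^ cnt S) * (K + ∑ F (λ j → ι (not (S j)) * ψ j))
      ≡⟨ cong (# (c ℕ.^ cnt S) *_) regroup ⟩
    # (c ℕ.^ cnt S) * (½ * (# (cnt S) * # d) + pairSum S w) ∎
    where
    F = allFin n
    L : Fin n → Fin n → ℚ
    L i j = ι (i <ᶠ j)
    W : Fin n → Fin n → ℚ
    W i j = ι (lookup w i <ᶠ lookup w j)
    NZ : Fin c → ℚ
    NZ x = ι (not (isZero x))
    K = ∑ F (λ i → ∑ F (λ j → L i j * W j i))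
    k : Fin n → ℚ
    k j = ∑ F (λ i → L i j * W i j)
    φ : Fin n → Fin c → ℚ
    φ j x = # (toℕ x) + # c * (NZ x * k j)
    ψ : Fin n → ℚ
    ψ j = ½ * # d + # d * k j
    φ0 : ∀ j → φ j zero ≡ 0ℚ
    φ0 j = trans (cong (_+ # c * (0ℚ * k j)) #-0)
      (solve 2 (λ a b → con 0ℚ ⊕ a ⊗ (con 0ℚ ⊗ b) ⊜ con 0ℚ) refl (# c) (k j))
    ∑NZ : ∑ colours NZ ≡ # d
    ∑NZ = trans (∑-allFin-suc NZ) (trans (R.+-identityˡ _) (trans (∑-const d 1ℚ) (R.*-identityʳ (# d))))
    φψ : ∀ j → ∑ colours (φ j) ≡ # c * ψ j
    φψ j = begin
      ∑ colours (φ j)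
        ≡⟨ ∑-+ colours _ _ ⟩
      ∑ colours (λ x → # (toℕ x)) + ∑ colours (λ x → # c * (NZ x * k j))
        ≡⟨ cong₂ _+_ (∑-toℕ c) (trans (∑-*ˡ (# c) colours _)
             (cong (# c *_) (trans (∑-*ʳ colours NZ (k j)) (cong (_* k j) ∑NZ)))) ⟩
      ½ * (# c * (# c - 1ℚ)) + # c * (# d * k j)
        ≡⟨ cong (λ y → ½ * (# c * (y - 1ℚ)) + # c * (# d * k j)) (#-suc d) ⟩
      ½ * (# c * (1ℚ + # d - 1ℚ)) + # c * (# d * k j)
        ≡⟨ solve 3 (λ c d k → con ½ ⊗ (c ⊗ (con 1ℚ ⊕ d ⊖ con 1ℚ)) ⊕ c ⊗ (d ⊗ k) ⊜ c ⊗ (con ½ ⊗ d ⊕ d ⊗ k))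
            refl (# c) (# d) (k j) ⟩
      # c * ψ j ∎
    expand : ∀ col → # (invc c w col) ≡ K + ∑ F (λ j → φ j (lookup col j))
    expand col = begin
      # (inv w ℕ.+ colSum col ℕ.+ c ℕ.* ascNZ w col)
        ≡⟨ trans (#-+ (inv w ℕ.+ colSum col) (c ℕ.* ascNZ w col))
            (cong₂ _+_ (#-+ (inv w) (colSum col)) (#-* c (ascNZ w col))) ⟩
      # (inv w) + # (colSum col) + # c * # (ascNZ w col)
        ≡⟨ cong₂ _+_ (cong₂ _+_
             (trans (#-sum F _) (∑-cong F (λ i → trans (#-count {n} _) (∑-cong F (λ j → ι-∧ (i <ᶠ j) _)))))
             (#-sum F _))
             (cong (# c *_) (trans (#-sum F _) (trans (∑-cong F (λ i → trans (#-count {n} _)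
               (∑-cong F (λ j → trans (ι-∧ (i <ᶠ j) _) (cong (L i j *_) (ι-∧ (lookup w i <ᶠ lookup w j) _))))))
               (∑-swap F F _)))) ⟩
      K + ∑ F (λ j → # (toℕ (lookup col j))) + # c * ∑ F (λ j → ∑ F (λ i → L i j * (W i j * NZ (lookup col j))))
        ≡⟨ cong (K + ∑ F (λ j → # (toℕ (lookup col j))) +_)
            (trans (sym (∑-*ˡ (# c) F _)) (∑-cong F (λ j → cong (# c *_) (trans
             (∑-cong F (λ i → sym (R.*-assoc (L i j) (W i j) (NZ (lookup col j)))))
             (trans (∑-*ʳ F (λ i → L i j * W i j) (NZ (lookup col j))) (R.*-comm (k j) (NZ (lookup col j)))))))) ⟩
      K + ∑ F (λ j → # (toℕ (lookup col j))) + ∑ F (λ j → # c * (NZ (lookup col j) * k j))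
        ≡⟨ R.+-assoc K _ _ ⟩
      K + (∑ F (λ j → # (toℕ (lookup col j))) + ∑ F (λ j → # c * (NZ (lookup col j) * k j)))
        ≡⟨ cong (K +_) (∑-+ F _ _) ⟨
      K + ∑ F (λ j → φ j (lookup col j)) ∎
    regroup : K + ∑ F (λ j → ι (not (S j)) * ψ j) ≡ ½ * (# (cnt S) * # d) + pairSum S w
    regroup = begin
      K + ∑ F (λ j → ι (not (S j)) * ψ j)
        ≡⟨ cong (K +_) (trans (∑-cong F (λ j →
            solve 3 (λ s d k → s ⊗ (con ½ ⊗ d ⊕ d ⊗ k) ⊜ s ⊗ (con ½ ⊗ d) ⊕ d ⊗ s ⊗ k)
            refl (ι (not (S j))) (# d) (k j))) (∑-+ F _ _)) ⟩
      K + (∑ F (λ j → ι (not (S j)) * (½ * # d)) + ∑ F (λ j → # d * ι (not (S j)) * k j))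
        ≡⟨ cong (K +_) (cong₂ _+_
            (trans (∑-*ʳ F _ (½ * # d)) (cong (_* (½ * # d)) (sym (#-cnt S))))
            (trans (∑-cong F (λ j → sym (∑-*ˡ (# d * ι (not (S j))) F _))) (∑-swap F F _))) ⟩
      K + (# (cnt S) * (½ * # d) + K′)
        ≡⟨ solve 4 (λ k m d k′ → k ⊕ (m ⊗ (con ½ ⊗ d) ⊕ k′) ⊜ con ½ ⊗ (m ⊗ d) ⊕ (k ⊕ k′))
            refl K (# (cnt S)) (# d) K′ ⟩
      ½ * (# (cnt S) * # d) + (K + K′)
        ≡⟨ cong (½ * (# (cnt S) * # d) +_) (trans (sym (∑-+ F _ _))
            (∑-cong F (λ i → trans (sym (∑-+ F _ _)) (∑-cong F (λ j →
             solve 5 (λ l u v d s → l ⊗ v ⊕ d ⊗ s ⊗ (l ⊗ u) ⊜ l ⊗ (v ⊕ d ⊗ (s ⊗ u)))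
                 refl (L i j) (W i j) (W j i) (# d) (ι (not (S j)))))))) ⟩
      ½ * (# (cnt S) * # d) + pairSum S w ∎
      where
      K′ = ∑ F (λ i → ∑ F (λ j → # d * ι (not (S j)) * (L i j * W i j)))

-- Equality and order of letters under indicators.

≡ᶠ-refl : (i : Fin n) → (i ≡ᶠ i) ≡ true
≡ᶠ-refl i = trans (isYes≗does (i ≟ i)) (dec-true (i ≟ i) refl)

≡ᶠ-≢ : {i j : Fin n} → i ≢ j → (i ≡ᶠ j) ≡ false
≡ᶠ-≢ {i = i} {j} i≢j = trans (isYes≗does (i ≟ j)) (dec-false (i ≟ j) i≢j)

≡ᶠ-suc : (i j : Fin n) → (suc i ≡ᶠ suc j) ≡ (i ≡ᶠ j)
≡ᶠ-suc i j = trans (isYes≗does (suc i ≟ suc j)) (sym (isYes≗does (i ≟ j)))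

<ᶠ-suc : (i j : Fin n) → (suc i <ᶠ suc j) ≡ (i <ᶠ j)
<ᶠ-suc i j = trans (isYes≗does (toℕ (suc i) ℕ.<? toℕ (suc j))) (sym (isYes≗does (toℕ i ℕ.<? toℕ j)))

<ᶠ-true : {i j : Fin n} → toℕ i ℕ.< toℕ j → (i <ᶠ j) ≡ true
<ᶠ-true {i = i} {j} i<j = trans (isYes≗does (toℕ i ℕ.<? toℕ j)) (dec-true (toℕ i ℕ.<? toℕ j) i<j)

<ᶠ-false : {i j : Fin n} → ¬ toℕ i ℕ.< toℕ j → (i <ᶠ j) ≡ false
<ᶠ-false {i = i} {j} i≮j = trans (isYes≗does (toℕ i ℕ.<? toℕ j)) (dec-false (toℕ i ℕ.<? toℕ j) i≮j)

-- Makes a conditional equation unconditional: where the condition fails, both sides carry a factor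
-- 0.
≡ᶠ-guard : (i j : Fin n) {x y : ℚ} → (i ≡ j → x ≡ y) → ι (i ≡ᶠ j) * x ≡ ι (i ≡ᶠ j) * y
≡ᶠ-guard i j e with i ≟ j
... | yes i≡j = cong (1ℚ *_) (e i≡j)
... | no  _   = trans (R.zeroˡ _) (sym (R.zeroˡ _))

<ᶠ-guard : (i j : Fin n) {x y : ℚ} → (toℕ i ℕ.< toℕ j → x ≡ y) → ι (i <ᶠ j) * x ≡ ι (i <ᶠ j) * y
<ᶠ-guard i j e with toℕ i ℕ.<? toℕ j
... | yes i<j = cong (1ℚ *_) (e i<j)
... | no  _   = trans (R.zeroˡ _) (sym (R.zeroˡ _))

∑-δ : (a : Fin n) (f : Fin n → ℚ) → ∑ (allFin n) (λ x → ι (x ≡ᶠ a) * f x) ≡ f a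
∑-δ {suc n} zero f = begin
  ∑ (allFin (suc n)) (λ x → ι (x ≡ᶠ zero) * f x)
    ≡⟨ ∑-allFin-suc {n} _ ⟩
  1ℚ * f zero + ∑ (allFin n) (λ x → 0ℚ * f (suc x))
    ≡⟨ cong₂ _+_ (R.*-identityˡ _) (∑-0 (allFin n) (λ x → R.zeroˡ _)) ⟩
  f zero + 0ℚ
    ≡⟨ R.+-identityʳ _ ⟩
  f zero ∎
∑-δ {suc n} (suc a) f = begin
  ∑ (allFin (suc n)) (λ x → ι (x ≡ᶠ suc a) * f x)
    ≡⟨ ∑-allFin-suc {n} _ ⟩
  0ℚ * f zero + ∑ (allFin n) (λ x → ι (suc x ≡ᶠ suc a) * f (suc x))
    ≡⟨ cong₂ _+_ (R.zeroˡ _) (trans (∑-cong (allFin n) (λ x → cong (λ b → ι b * f (suc x)) (≡ᶠ-suc x a)))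
        (∑-δ a (f ∘ suc))) ⟩
  0ℚ + f (suc a)
    ≡⟨ R.+-identityˡ _ ⟩
  f (suc a) ∎

∑-δ′ : (a : Fin n) (f : Fin n → ℚ) → ∑ (allFin n) (λ x → ι (a ≡ᶠ x) * f x) ≡ f a
∑-δ′ {n} a f = trans (∑-cong (allFin n) (λ x → cong (λ b → ι b * f x) (flip x))) (∑-δ a f)
  where
  flip : ∀ x → (a ≡ᶠ x) ≡ (x ≡ᶠ a)
  flip x with a ≟ x
  ... | yes refl = sym (≡ᶠ-refl x)
  ... | no  a≢x  = sym (≡ᶠ-≢ (λ x≡a → a≢x (sym x≡a)))

-- Relabelling the values of words.

∑-allFin : (f : Fin n → ℚ) → ∑ (allFin n) f ≡ sum f
∑-allFin {zero}  f = ∑-allFin-0 f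
∑-allFin {suc n} f = trans (∑-allFin-suc f) (cong (f zero +_) (∑-allFin (f ∘ suc)))

∑-permute : (π : Permutation′ n) (f : Fin n → ℚ) → ∑ (allFin n) f ≡ ∑ (allFin n) (λ x → f (π ⟨$⟩ʳ x))
∑-permute π f = trans (∑-allFin f) (trans (sum-permute f π) (sym (∑-allFin _)))

∑-words-permute : (π : Permutation′ n) (k : ℕ) (f : Vec (Fin n) k → ℚ) →
  ∑ (allWords (allFin n) k) f ≡ ∑ (allWords (allFin n) k) (λ w → f (Vec.map (π ⟨$⟩ʳ_) w))
∑-words-permute {n} π zero    f = trans (∑-words-0 (allFin n) f) (sym (∑-words-0 (allFin n) _))
∑-words-permute {n} π (suc k) f = begin
  ∑ (allWords (allFin n) (suc k)) f
    ≡⟨ ∑-words-suc (allFin n) k f ⟩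
  ∑ (allFin n) (λ x → ∑ (allWords (allFin n) k) (λ w → f (x ∷ w)))
    ≡⟨ ∑-permute π _ ⟩
  ∑ (allFin n) (λ x → ∑ (allWords (allFin n) k) (λ w → f ((π ⟨$⟩ʳ x) ∷ w)))
    ≡⟨ ∑-cong (allFin n) (λ x → ∑-words-permute π k _) ⟩
  ∑ (allFin n) (λ x → ∑ (allWords (allFin n) k) (λ w → f ((π ⟨$⟩ʳ x) ∷ Vec.map (π ⟨$⟩ʳ_) w)))
    ≡⟨ ∑-words-suc (allFin n) k _ ⟨
  _ ∎

∑-words-δ : (k : ℕ) (g : Fin k → Fin n) (f : Vec (Fin n) k → ℚ) →
  ∑ (allWords (allFin n) k) (λ w → ∏ (λ l → ι (lookup w l ≡ᶠ g l)) * f w) ≡ f (Vec.tabulate g)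
∑-words-δ {n} zero    g f = trans (∑-words-0 (allFin n) _) (R.*-identityˡ _)
∑-words-δ {n} (suc k) g f = begin
  ∑ (allWords (allFin n) (suc k)) (λ w → ∏ (λ l → ι (lookup w l ≡ᶠ g l)) * f w)
    ≡⟨ ∑-words-suc (allFin n) k _ ⟩
  ∑ (allFin n) (λ x → ∑ (allWords (allFin n) k) (λ w → ι (x ≡ᶠ g zero) * p w * f (x ∷ w)))
    ≡⟨ ∑-cong (allFin n) (λ x → trans (∑-cong (allWords (allFin n) k)
        (λ w → R.*-assoc (ι (x ≡ᶠ g zero)) (p w) (f (x ∷ w))))
         (trans (∑-*ˡ (ι (x ≡ᶠ g zero)) _ _) (cong (ι (x ≡ᶠ g zero) *_) (∑-words-δ k (g ∘ suc) _)))) ⟩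
  ∑ (allFin n) (λ x → ι (x ≡ᶠ g zero) * f (x ∷ Vec.tabulate (g ∘ suc)))
    ≡⟨ ∑-δ (g zero) _ ⟩
  _ ∎
  where
  p : Vec (Fin n) k → ℚ
  p w = ∏ (λ l → ι (lookup w l ≡ᶠ g (suc l)))

-- Permutations fixing the positions in S.

distinctAt : Vec (Fin n) n → Fin n → Fin n → Bool
distinctAt w i j = if i <ᶠ j then not (lookup w i ≡ᶠ lookup w j) else true

ι-isPerm : (w : Vec (Fin n) n) → ι (isPerm w) ≡ ∏ (λ i → ∏ (λ j → ι (distinctAt w i j)))
ι-isPerm {n} w = trans (ι-allB {n} _) (∏-cong (λ i → ι-allB (distinctAt w i)))

isPerm-distinct-< : (w : Vec (Fin n) n) (i j : Fin n) → toℕ i ℕ.< toℕ j → (b : Fin n) →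
  ι (isPerm w) * (ι (lookup w i ≡ᶠ b) * ι (lookup w j ≡ᶠ b)) ≡ 0ℚ
isPerm-distinct-< {n} w i j i<j b = trans (cong (_* both) (ι-isPerm w))
  -- The factor of `isPerm` at (i, j) is isolated in both nested products; it vanishes if the two
  -- letters coincide.
  (trans (∏-at _ i (∏-at (λ j → ι (distinctAt w i j)) j clash)) (R.zeroʳ _))
  where
  both = ι (lookup w i ≡ᶠ b) * ι (lookup w j ≡ᶠ b)
  clash : ι (distinctAt w i j) * both ≡ ι (distinctAt w i j) * 0ℚ
  clash rewrite <ᶠ-true i<j with lookup w i ≟ b | lookup w j ≟ b
  ... | no _     | _        = R.*-congˡ (R.zeroˡ _)
  ... | yes _    | no _     = R.*-congˡ (R.zeroʳ _)
  ... | yes wi≡b | yes wj≡b rewrite wi≡b | wj≡b | ≡ᶠ-refl b = trans (R.zeroˡ _) (sym (R.zeroˡ _))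

isPerm-distinct : (w : Vec (Fin n) n) (i j : Fin n) → i ≢ j → (b : Fin n) →
  ι (isPerm w) * (ι (lookup w i ≡ᶠ b) * ι (lookup w j ≡ᶠ b)) ≡ 0ℚ
isPerm-distinct w i j i≢j b with ℕₚ.<-cmp (toℕ i) (toℕ j)
... | tri< i<j _ _ = isPerm-distinct-< w i j i<j b
... | tri≈ _ i≡j _ = contradiction (toℕ-injective i≡j) i≢j
... | tri> _ _ j<i = trans (R.*-congˡ (R.*-comm _ _)) (isPerm-distinct-< w j i j<i b)

≡ᶠ-permute : (π : Permutation′ n) (x y : Fin n) → (π ⟨$⟩ʳ x ≡ᶠ π ⟨$⟩ʳ y) ≡ (x ≡ᶠ y)
≡ᶠ-permute π x y with x ≟ y
... | yes refl = ≡ᶠ-refl _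
... | no  x≢y  = ≡ᶠ-≢ (λ e → x≢y (trans (sym (inverseˡ π)) (trans (cong (π ⟨$⟩ˡ_) e) (inverseˡ π))))

isPerm-map : (π : Permutation′ n) (w : Vec (Fin n) n) → ι (isPerm (Vec.map (π ⟨$⟩ʳ_) w)) ≡ ι (isPerm w)
isPerm-map {n} π w = trans (ι-isPerm (Vec.map (π ⟨$⟩ʳ_) w)) (trans
  (∏-cong (λ i → ∏-cong (λ j → cong (λ b → ι (if i <ᶠ j then not b else true))
    (trans (cong₂ _≡ᶠ_ (lookup-map i (π ⟨$⟩ʳ_) w) (lookup-map j (π ⟨$⟩ʳ_) w)) (≡ᶠ-permute π _ _)))))
  (sym (ι-isPerm w)))

isPerm-id : (n : ℕ) → ι (isPerm (Vec.tabulate {n = n} id)) ≡ 1ℚ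
isPerm-id n = trans (ι-isPerm (Vec.tabulate {n = n} id)) (∏-1 (λ i → ∏-1 (λ j → at i j)))
  where
  at : (i j : Fin n) → ι (distinctAt (Vec.tabulate id) i j) ≡ 1ℚ
  at i j rewrite lookup∘tabulate {A = Fin n} id i | lookup∘tabulate {A = Fin n} id j with toℕ i ℕ.<? toℕ j
  ... | no  _   = refl
  ... | yes i<j = cong (ι ∘ not) (≡ᶠ-≢ {i = i} {j} (λ { refl → ℕₚ.<-irrefl refl i<j }))

fix-pin : (S : Fin n → Bool) (s : Fin n) → S s ≡ true → (w : Vec (Fin n) n) {x y : ℚ} →
          (lookup w s ≡ s → x ≡ y) → fix S w * x ≡ fix S w * y
fix-pin S s Ss w {x} {y} e = ∏-at _ s
  (subst (λ b → (if b then ι (lookup w s ≡ᶠ s) else 1ℚ) * x ≡ (if b then ι (lookup w s ≡ᶠ s) else 1ℚ) * y)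
    (sym Ss) (≡ᶠ-guard (lookup w s) s e))

infixl 5 _∪ᶠ_
_∪ᶠ_ : (Fin n → Bool) → Fin n → Fin n → Bool
(S ∪ᶠ j) l = S l ∨ (l ≡ᶠ j)

fix-∪ : (S : Fin n → Bool) (j : Fin n) → S j ≡ false → (w : Vec (Fin n) n) →
        fix (S ∪ᶠ j) w ≡ fix S w * ι (lookup w j ≡ᶠ j)
fix-∪ S j Sj w = ∏-update _ _ j (ι (lookup w j ≡ᶠ j)) at-j off-j
  where
  at-j : (if S j ∨ (j ≡ᶠ j) then ι (lookup w j ≡ᶠ j) else 1ℚ) ≡
         (if S j then ι (lookup w j ≡ᶠ j) else 1ℚ) * ι (lookup w j ≡ᶠ j)
  at-j rewrite Sj | ≡ᶠ-refl j = sym (R.*-identityˡ _)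
  off-j : ∀ l → l ≢ j → (if S l ∨ (l ≡ᶠ j) then ι (lookup w l ≡ᶠ l) else 1ℚ) ≡
                        (if S l then ι (lookup w l ≡ᶠ l) else 1ℚ)
  off-j l l≢j rewrite ≡ᶠ-≢ l≢j | ∨-identityʳ (S l) = refl

fix-map : (S : Fin n → Bool) (π : Permutation′ n) → (∀ l → S l ≡ true → π ⟨$⟩ʳ l ≡ l) →
          (w : Vec (Fin n) n) → fix S (Vec.map (π ⟨$⟩ʳ_) w) ≡ fix S w
fix-map S π πfix w = ∏-cong at
  where
  at : ∀ l → (if S l then ι (lookup (Vec.map (π ⟨$⟩ʳ_) w) l ≡ᶠ l) else 1ℚ) ≡
             (if S l then ι (lookup w l ≡ᶠ l) else 1ℚ)
  at l with S l in Sl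
  ... | false = refl
  ... | true  = cong ι (trans (cong₂ _≡ᶠ_ (lookup-map l (π ⟨$⟩ʳ_) w) (sym (πfix l Sl))) (≡ᶠ-permute π _ l))

module _ {n : ℕ} where
  private
    W : List (Vec (Fin n) n)
    W = allWords (allFin n) n

  ∑fixing : (Fin n → Bool) → (Vec (Fin n) n → ℚ) → ℚ
  ∑fixing S f = ∑ W (λ w → ι (isPerm w) * fix S w * f w)

  ∑fixing-cong : ∀ S {f g} → (∀ w → f w ≡ g w) → ∑fixing S f ≡ ∑fixing S g
  ∑fixing-cong S e = ∑-cong W (λ w → cong (ι (isPerm w) * fix S w *_) (e w))

  ∑fixing-+ : ∀ S f g → ∑fixing S (λ w → f w + g w) ≡ ∑fixing S f + ∑fixing S g
  ∑fixing-+ S f g = trans (∑-cong W (λ w → R.distribˡ _ (f w) (g w))) (∑-+ W _ _)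

  ∑fixing-*ˡ : ∀ S c f → ∑fixing S (λ w → c * f w) ≡ c * ∑fixing S f
  ∑fixing-*ˡ S c f = trans
    (∑-cong W (λ w → solve 3 (λ p c f → p ⊗ (c ⊗ f) ⊜ c ⊗ (p ⊗ f)) refl (ι (isPerm w) * fix S w) c (f w)))
    (∑-*ˡ c W _)

  ∑fixing-∑ : ∀ S (xs : List A) (f : A → Vec (Fin n) n → ℚ) →
              ∑fixing S (λ w → ∑ xs (λ x → f x w)) ≡ ∑ xs (λ x → ∑fixing S (f x))
  ∑fixing-∑ S xs f = trans (∑-cong W (λ w → sym (∑-*ˡ _ xs _))) (∑-swap W xs _)

  -- `f` takes the letter at s apart from the word, so a chosen occurrence of it can be replaced.
  ∑fixing-pin : ∀ S s → S s ≡ true → (f : Fin n → Vec (Fin n) n → ℚ) →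
                ∑fixing S (λ w → f (lookup w s) w) ≡ ∑fixing S (f s)
  ∑fixing-pin S s Ss f = ∑-cong W (λ w → trans (R.*-assoc (ι (isPerm w)) _ _) (trans
    (cong (ι (isPerm w) *_) (fix-pin S s Ss w (λ e → cong (λ x → f x w) e)))
    (sym (R.*-assoc (ι (isPerm w)) _ _))))

  -- Position b already takes the value b, and a permutation takes it only once.
  ∑fixing-occupied : ∀ S j b → j ≢ b → S b ≡ true → (f : Vec (Fin n) n → ℚ) →
                     ∑fixing S (λ w → ι (lookup w j ≡ᶠ b) * f w) ≡ 0ℚ
  -- Reading `∑fixing-pin` backwards inserts the indicator of w_b = b, which clashes with w_j = b.
  ∑fixing-occupied S j b j≢b Sb f = trans (sym (trans
      (∑fixing-pin S b Sb (λ x w → ι (x ≡ᶠ b) * (ι (lookup w j ≡ᶠ b) * f w)))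
      (∑fixing-cong S (λ w → trans (cong (λ t → ι t * (ι (lookup w j ≡ᶠ b) * f w)) (≡ᶠ-refl b)) (R.*-identityˡ _)))))
    (∑-0 W (λ w → begin
      ι (isPerm w) * fix S w * (ι (lookup w b ≡ᶠ b) * (ι (lookup w j ≡ᶠ b) * f w))
        ≡⟨ solve 5 (λ p x u v f → p ⊗ x ⊗ (u ⊗ (v ⊗ f)) ⊜ p ⊗ (v ⊗ u) ⊗ (x ⊗ f)) refl
             (ι (isPerm w)) (fix S w) (ι (lookup w b ≡ᶠ b)) (ι (lookup w j ≡ᶠ b)) (f w) ⟩
      ι (isPerm w) * (ι (lookup w j ≡ᶠ b) * ι (lookup w b ≡ᶠ b)) * (fix S w * f w)
        ≡⟨ cong (_* (fix S w * f w)) (isPerm-distinct w j b j≢b b) ⟩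
      0ℚ * (fix S w * f w)
        ≡⟨ R.zeroˡ _ ⟩
      0ℚ ∎))

  transpose-fix : (i j l : Fin n) → l ≢ i → l ≢ j → transpose i j ⟨$⟩ʳ l ≡ l
  transpose-fix i j l l≢i l≢j rewrite dec-false (l ≟ i) l≢i | dec-false (l ≟ j) l≢j = refl

  transpose-i : (i j : Fin n) → transpose i j ⟨$⟩ʳ i ≡ j
  transpose-i i j rewrite dec-true (i ≟ i) refl = refl

  -- Swapping the values j and b turns the words with w_j = b into those fixing j.
  ∑fixing-transport : ∀ S j b → S j ≡ false → S b ≡ false → (f : Vec (Fin n) n → ℚ) →
    ∑fixing S (λ w → ι (lookup w j ≡ᶠ b) * f w) ≡
    ∑fixing (S ∪ᶠ j) (λ w → f (Vec.map (transpose j b ⟨$⟩ʳ_) w))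
  ∑fixing-transport S j b Sj Sb f = trans (∑-words-permute π n _) (∑-cong W step)
    where
    π = transpose j b
    S≢ : ∀ {l k} → S l ≡ true → S k ≡ false → l ≢ k
    S≢ Sl Sk refl with trans (sym Sl) Sk
    ... | ()
    step : ∀ w → _
    step w = begin
      ι (isPerm πw) * fix S πw * (ι (lookup πw j ≡ᶠ b) * f πw)
        ≡⟨ cong₂ _*_ (cong₂ _*_ (isPerm-map π w) (fix-map S π (λ l Sl → transpose-fix j b l (S≢ Sl Sj) (S≢ Sl Sb)) w))
             (cong (λ t → ι t * f πw) (trans (cong₂ _≡ᶠ_ (lookup-map j (π ⟨$⟩ʳ_) w) (sym (transpose-i j b)))
               (≡ᶠ-permute π (lookup w j) j))) ⟩
      ι (isPerm w) * fix S w * (ι (lookup w j ≡ᶠ j) * f πw)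
        ≡⟨ solve 4 (λ p x u f → p ⊗ x ⊗ (u ⊗ f) ⊜ p ⊗ (x ⊗ u) ⊗ f)
            refl (ι (isPerm w)) (fix S w) (ι (lookup w j ≡ᶠ j)) (f πw) ⟩
      ι (isPerm w) * (fix S w * ι (lookup w j ≡ᶠ j)) * f πw
        ≡⟨ cong (λ x → ι (isPerm w) * x * f πw) (fix-∪ S j Sj w) ⟨
      ι (isPerm w) * fix (S ∪ᶠ j) w * f πw ∎
      where πw = Vec.map (π ⟨$⟩ʳ_) w

  ∑fixing-split : ∀ S j (f : Fin n → Vec (Fin n) n → ℚ) →
    ∑fixing S (λ w → f (lookup w j) w) ≡ ∑ (allFin n) (λ b → ∑fixing S (λ w → ι (lookup w j ≡ᶠ b) * f b w))
  ∑fixing-split S j f = trans (∑fixing-cong S (λ w → sym (∑-δ′ (lookup w j) (λ b → f b w))))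
      (∑fixing-∑ S (allFin n) _)

-- Counting permutations with prescribed values.

cnt-cong : {S T : Fin n → Bool} → (∀ l → S l ≡ T l) → cnt S ≡ cnt T
cnt-cong {zero}  S≗T = refl
cnt-cong {suc n} S≗T = cong₂ (λ b m → if b then m else suc m) (S≗T zero) (cnt-cong (S≗T ∘ suc))

cnt-∪ : (S : Fin n → Bool) (j : Fin n) → S j ≡ false → cnt S ≡ suc (cnt (S ∪ᶠ j))
cnt-∪ S zero    Sj rewrite Sj = cong suc (cnt-cong (λ l → sym (∨-identityʳ (S (suc l)))))
cnt-∪ S (suc j) Sj with cnt-∪ (S ∘ suc) j Sj | cnt-cong (λ l → cong (S (suc l) ∨_) (≡ᶠ-suc l j))
... | ih | e rewrite e with S zero
... | true  = ih
... | false = cong suc ih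

cnt-0 : (S : Fin n → Bool) → cnt S ≡ 0 → ∀ l → S l ≡ true
cnt-0 S e l with S l in Sl
... | true  = refl
... | false with trans (sym e) (cnt-∪ S l Sl)
...   | ()

cnt-suc : (S : Fin n → Bool) {m : ℕ} → cnt S ≡ suc m → ∃ λ j → S j ≡ false
cnt-suc {suc n} S e with S zero in S0
... | false = zero , S0
... | true  with cnt-suc (S ∘ suc) e
...   | j , Sj = suc j , Sj

S≢ : (S : Fin n → Bool) {l k : Fin n} → S l ≡ false → S k ≡ true → l ≢ k
S≢ S Sl Sk refl with trans (sym Sl) Sk
... | ()

∪-self : (S : Fin n → Bool) (j : Fin n) → (S ∪ᶠ j) j ≡ true
∪-self S j = trans (cong (S j ∨_) (≡ᶠ-refl j)) (∨-zeroʳ (S j))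

∪-other : (S : Fin n → Bool) (j : Fin n) {l : Fin n} → l ≢ j → (S ∪ᶠ j) l ≡ S l
∪-other S j l≢j = trans (cong (S _ ∨_) (≡ᶠ-≢ l≢j)) (∨-identityʳ (S _))

-- Either b is occupied and nothing remains, or swapping values turns j into one more fixed point,
-- whatever the free value b was.
∑fixing-one-point′ : (S : Fin n → Bool) (j b : Fin n) → S j ≡ false →
  ∑fixing S (λ w → ι (lookup w j ≡ᶠ b)) ≡ ι (not (S b)) * ∑fixing (S ∪ᶠ j) (λ _ → 1ℚ)
∑fixing-one-point′ S j b Sj = trans (∑fixing-cong S (λ w → sym (R.*-identityʳ _))) (lem (S b) refl)
  where
  lem : ∀ t → S b ≡ t → ∑fixing S (λ w → ι (lookup w j ≡ᶠ b) * 1ℚ) ≡ ι (not t) * ∑fixing (S ∪ᶠ j) (λ _ → 1ℚ)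
  lem true  Sb = trans (∑fixing-occupied S j b (S≢ S Sj Sb) Sb _) (sym (R.zeroˡ _))
  lem false Sb = trans (∑fixing-transport S j b Sj Sb _) (sym (R.*-identityˡ _))

-- Split by the value at a free position j: each of the m free values leaves the count for S
-- together with j. When nothing is free, only the identity is left.
∑fixing-1 : (m : ℕ) (S : Fin n → Bool) → cnt S ≡ m → ∑fixing S (λ _ → 1ℚ) ≡ # (m !)
∑fixing-1 {n} zero S e = begin
  ∑fixing S (λ _ → 1ℚ)
    ≡⟨ ∑-cong (allWords (allFin n) n) (λ w → trans (R.*-identityʳ _) (trans (R.*-comm _ _)
         (cong (_* ι (isPerm w)) (∏-cong (λ l → cong (λ b → if b then ι (lookup w l ≡ᶠ l) else 1ℚ)
             (cnt-0 S e l)))))) ⟩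
  ∑ (allWords (allFin n) n) (λ w → ∏ (λ l → ι (lookup w l ≡ᶠ l)) * ι (isPerm w))
    ≡⟨ ∑-words-δ n id (λ w → ι (isPerm w)) ⟩
  ι (isPerm (Vec.tabulate {n = n} id))
    ≡⟨ trans (isPerm-id n) (sym #-1) ⟩
  # 1 ∎
∑fixing-1 {n} (suc m) S e with cnt-suc S e
... | j , Sj = begin
  ∑fixing S (λ _ → 1ℚ)
    ≡⟨ ∑fixing-split S j (λ _ _ → 1ℚ) ⟩
  ∑ (allFin n) (λ b → ∑fixing S (λ w → ι (lookup w j ≡ᶠ b) * 1ℚ))
    ≡⟨ ∑-cong (allFin n) (λ b → trans (∑fixing-cong S (λ w → R.*-identityʳ _)) (∑fixing-one-point′ S j b Sj)) ⟩
  ∑ (allFin n) (λ b → ι (not (S b)) * ∑fixing (S ∪ᶠ j) (λ _ → 1ℚ))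
    ≡⟨ ∑-*ʳ (allFin n) _ _ ⟩
  ∑ (allFin n) (λ b → ι (not (S b))) * ∑fixing (S ∪ᶠ j) (λ _ → 1ℚ)
    ≡⟨ cong₂ _*_ (trans (sym (#-cnt S)) (cong # e))
        (∑fixing-1 m (S ∪ᶠ j) (ℕₚ.suc-injective (trans (sym (cnt-∪ S j Sj)) e))) ⟩
  # (suc m) * # (m !)
    ≡⟨ #-* (suc m) (m !) ⟨
  # (suc m !) ∎

∑fixing-one-point : (S : Fin n → Bool) (j b : Fin n) → S j ≡ false →
  ∑fixing S (λ w → ι (lookup w j ≡ᶠ b)) ≡ ι (not (S b)) * # ((cnt S ∸ 1) !)
∑fixing-one-point S j b Sj = trans (∑fixing-one-point′ S j b Sj)
  (cong (ι (not (S b)) *_) (∑fixing-1 (cnt S ∸ 1) (S ∪ᶠ j) (sym (cong (_∸ 1) (cnt-∪ S j Sj)))))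

-- For free b, transport makes j a fixed point and pulls a back along the transposition. The
-- preimage is free for the enlarged set exactly when a is free for S and differs from b, so the
-- one-point count finishes.
∑fixing-two-point : (S : Fin n → Bool) (i j a b : Fin n) → i ≢ j → S i ≡ false → S j ≡ false →
  ∑fixing S (λ w → ι (lookup w j ≡ᶠ b) * ι (lookup w i ≡ᶠ a)) ≡
  ι (not (S a)) * ι (not (S b)) * ι (not (a ≡ᶠ b)) * # ((cnt S ∸ 2) !)
∑fixing-two-point {n} S i j a b i≢j Si Sj = lem (S b) refl
  where
  F = # ((cnt S ∸ 2) !)
  π = transpose j b
  Sji : (S ∪ᶠ j) i ≡ false
  Sji = trans (∪-other S j i≢j) Si
  π⁻¹a : ∀ {x} → π ⟨$⟩ʳ x ≡ a → π ⟨$⟩ˡ a ≡ x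
  π⁻¹a e = trans (cong (π ⟨$⟩ˡ_) (sym e)) (inverseˡ π)
  free : S b ≡ false → Dec (a ≡ b) → Dec (a ≡ j) →
         ι (not ((S ∪ᶠ j) (π ⟨$⟩ˡ a))) ≡ ι (not (S a)) * 1ℚ * ι (not (a ≡ᶠ b))
  free Sb (yes a≡b) _ = begin
    ι (not ((S ∪ᶠ j) (π ⟨$⟩ˡ a)))
      ≡⟨ cong (ι ∘ not) (trans (cong (S ∪ᶠ j) (π⁻¹a (trans (transpose-i j b) (sym a≡b)))) (∪-self S j)) ⟩
    0ℚ
      ≡⟨ R.zeroʳ _ ⟨
    ι (not (S a)) * 1ℚ * 0ℚ
      ≡⟨ cong (λ t → ι (not (S a)) * 1ℚ * ι (not t)) (trans (cong (_≡ᶠ b) a≡b) (≡ᶠ-refl b)) ⟨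
    _ ∎
  free Sb (no a≢b) a≟j = begin
    ι (not ((S ∪ᶠ j) (π ⟨$⟩ˡ a)))
      ≡⟨ cong (ι ∘ not) (moved a≟j) ⟩
    ι (not (S a))
      ≡⟨ trans (R.*-identityʳ _) (R.*-identityʳ _) ⟨
    ι (not (S a)) * 1ℚ * 1ℚ
      ≡⟨ cong (λ t → ι (not (S a)) * 1ℚ * ι (not t)) (≡ᶠ-≢ a≢b) ⟨
    _ ∎
    where
    moved : Dec (a ≡ j) → (S ∪ᶠ j) (π ⟨$⟩ˡ a) ≡ S a
    moved (no a≢j)  = trans (cong (S ∪ᶠ j) (π⁻¹a (transpose-fix j b a a≢j a≢b))) (∪-other S j a≢j)
    -- The swap sends b to j = a, so the preimage of a is b, which is free and different from j.
    moved (yes a≡j) = begin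
      (S ∪ᶠ j) (π ⟨$⟩ˡ a)  ≡⟨ cong (S ∪ᶠ j) (π⁻¹a πb≡a) ⟩
      (S ∪ᶠ j) b           ≡⟨ ∪-other S j b≢j ⟩
      S b                  ≡⟨ trans Sb (sym Sj) ⟩
      S j                  ≡⟨ cong S a≡j ⟨
      S a                  ∎
      where
      b≢j : b ≢ j
      b≢j b≡j = a≢b (trans a≡j (sym b≡j))
      πb≡a : π ⟨$⟩ʳ b ≡ a
      πb≡a rewrite dec-false (b ≟ j) b≢j | dec-true (b ≟ b) refl = sym a≡j
  lem : ∀ t → S b ≡ t → ∑fixing S (λ w → ι (lookup w j ≡ᶠ b) * ι (lookup w i ≡ᶠ a)) ≡
                        ι (not (S a)) * ι (not t) * ι (not (a ≡ᶠ b)) * F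
  lem true  Sb = trans (∑fixing-occupied S j b (S≢ S Sj Sb) Sb _)
    (solve 3 (λ x y f → con 0ℚ ⊜ x ⊗ con 0ℚ ⊗ y ⊗ f) refl (ι (not (S a))) (ι (not (a ≡ᶠ b))) F)
  lem false Sb = begin
    ∑fixing S (λ w → ι (lookup w j ≡ᶠ b) * ι (lookup w i ≡ᶠ a))
      ≡⟨ ∑fixing-transport S j b Sj Sb _ ⟩
    ∑fixing (S ∪ᶠ j) (λ w → ι (lookup (Vec.map (π ⟨$⟩ʳ_) w) i ≡ᶠ a))
      ≡⟨ ∑fixing-cong (S ∪ᶠ j) (λ w → cong ι (trans (cong₂ _≡ᶠ_ (lookup-map i (π ⟨$⟩ʳ_) w) (sym (inverseʳ π)))
          (≡ᶠ-permute π (lookup w i) (π ⟨$⟩ˡ a)))) ⟩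
    ∑fixing (S ∪ᶠ j) (λ w → ι (lookup w i ≡ᶠ π ⟨$⟩ˡ a))
      ≡⟨ ∑fixing-one-point (S ∪ᶠ j) i (π ⟨$⟩ˡ a) Sji ⟩
    ι (not ((S ∪ᶠ j) (π ⟨$⟩ˡ a))) * # ((cnt (S ∪ᶠ j) ∸ 1) !)
      ≡⟨ cong₂ _*_ (free Sb (a ≟ b) (a ≟ j)) (cong (λ m → # ((m ∸ 2) !)) (sym (cnt-∪ S j Sj))) ⟩
    ι (not (S a)) * 1ℚ * ι (not (a ≡ᶠ b)) * F ∎

-- The pair statistic summed over the permutations fixing S.

below above : (Fin n → Bool) → Fin n → ℚ
below {n} S x = ∑ (allFin n) (λ b → ι (not (S b)) * ι (b <ᶠ x))
above {n} S x = ∑ (allFin n) (λ b → ι (not (S b)) * ι (x <ᶠ b))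

-- `fixedBetween` is Σ L_s G_s and `fixedAbove²` is Σ G_s² over s in S; Σ G_s is needed for the
-- recursion of `fixedBetween`.
freePairs fixedAbove fixedBetween fixedAbove² : (Fin n → Bool) → ℚ
freePairs    {n} S = ∑ (allFin n) (λ i → ι (not (S i)) * above S i)
fixedAbove   {n} S = ∑ (allFin n) (λ i → ι (S i) * above S i)
fixedBetween {n} S = ∑ (allFin n) (λ i → ι (S i) * (below S i * above S i))
fixedAbove²  {n} S = ∑ (allFin n) (λ i → ι (S i) * (above S i * above S i))

<ᶠ-≢ : (a b : Fin n) → ι (b <ᶠ a) * ι (not (a ≡ᶠ b)) ≡ ι (b <ᶠ a) * 1ℚ
<ᶠ-≢ a b = <ᶠ-guard b a (λ b<a → cong (ι ∘ not) (≡ᶠ-≢ {i = a} {b} (λ { refl → ℕₚ.<-irrefl refl b<a })))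

<ᶠ-≢′ : (a b : Fin n) → ι (a <ᶠ b) * ι (not (a ≡ᶠ b)) ≡ ι (a <ᶠ b) * 1ℚ
<ᶠ-≢′ a b = <ᶠ-guard a b (λ a<b → cong (ι ∘ not) (≡ᶠ-≢ {i = a} {b} (λ { refl → ℕₚ.<-irrefl refl a<b })))

module _ {n : ℕ} (d : ℕ) (S : Fin n → Bool) where
  private
    F = allFin n
    -- Truncated subtraction does no harm: `f₁` and `f₂` arise when one or two free positions exist,
    -- or else stand beside a factor 0.
    f₁ = # ((cnt S ∸ 1) !)
    f₂ = # ((cnt S ∸ 2) !)
    D = # d
    ν s : Fin n → ℚ
    ν i = ι (not (S i))
    s i = ι (S i)
    G = above S
    L = below S
    P = freePairs S

  -- The values form any ordered pair of distinct free letters; P of these pairs are inverted and P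
  -- ascend with weight D.
  free-free : (i j : Fin n) → i ≢ j → S i ≡ false → S j ≡ false →
    ∑fixing S (λ w → κ d false (lookup w i) (lookup w j)) ≡ f₂ * ((1ℚ + D) * P)
  free-free i j i≢j Si Sj = begin
    ∑fixing S (λ w → κ d false (lookup w i) (lookup w j))
      ≡⟨ ∑fixing-split S j (λ b w → κ d false (lookup w i) b) ⟩
    ∑ F (λ b → ∑fixing S (λ w → ι (lookup w j ≡ᶠ b) * κ d false (lookup w i) b))
      ≡⟨ ∑-cong F (λ b → ∑fixing-split S i (λ a w → ι (lookup w j ≡ᶠ b) * κ d false a b)) ⟩
    ∑ F (λ b → ∑ F (λ a → ∑fixing S (λ w → ι (lookup w i ≡ᶠ a) * (ι (lookup w j ≡ᶠ b) * κ d false a b))))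
      ≡⟨ ∑-cong F (λ b → ∑-cong F (λ a → trans
           (∑fixing-cong S (λ w → solve 3 (λ x y k → x ⊗ (y ⊗ k) ⊜ k ⊗ (y ⊗ x)) refl
             (ι (lookup w i ≡ᶠ a)) (ι (lookup w j ≡ᶠ b)) (κ d false a b)))
           (trans (∑fixing-*ˡ S (κ d false a b) _)
               (cong (κ d false a b *_) (∑fixing-two-point S i j a b i≢j Si Sj))))) ⟩
    ∑ F (λ b → ∑ F (λ a → κ d false a b * (ν a * ν b * ι (not (a ≡ᶠ b)) * f₂)))
      ≡⟨ ∑-cong F (λ b → ∑-cong F (λ a → begin
           (ι (b <ᶠ a) + D * (1ℚ * ι (a <ᶠ b))) * (ν a * ν b * ι (not (a ≡ᶠ b)) * f₂)
             ≡⟨ solve 7 (λ u v d x y e f → (u ⊕ d ⊗ (con 1ℚ ⊗ v)) ⊗ (x ⊗ y ⊗ e ⊗ f) ⊜ f ⊗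
                 (x ⊗ y ⊗ (u ⊗ e) ⊕ d ⊗ (x ⊗ y ⊗ (v ⊗ e)))) refl
                  (ι (b <ᶠ a)) (ι (a <ᶠ b)) D (ν a) (ν b) (ι (not (a ≡ᶠ b))) f₂ ⟩
           f₂ * (ν a * ν b * (ι (b <ᶠ a) * ι (not (a ≡ᶠ b))) + D * (ν a * ν b * (ι (a <ᶠ b) * ι (not (a ≡ᶠ b)))))
             ≡⟨ cong₂ (λ x y → f₂ * (ν a * ν b * x + D * (ν a * ν b * y))) (<ᶠ-≢ a b) (<ᶠ-≢′ a b) ⟩
           f₂ * (ν a * ν b * (ι (b <ᶠ a) * 1ℚ) + D * (ν a * ν b * (ι (a <ᶠ b) * 1ℚ)))
             ≡⟨ solve 6 (λ u v d x y f → f ⊗ (x ⊗ y ⊗ (u ⊗ con 1ℚ) ⊕ d ⊗ (x ⊗ y ⊗ (v ⊗ con 1ℚ))) ⊜ f ⊗ (y ⊗ (x ⊗ u)) ⊕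
                 f ⊗ d ⊗ (x ⊗ (y ⊗ v))) refl
                  (ι (b <ᶠ a)) (ι (a <ᶠ b)) D (ν a) (ν b) f₂ ⟩
           f₂ * (ν b * (ν a * ι (b <ᶠ a))) + f₂ * D * (ν a * (ν b * ι (a <ᶠ b))) ∎)) ⟩
    ∑ F (λ b → ∑ F (λ a → f₂ * (ν b * (ν a * ι (b <ᶠ a))) + f₂ * D * (ν a * (ν b * ι (a <ᶠ b)))))
      ≡⟨ trans (∑-cong F (λ b → ∑-+ F _ _)) (∑-+ F _ _) ⟩
    ∑ F (λ b → ∑ F (λ a → f₂ * (ν b * (ν a * ι (b <ᶠ a))))) +
        ∑ F (λ b → ∑ F (λ a → f₂ * D * (ν a * (ν b * ι (a <ᶠ b)))))
      ≡⟨ cong₂ _+_ (collect f₂) (trans (∑-swap F F _) (collect (f₂ * D))) ⟩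
    f₂ * P + f₂ * D * P
      ≡⟨ solve 3 (λ f d p → f ⊗ p ⊕ f ⊗ d ⊗ p ⊜ f ⊗ ((con 1ℚ ⊕ d) ⊗ p)) refl f₂ D P ⟩
    f₂ * ((1ℚ + D) * P) ∎
    where
    collect : ∀ r → ∑ F (λ b → ∑ F (λ a → r * (ν b * (ν a * ι (b <ᶠ a))))) ≡ r * P
    collect r = trans (∑-cong F (λ b → trans (∑-*ˡ r F _) (cong (r *_) (∑-*ˡ (ν b) F _)))) (∑-*ˡ r F _)

  -- Position i carries the value i, so `L i` free values to its right give an inversion and `G i`
  -- an ascent of weight D.
  pinned-free : (i j : Fin n) → S i ≡ true → S j ≡ false →
    ∑fixing S (λ w → κ d false (lookup w i) (lookup w j)) ≡ f₁ * (L i + D * G i)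
  pinned-free i j Si Sj = begin
    ∑fixing S (λ w → κ d false (lookup w i) (lookup w j))
      ≡⟨ ∑fixing-pin S i Si (λ x w → κ d false x (lookup w j)) ⟩
    ∑fixing S (λ w → κ d false i (lookup w j))
      ≡⟨ ∑fixing-split S j (λ b w → κ d false i b) ⟩
    ∑ F (λ b → ∑fixing S (λ w → ι (lookup w j ≡ᶠ b) * κ d false i b))
      ≡⟨ ∑-cong F (λ b → begin
           ∑fixing S (λ w → ι (lookup w j ≡ᶠ b) * κ d false i b)
             ≡⟨ trans (∑fixing-cong S (λ w → R.*-comm _ _)) (∑fixing-*ˡ S (κ d false i b) _) ⟩
           κ d false i b * ∑fixing S (λ w → ι (lookup w j ≡ᶠ b))
             ≡⟨ cong (κ d false i b *_) (∑fixing-one-point S j b Sj) ⟩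
           κ d false i b * (ν b * f₁)
             ≡⟨ solve 5 (λ u v d x f → (u ⊕ d ⊗ (con 1ℚ ⊗ v)) ⊗ (x ⊗ f) ⊜ f ⊗ (x ⊗ u) ⊕ f ⊗ d ⊗ (x ⊗ v)) refl
                  (ι (b <ᶠ i)) (ι (i <ᶠ b)) D (ν b) f₁ ⟩
           f₁ * (ν b * ι (b <ᶠ i)) + f₁ * D * (ν b * ι (i <ᶠ b)) ∎) ⟩
    ∑ F (λ b → f₁ * (ν b * ι (b <ᶠ i)) + f₁ * D * (ν b * ι (i <ᶠ b)))
      ≡⟨ trans (∑-+ F _ _) (cong₂ _+_ (∑-*ˡ f₁ F _) (∑-*ˡ (f₁ * D) F _)) ⟩
    f₁ * L i + f₁ * D * G i
      ≡⟨ solve 4 (λ f l d g → f ⊗ l ⊕ f ⊗ d ⊗ g ⊜ f ⊗ (l ⊕ d ⊗ g)) refl f₁ (L i) D (G i) ⟩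
    f₁ * (L i + D * G i) ∎

  -- Position j carries the value j in color 0, so ascents cost nothing and only the `G j` larger
  -- free values count.
  free-pinned : (i j : Fin n) → S i ≡ false → S j ≡ true →
    ∑fixing S (λ w → κ d true (lookup w i) (lookup w j)) ≡ f₁ * G j
  free-pinned i j Si Sj = begin
    ∑fixing S (λ w → κ d true (lookup w i) (lookup w j))
      ≡⟨ ∑fixing-pin S j Sj (λ x w → κ d true (lookup w i) x) ⟩
    ∑fixing S (λ w → κ d true (lookup w i) j)
      ≡⟨ ∑fixing-split S i (λ a w → κ d true a j) ⟩
    ∑ F (λ a → ∑fixing S (λ w → ι (lookup w i ≡ᶠ a) * κ d true a j))
      ≡⟨ ∑-cong F (λ a → begin
           ∑fixing S (λ w → ι (lookup w i ≡ᶠ a) * κ d true a j)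
             ≡⟨ trans (∑fixing-cong S (λ w → R.*-comm _ _)) (∑fixing-*ˡ S (κ d true a j) _) ⟩
           κ d true a j * ∑fixing S (λ w → ι (lookup w i ≡ᶠ a))
             ≡⟨ cong (κ d true a j *_) (∑fixing-one-point S i a Si) ⟩
           κ d true a j * (ν a * f₁)
             ≡⟨ solve 5 (λ u v d x f → (u ⊕ d ⊗ (con 0ℚ ⊗ v)) ⊗ (x ⊗ f) ⊜ f ⊗ (x ⊗ u)) refl
                  (ι (j <ᶠ a)) (ι (a <ᶠ j)) D (ν a) f₁ ⟩
           f₁ * (ν a * ι (j <ᶠ a)) ∎) ⟩
    ∑ F (λ a → f₁ * (ν a * ι (j <ᶠ a)))
      ≡⟨ ∑-*ˡ f₁ F _ ⟩
    f₁ * G j ∎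

  pinned-pinned : (i j : Fin n) → toℕ i ℕ.< toℕ j → S i ≡ true → S j ≡ true →
    ∑fixing S (λ w → κ d true (lookup w i) (lookup w j)) ≡ 0ℚ
  pinned-pinned i j i<j Si Sj = begin
    ∑fixing S (λ w → κ d true (lookup w i) (lookup w j))
      ≡⟨ ∑fixing-pin S i Si (λ x w → κ d true x (lookup w j)) ⟩
    ∑fixing S (λ w → κ d true i (lookup w j))
      ≡⟨ ∑fixing-pin S j Sj (λ x w → κ d true i x) ⟩
    ∑fixing S (λ w → κ d true i j)
      ≡⟨ ∑-0 (allWords F n) (λ w → trans (cong (_ *_) κ≡0) (R.zeroʳ _)) ⟩
    0ℚ ∎
    where
    κ≡0 : κ d true i j ≡ 0ℚ
    κ≡0 = trans (cong (λ b → ι b + D * (0ℚ * ι (i <ᶠ j))) (<ᶠ-false {i = j} {i} (ℕₚ.<-asym i<j)))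
      (solve 2 (λ d u → con 0ℚ ⊕ d ⊗ (con 0ℚ ⊗ u) ⊜ con 0ℚ) refl D (ι (i <ᶠ j)))

  pair-total : (i j : Fin n) → toℕ i ℕ.< toℕ j →
    ∑fixing S (λ w → κ d (S j) (lookup w i) (lookup w j)) ≡
    ν i * ν j * (f₂ * ((1ℚ + D) * P)) + s i * ν j * (f₁ * (L i + D * G i)) + ν i * s j * (f₁ * G j)
  pair-total i j i<j = cases (S i) (S j) refl refl
    where
    x = f₂ * ((1ℚ + D) * P)
    y = f₁ * (L i + D * G i)
    z = f₁ * G j
    cases : ∀ p q → S i ≡ p → S j ≡ q →
      ∑fixing S (λ w → κ d q (lookup w i) (lookup w j)) ≡
      ι (not p) * ι (not q) * x + ι p * ι (not q) * y + ι (not p) * ι q * z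
    cases false false Si Sj = trans (free-free i j (λ { refl → ℕₚ.<-irrefl refl i<j }) Si Sj)
      (solve 3 (λ x y z → x ⊜ con 1ℚ ⊗ con 1ℚ ⊗ x ⊕ con 0ℚ ⊗ con 1ℚ ⊗ y ⊕ con 1ℚ ⊗ con 0ℚ ⊗ z) refl x y z)
    cases true  false Si Sj = trans (pinned-free i j Si Sj)
      (solve 3 (λ x y z → y ⊜ con 0ℚ ⊗ con 1ℚ ⊗ x ⊕ con 1ℚ ⊗ con 1ℚ ⊗ y ⊕ con 0ℚ ⊗ con 0ℚ ⊗ z) refl x y z)
    cases false true  Si Sj = trans (free-pinned i j Si Sj)
      (solve 3 (λ x y z → z ⊜ con 1ℚ ⊗ con 0ℚ ⊗ x ⊕ con 0ℚ ⊗ con 0ℚ ⊗ y ⊕ con 1ℚ ⊗ con 1ℚ ⊗ z) refl x y z)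
    cases true  true  Si Sj = trans (pinned-pinned i j i<j Si Sj)
      (solve 3 (λ x y z → con 0ℚ ⊜ con 0ℚ ⊗ con 0ℚ ⊗ x ⊕ con 1ℚ ⊗ con 0ℚ ⊗ y ⊕ con 0ℚ ⊗ con 1ℚ ⊗ z) refl x y z)

  -- P enters once through positions and once through values. `fixedBetween` arises twice: s is the
  -- left end of `G s` pairs with `L s` inverting values each, and the right end of `L s` pairs with
  -- `G s` inverting values each.
  ∑fixing-pairSum : ∑fixing S (pairSum d S) ≡
    f₂ * ((1ℚ + D) * (P * P)) + f₁ * (fixedBetween S + fixedBetween S + D * fixedAbove² S)
  ∑fixing-pairSum = begin
    ∑fixing S (pairSum d S)
      ≡⟨ trans (∑fixing-∑ S F _) (∑-cong F (λ i → trans (∑fixing-∑ S F _) (∑-cong F (λ j →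
           trans (∑fixing-*ˡ S (ι (i <ᶠ j)) _) (<ᶠ-guard i j (pair-total i j)))))) ⟩
    ∑ F (λ i → ∑ F (λ j → ι (i <ᶠ j) * (ν i * ν j * x + s i * ν j * (f₁ * y i) + ν i * s j * (f₁ * G j))))
      ≡⟨ ∑-cong F (λ i → ∑-cong F (λ j →
           solve 9 (λ l a b s r x f y g → l ⊗ (a ⊗ b ⊗ x ⊕ s ⊗ b ⊗ (f ⊗ y) ⊕ a ⊗ r ⊗ (f ⊗ g)) ⊜
                                   x ⊗ (a ⊗ (b ⊗ l)) ⊕ f ⊗ (s ⊗ y ⊗ (b ⊗ l)) ⊕ f ⊗ (r ⊗ g ⊗ (a ⊗ l))) refl
             (ι (i <ᶠ j)) (ν i) (ν j) (s i) (s j) x f₁ (y i) (G j))) ⟩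
    ∑ F (λ i → ∑ F (λ j → x * (ν i * (ν j * ι (i <ᶠ j))) + f₁ * (s i * y i * (ν j * ι (i <ᶠ j))) + f₁ *
        (s j * G j * (ν i * ι (i <ᶠ j)))))
      ≡⟨ trans (∑-cong F (λ i → trans (∑-+ F _ _)
          (cong (_+ ∑ F (λ j → f₁ * (s j * G j * (ν i * ι (i <ᶠ j))))) (∑-+ F _ _))))
           (trans (∑-+ F _ _) (cong (_+ ∑ F (λ i → ∑ F (λ j → f₁ * (s j * G j * (ν i * ι (i <ᶠ j)))))) (∑-+ F _ _))) ⟩
    ∑ F (λ i → ∑ F (λ j → x * (ν i * (ν j * ι (i <ᶠ j))))) +
    ∑ F (λ i → ∑ F (λ j → f₁ * (s i * y i * (ν j * ι (i <ᶠ j))))) +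
    ∑ F (λ i → ∑ F (λ j → f₁ * (s j * G j * (ν i * ι (i <ᶠ j)))))
      ≡⟨ cong₂ _+_ (cong₂ _+_ (inner x ν ν (λ i j → ι (i <ᶠ j))) (inner f₁ (λ i → s i * y i) ν (λ i j → ι (i <ᶠ j))))
           (trans (∑-swap F F _) (inner f₁ (λ j → s j * G j) ν (λ j i → ι (i <ᶠ j)))) ⟩
    x * P + f₁ * ∑ F (λ i → s i * y i * G i) + f₁ * ∑ F (λ j → s j * G j * L j)
      ≡⟨ cong₂ (λ u v → x * P + f₁ * u + f₁ * v)
           (trans (∑-cong F (λ i → solve 4 (λ s l d g → s ⊗ (l ⊕ d ⊗ g) ⊗ g ⊜ s ⊗ (l ⊗ g) ⊕ d ⊗ (s ⊗ (g ⊗ g)))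
               refl (s i) (L i) D (G i)))
             (trans (∑-+ F _ _) (cong (fixedBetween S +_) (∑-*ˡ D F _))))
           (∑-cong F (λ j → solve 3 (λ s g l → s ⊗ g ⊗ l ⊜ s ⊗ (l ⊗ g)) refl (s j) (G j) (L j))) ⟩
    x * P + f₁ * (fixedBetween S + D * fixedAbove² S) + f₁ * fixedBetween S
      ≡⟨ solve 6 (λ f p d g e v → f ⊗ ((con 1ℚ ⊕ d) ⊗ p) ⊗ p ⊕ g ⊗ (e ⊕ d ⊗ v) ⊕ g ⊗ e ⊜
                               f ⊗ ((con 1ℚ ⊕ d) ⊗ (p ⊗ p)) ⊕ g ⊗ (e ⊕ e ⊕ d ⊗ v)) refl
           f₂ P D f₁ (fixedBetween S) (fixedAbove² S) ⟩
    _ ∎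
    where
    x = f₂ * ((1ℚ + D) * P)
    y : Fin n → ℚ
    y i = L i + D * G i
    inner : ∀ r (u v : Fin n → ℚ) (l : Fin n → Fin n → ℚ) →
            ∑ F (λ i → ∑ F (λ j → r * (u i * (v j * l i j)))) ≡ r * ∑ F (λ i → u i * ∑ F (λ j → v j * l i j))
    inner r u v l = trans (∑-cong F (λ i → trans (∑-*ˡ r F _) (cong (r *_) (∑-*ˡ (u i) F _)))) (∑-*ˡ r F _)

-- Recursions on the first letter of the set.

above-zero : (S : Fin (suc n) → Bool) → above S zero ≡ # (cnt (S ∘ suc))
above-zero {n} S = begin
  above S zero
    ≡⟨ ∑-allFin-suc {n} _ ⟩
  ι (not (S zero)) * 0ℚ + ∑ (allFin n) (λ b → ι (not (S (suc b))) * 1ℚ)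
    ≡⟨ cong₂ _+_ (R.zeroʳ _) (∑-cong (allFin n) (λ b → R.*-identityʳ _)) ⟩
  0ℚ + ∑ (allFin n) (λ b → ι (not (S (suc b))))
    ≡⟨ trans (R.+-identityˡ _) (sym (#-cnt (S ∘ suc))) ⟩
  # (cnt (S ∘ suc)) ∎

above-suc : (S : Fin (suc n) → Bool) (i : Fin n) → above S (suc i) ≡ above (S ∘ suc) i
above-suc {n} S i = trans (∑-allFin-suc {n} _) (trans
  (cong₂ _+_ (R.zeroʳ _) (∑-cong (allFin n) (λ b → cong (λ u → ι (not (S (suc b))) * ι u) (<ᶠ-suc i b))))
  (R.+-identityˡ _))

below-zero : (S : Fin (suc n) → Bool) → below S zero ≡ 0ℚ
below-zero {n} S = ∑-0 (allFin (suc n)) (λ b → R.zeroʳ _)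

below-suc : (S : Fin (suc n) → Bool) (i : Fin n) → below S (suc i) ≡ ι (not (S zero)) + below (S ∘ suc) i
below-suc {n} S i = trans (∑-allFin-suc {n} _)
  (cong₂ _+_ (R.*-identityʳ _) (∑-cong (allFin n) (λ b → cong (λ u → ι (not (S (suc b))) * ι u) (<ᶠ-suc b i))))

freePairs-suc : (S : Fin (suc n) → Bool) →
  freePairs S ≡ ι (not (S zero)) * # (cnt (S ∘ suc)) + freePairs (S ∘ suc)
freePairs-suc {n} S = trans (∑-allFin-suc {n} _)
  (cong₂ _+_ (cong (ι (not (S zero)) *_) (above-zero S)) (∑-cong (allFin n) (λ i → R.*-congˡ (above-suc S i))))

fixedAbove-suc : (S : Fin (suc n) → Bool) →
  fixedAbove S ≡ ι (S zero) * # (cnt (S ∘ suc)) + fixedAbove (S ∘ suc)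
fixedAbove-suc {n} S = trans (∑-allFin-suc {n} _)
  (cong₂ _+_ (cong (ι (S zero) *_) (above-zero S)) (∑-cong (allFin n) (λ i → R.*-congˡ (above-suc S i))))

fixedAbove²-suc : (S : Fin (suc n) → Bool) →
  fixedAbove² S ≡ ι (S zero) * (# (cnt (S ∘ suc)) * # (cnt (S ∘ suc))) + fixedAbove² (S ∘ suc)
fixedAbove²-suc {n} S = trans (∑-allFin-suc {n} _)
  (cong₂ _+_ (cong (λ u → ι (S zero) * (u * u)) (above-zero S))
    (∑-cong (allFin n) (λ i → cong (λ u → ι (S (suc i)) * (u * u)) (above-suc S i))))

-- A free first letter lies below every fixed one and raises each L_s by 1, which adds Σ G_s. A
-- fixed first letter has nothing below it.
fixedBetween-suc : (S : Fin (suc n) → Bool) →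
  fixedBetween S ≡ ι (not (S zero)) * fixedAbove (S ∘ suc) + fixedBetween (S ∘ suc)
fixedBetween-suc {n} S = begin
  fixedBetween S
    ≡⟨ ∑-allFin-suc {n} _ ⟩
  ι (S zero) * (below S zero * above S zero) +
      ∑ (allFin n) (λ i → ι (S (suc i)) * (below S (suc i) * above S (suc i)))
    ≡⟨ cong₂ _+_ (trans (cong (λ u → ι (S zero) * (u * above S zero)) (below-zero S))
                    (solve 2 (λ x y → x ⊗ (con 0ℚ ⊗ y) ⊜ con 0ℚ) refl (ι (S zero)) (above S zero)))
         (trans (∑-cong (allFin n) (λ i → trans
             (cong₂ (λ u v → ι (S (suc i)) * (u * v)) (below-suc S i) (above-suc S i))
             (solve 4 (λ s ν l g → s ⊗ ((ν ⊕ l) ⊗ g) ⊜ ν ⊗ (s ⊗ g) ⊕ s ⊗ (l ⊗ g)) refl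
               (ι (S (suc i))) (ι (not (S zero))) (below (S ∘ suc) i) (above (S ∘ suc) i))))
           (trans (∑-+ (allFin n) _ _) (cong (_+ fixedBetween (S ∘ suc)) (∑-*ˡ (ι (not (S zero))) (allFin n) _)))) ⟩
  0ℚ + (ι (not (S zero)) * fixedAbove (S ∘ suc) + fixedBetween (S ∘ suc))
    ≡⟨ R.+-identityˡ _ ⟩
  _ ∎

freePairs-cnt : (S : Fin n → Bool) → freePairs S ≡ ½ * (# (cnt S) * (# (cnt S) - 1ℚ))
freePairs-cnt {zero}  S = trans (∑-allFin-0 _) (trans (solve 0 (con 0ℚ ⊜ con ½ ⊗ (con 0ℚ ⊗ (con 0ℚ ⊖ con 1ℚ))) refl)
  (sym (cong (λ m → ½ * (m * (m - 1ℚ))) #-0)))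
freePairs-cnt {suc n} S = trans (freePairs-suc S)
    (trans (cong (ι (not (S zero)) * # m +_) (freePairs-cnt (S ∘ suc))) (cases (S zero)))
  where
  m = cnt (S ∘ suc)
  cases : ∀ b → ι (not b) * # m + ½ * (# m * (# m - 1ℚ)) ≡
                ½ * (# (if b then m else suc m) * (# (if b then m else suc m) - 1ℚ))
  cases true  = trans (R.+-congʳ (R.zeroˡ _)) (R.+-identityˡ _)
  cases false = trans
    (solve 1 (λ m → con 1ℚ ⊗ m ⊕ con ½ ⊗ (m ⊗ (m ⊖ con 1ℚ)) ⊜ con ½ ⊗
        ((con 1ℚ ⊕ m) ⊗ (con 1ℚ ⊕ m ⊖ con 1ℚ))) refl (# m))
    (cong (λ x → ½ * (x * (x - 1ℚ))) (sym (#-suc m)))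

-- Averages over the sets of a given size.

⅙ : ℚ
⅙ = ℤ.+ 1 ℚ./ 6

⅔ : ℚ
⅔ = ℤ.+ 2 ℚ./ 3

ones+cnt : (v : Vec Bool n) → ones v ℕ.+ cnt (lookup v) ≡ n
ones+cnt []          = refl
ones+cnt (true  ∷ v) = cong suc (ones+cnt v)
ones+cnt (false ∷ v) = trans (ℕₚ.+-suc (ones v) _) (cong suc (ones+cnt v))

private
  size cosize : Vec Bool n → ℚ
  size v = # (ones v)
  cosize v = # (cnt (lookup v))

-- Removing s from S is a bijection from the pairs (S, s) with s ∈ S to those with s ∉ S.
shift : (n : ℕ) (φ : ℕ → ℚ) →
  ∑ (subsets n) (λ v → φ (ones v) * size v) ≡ ∑ (subsets n) (λ v → φ (suc (ones v)) * cosize v)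
shift zero    φ = trans (∑-words-0 bools _) (trans
    (trans (cong (φ 0 *_) #-0) (trans (R.zeroʳ _) (sym (trans (cong (φ 1 *_) #-0) (R.zeroʳ _)))))
    (sym (∑-words-0 bools _)))
shift (suc n) φ = begin
  ∑ (subsets (suc n)) (λ v → φ (ones v) * size v)
    ≡⟨ ∑-subsets-suc n _ ⟩
  ∑ X (λ v → φ (ones v) * size v) + ∑ X (λ v → φ (suc (ones v)) * # (suc (ones v)))
    ≡⟨ cong (∑ X (λ v → φ (ones v) * size v) +_)
        (trans (∑-cong X (λ v → trans (cong (φ (suc (ones v)) *_) (#-suc (ones v))) (R.distribˡ _ _ _)))
        (∑-+ X _ _)) ⟩
  ∑ X (λ v → φ (ones v) * size v) + (∑ X (λ v → φ (suc (ones v)) * 1ℚ) + ∑ X (λ v → φ (suc (ones v)) * size v))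
    ≡⟨ cong₂ (λ a b → a + (∑ X (λ v → φ (suc (ones v)) * 1ℚ) + b)) (shift n φ) (shift n (φ ∘ suc)) ⟩
  ∑ X (λ v → φ (suc (ones v)) * cosize v) + (∑ X (λ v → φ (suc (ones v)) * 1ℚ) +
      ∑ X (λ v → φ (suc (suc (ones v))) * cosize v))
    ≡⟨ solve 3 (λ a b c → a ⊕ (b ⊕ c) ⊜ b ⊕ a ⊕ c) refl _ _ _ ⟩
  ∑ X (λ v → φ (suc (ones v)) * 1ℚ) + ∑ X (λ v → φ (suc (ones v)) * cosize v) +
      ∑ X (λ v → φ (suc (suc (ones v))) * cosize v)
    ≡⟨ cong (_+ ∑ X (λ v → φ (suc (suc (ones v))) * cosize v)) (trans (sym (∑-+ X _ _)) (∑-cong X (λ v →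
         trans (sym (R.distribˡ _ _ _)) (cong (φ (suc (ones v)) *_) (sym (#-suc (cnt (lookup v)))))))) ⟩
  ∑ X (λ v → φ (suc (ones v)) * # (suc (cnt (lookup v)))) + ∑ X (λ v → φ (suc (suc (ones v))) * cosize v)
    ≡⟨ ∑-subsets-suc n _ ⟨
  ∑ (subsets (suc n)) (λ v → φ (suc (ones v)) * cosize v) ∎
  where X = subsets n

size+cosize : (v : Vec Bool n) → size v + cosize v ≡ # n
size+cosize v = trans (sym (#-+ (ones v) _)) (cong # (ones+cnt v))

-- `shift` applied to φ(a) (n - a), because `cosize` is n minus `size`.
shift² : (n : ℕ) (φ : ℕ → ℚ) →
  ∑ (subsets n) (λ v → φ (ones v) * (size v * cosize v)) ≡
      ∑ (subsets n) (λ v → φ (suc (ones v)) * (cosize v * (cosize v - 1ℚ)))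
shift² n φ = begin
  ∑ X (λ v → φ (ones v) * (size v * cosize v))
    ≡⟨ ∑-cong X (λ v → trans (solve 3 (λ f k m → f ⊗ (k ⊗ m) ⊜ f ⊗ (k ⊕ m ⊖ k) ⊗ k)
        refl (φ (ones v)) (size v) (cosize v))
         (cong (λ x → φ (ones v) * (x - size v) * size v) (size+cosize v))) ⟩
  ∑ X (λ v → φ (ones v) * (# n - size v) * size v)
    ≡⟨ shift n (λ a → φ a * (# n - # a)) ⟩
  ∑ X (λ v → φ (suc (ones v)) * (# n - # (suc (ones v))) * cosize v)
    ≡⟨ ∑-cong X (λ v → trans (cong₂ (λ x y → φ (suc (ones v)) * (x - y) * cosize v) (sym (size+cosize v))
        (#-suc (ones v)))
         (solve 3 (λ f k m → f ⊗ (k ⊕ m ⊖ (con 1ℚ ⊕ k)) ⊗ m ⊜ f ⊗ (m ⊗ (m ⊖ con 1ℚ)))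
             refl (φ (suc (ones v))) (size v) (cosize v))) ⟩
  ∑ X (λ v → φ (suc (ones v)) * (cosize v * (cosize v - 1ℚ))) ∎
  where X = subsets n

-- In the induction steps of the averages below, both sides are split at the first letter
-- of S; what the induction hypothesis leaves over is a combination of shift and shift².
private
  defect : (n : ℕ) (φ : ℕ → ℚ) (a b : ℚ) →
    ∑ (subsets n) (λ v → φ (ones v) * (a * size v + b * (size v * cosize v))) ≡
    ∑ (subsets n) (λ v → φ (suc (ones v)) * (a * cosize v + b * (cosize v * (cosize v - 1ℚ))))
  defect n φ a b = begin
    ∑ X (λ v → φ (ones v) * (a * size v + b * (size v * cosize v)))
      ≡⟨ expand (λ v → φ (ones v)) size (λ v → size v * cosize v) ⟩
    a * ∑ X (λ v → φ (ones v) * size v) + b * ∑ X (λ v → φ (ones v) * (size v * cosize v))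
      ≡⟨ cong₂ (λ x y → a * x + b * y) (shift n φ) (shift² n φ) ⟩
    a * ∑ X (λ v → φ (suc (ones v)) * cosize v) + b * ∑ X (λ v → φ (suc (ones v)) * (cosize v * (cosize v - 1ℚ)))
      ≡⟨ expand (λ v → φ (suc (ones v))) cosize (λ v → cosize v * (cosize v - 1ℚ)) ⟨
    _ ∎
    where
    X = subsets n
    expand : (f x y : Vec Bool n → ℚ) →
      ∑ X (λ v → f v * (a * x v + b * y v)) ≡ a * ∑ X (λ v → f v * x v) + b * ∑ X (λ v → f v * y v)
    expand f x y = trans (∑-cong X (λ v → solve 5 (λ f a x b y → f ⊗ (a ⊗ x ⊕ b ⊗ y) ⊜ a ⊗ (f ⊗ x) ⊕ b ⊗ (f ⊗ y))
        refl (f v) a (x v) b (y v)))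
      (trans (∑-+ X _ _) (cong₂ _+_ (∑-*ˡ a X _) (∑-*ˡ b X _)))

  -- `p` is the claimed average in k = `size` and m = `cosize`; `B₀` and `B₁` come from the
  -- hypotheses for a free and a fixed first letter. `p` exceeds `B₀` by a k + b k m, and `B₁`
  -- exceeds `p` by a m + b m (m - 1); by `defect` the two excesses cancel.
  average-suc : (n : ℕ) (φ : ℕ → ℚ) (T : Vec Bool (suc n) → ℚ) (B₀ B₁ : Vec Bool n → ℚ) (p : ℚ → ℚ → ℚ) (a b : ℚ) →
    ∑ (subsets n) (λ v → φ (ones v) * T (false ∷ v)) ≡ ∑ (subsets n) (λ v → φ (ones v) * B₀ v) →
    ∑ (subsets n) (λ v → φ (suc (ones v)) * T (true ∷ v)) ≡ ∑ (subsets n) (λ v → φ (suc (ones v)) * B₁ v) →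
    (∀ v → p (size v) (1ℚ + cosize v) ≡ B₀ v + (a * size v + b * (size v * cosize v))) →
    (∀ v → B₁ v ≡ p (1ℚ + size v) (cosize v) + (a * cosize v + b * (cosize v * (cosize v - 1ℚ)))) →
    ∑ (subsets (suc n)) (λ v → φ (ones v) * T v) ≡ ∑ (subsets (suc n)) (λ v → φ (ones v) * p (size v) (cosize v))
  average-suc n φ T B₀ B₁ p a b h₀ h₁ e₀ e₁ = begin
    ∑ (subsets (suc n)) (λ v → φ (ones v) * T v)
      ≡⟨ ∑-subsets-suc n _ ⟩
    ∑ X (λ v → φ (ones v) * T (false ∷ v)) + ∑ X (λ v → φ (suc (ones v)) * T (true ∷ v))
      ≡⟨ cong₂ _+_ h₀ (trans h₁ (distrib (λ v → φ (suc (ones v))) e₁)) ⟩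
    ∑ X (λ v → φ (ones v) * B₀ v) + (∑ X (λ v → φ (suc (ones v)) * p (1ℚ + size v) (cosize v)) +
        ∑ X (λ v → φ (suc (ones v)) * (a * cosize v + b * (cosize v * (cosize v - 1ℚ)))))
      ≡⟨ cong (λ x → ∑ X (λ v → φ (ones v) * B₀ v) + (∑ X (λ v → φ (suc (ones v)) * p (1ℚ + size v) (cosize v)) + x))
          (defect n φ a b) ⟨
    ∑ X (λ v → φ (ones v) * B₀ v) + (∑ X (λ v → φ (suc (ones v)) * p (1ℚ + size v) (cosize v)) +
        ∑ X (λ v → φ (ones v) * (a * size v + b * (size v * cosize v))))
      ≡⟨ solve 3 (λ x y z → x ⊕ (y ⊕ z) ⊜ x ⊕ z ⊕ y) refl _ _ _ ⟩
    ∑ X (λ v → φ (ones v) * B₀ v) + ∑ X (λ v → φ (ones v) * (a * size v + b * (size v * cosize v))) +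
        ∑ X (λ v → φ (suc (ones v)) * p (1ℚ + size v) (cosize v))
      ≡⟨ cong₂ _+_ (trans (sym (distrib (λ v → φ (ones v)) e₀))
          (∑-cong X (λ v → cong (λ x → φ (ones v) * p (size v) x) (sym (#-suc (cnt (lookup v)))))))
           (∑-cong X (λ v → cong (λ x → φ (suc (ones v)) * p x (cosize v)) (sym (#-suc (ones v))))) ⟩
    ∑ X (λ v → φ (ones v) * p (size v) (# (suc (cnt (lookup v))))) +
        ∑ X (λ v → φ (suc (ones v)) * p (# (suc (ones v))) (cosize v))
      ≡⟨ ∑-subsets-suc n _ ⟨
    _ ∎
    where
    X = subsets n
    distrib : (f : Vec Bool n → ℚ) {x y z : Vec Bool n → ℚ} → (∀ v → x v ≡ y v + z v) →
      ∑ X (λ v → f v * x v) ≡ ∑ X (λ v → f v * y v) + ∑ X (λ v → f v * z v)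
    distrib f e = trans (∑-cong X (λ v → trans (cong (f v *_) (e v)) (R.distribˡ _ _ _))) (∑-+ X _ _)

  average-+ : {f x y : Vec Bool n → ℚ} (T z : Vec Bool n → ℚ) → (∀ v → T v ≡ z v + x v) →
    ∑ (subsets n) (λ v → f v * x v) ≡ ∑ (subsets n) (λ v → f v * y v) →
    ∑ (subsets n) (λ v → f v * T v) ≡ ∑ (subsets n) (λ v → f v * (z v + y v))
  average-+ {n} {f} T z e h = trans (∑-cong (subsets n) (λ v → trans (cong (f v *_) (e v)) (R.distribˡ _ _ _)))
    (trans (∑-+ (subsets n) _ _) (trans (cong (_ +_) h)
      (trans (sym (∑-+ (subsets n) _ _)) (∑-cong (subsets n) (λ v → sym (R.distribˡ _ _ _))))))

  average-zero : (φ : ℕ → ℚ) (T : Vec Bool 0 → ℚ) (p : ℚ → ℚ → ℚ) → T [] ≡ 0ℚ → p 0ℚ 0ℚ ≡ 0ℚ →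
    ∑ (subsets 0) (λ v → φ (ones v) * T v) ≡ ∑ (subsets 0) (λ v → φ (ones v) * p (size v) (cosize v))
  average-zero φ T p T≡0 p≡0 = trans (∑-words-0 bools _) (trans
    (cong (φ 0 *_) (trans T≡0 (trans (sym p≡0) (sym (cong₂ p #-0 #-0))))) (sym (∑-words-0 bools _)))

-- An arbitrary weight `φ` of the size expresses the average without division, and can be shifted in
-- the induction. The mean of G_s is m / 2.
average-fixedAbove : (n : ℕ) (φ : ℕ → ℚ) →
  ∑ (subsets n) (λ v → φ (ones v) * fixedAbove (lookup v)) ≡
      ∑ (subsets n) (λ v → φ (ones v) * (½ * (size v * cosize v)))
average-fixedAbove zero    φ = average-zero φ _ (λ k m → ½ * (k * m)) (∑-allFin-0 _)
  (solve 0 (con ½ ⊗ (con 0ℚ ⊗ con 0ℚ) ⊜ con 0ℚ) refl)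
average-fixedAbove (suc n) φ = average-suc n φ (λ v → fixedAbove (lookup v))
  (λ v → 0ℚ * cosize v + ½ * (size v * cosize v)) (λ v → 1ℚ * cosize v + ½ * (size v * cosize v))
      -- From k (m + 1) / 2 - k m / 2 = k / 2.
      (λ k m → ½ * (k * m)) ½ 0ℚ
  (average-+ _ _ (λ v → fixedAbove-suc (lookup (false ∷ v))) (average-fixedAbove n φ))
  (average-+ _ _ (λ v → fixedAbove-suc (lookup (true ∷ v))) (average-fixedAbove n (φ ∘ suc)))
  (λ v → solve 2 (λ k m → con ½ ⊗ (k ⊗ (con 1ℚ ⊕ m)) ⊜
                          con 0ℚ ⊗ m ⊕ con ½ ⊗ (k ⊗ m) ⊕ (con ½ ⊗ k ⊕ con 0ℚ ⊗ (k ⊗ m))) refl (size v) (cosize v))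
  (λ v → solve 2 (λ k m → con 1ℚ ⊗ m ⊕ con ½ ⊗ (k ⊗ m) ⊜
                          con ½ ⊗ ((con 1ℚ ⊕ k) ⊗ m) ⊕ (con ½ ⊗ m ⊕ con 0ℚ ⊗ (m ⊗ (m ⊖ con 1ℚ))))
                              refl (size v) (cosize v))

average-fixedBetween : (n : ℕ) (φ : ℕ → ℚ) →
  ∑ (subsets n) (λ v → φ (ones v) * fixedBetween (lookup v)) ≡
  ∑ (subsets n) (λ v → φ (ones v) * (⅙ * (size v * (cosize v * (cosize v - 1ℚ)))))
average-fixedBetween zero    φ = average-zero φ _ (λ k m → ⅙ * (k * (m * (m - 1ℚ)))) (∑-allFin-0 _)
  (solve 0 (con ⅙ ⊗ (con 0ℚ ⊗ (con 0ℚ ⊗ (con 0ℚ ⊖ con 1ℚ))) ⊜ con 0ℚ) refl)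
average-fixedBetween (suc n) φ = average-suc n φ (λ v → fixedBetween (lookup v))
  (λ v → ½ * (size v * cosize v) + ⅙ * (size v * (cosize v * (cosize v - 1ℚ))))
      (λ v → 0ℚ + ⅙ * (size v * (cosize v * (cosize v - 1ℚ))))
  -- From k (m + 1) m / 6 - k m / 2 - k m (m - 1) / 6 = -k m / 6.
  (λ k m → ⅙ * (k * (m * (m - 1ℚ)))) 0ℚ (- ⅙)
  -- A free first letter also contributes `fixedAbove`, so two averages are substituted in turn.
  (trans (average-+ _ _ (λ v → trans (fixedBetween-suc (lookup (false ∷ v))) (R.+-congʳ (R.*-identityˡ _)))
      (average-fixedBetween n φ))
    (average-+ _ _ (λ v → R.+-comm _ _) (average-fixedAbove n φ) ▹ λ v → cong (φ (ones v) *_) (R.+-comm _ _)))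
  (average-+ _ _ (λ v → trans (fixedBetween-suc (lookup (true ∷ v))) (R.+-congʳ (R.zeroˡ _)))
      (average-fixedBetween n (φ ∘ suc)))
  (λ v → solve 2 (λ k m → con ⅙ ⊗ (k ⊗ ((con 1ℚ ⊕ m) ⊗ (con 1ℚ ⊕ m ⊖ con 1ℚ))) ⊜
      con ½ ⊗ (k ⊗ m) ⊕ con ⅙ ⊗ (k ⊗ (m ⊗ (m ⊖ con 1ℚ))) ⊕ (con 0ℚ ⊗ k ⊕ (⊝ con ⅙) ⊗ (k ⊗ m)))
          refl (size v) (cosize v))
  (λ v → solve 2 (λ k m → con 0ℚ ⊕ con ⅙ ⊗ (k ⊗ (m ⊗ (m ⊖ con 1ℚ))) ⊜
      con ⅙ ⊗ ((con 1ℚ ⊕ k) ⊗ (m ⊗ (m ⊖ con 1ℚ))) ⊕ (con 0ℚ ⊗ m ⊕ (⊝ con ⅙) ⊗ (m ⊗ (m ⊖ con 1ℚ))))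
          refl (size v) (cosize v))
  where
  _▹_ : {x : ℚ} {f g : Vec Bool n → ℚ} → x ≡ ∑ (subsets n) f → (∀ v → f v ≡ g v) → x ≡ ∑ (subsets n) g
  e ▹ h = trans e (∑-cong (subsets n) h)

average-fixedAbove² : (n : ℕ) (φ : ℕ → ℚ) →
  ∑ (subsets n) (λ v → φ (ones v) * fixedAbove² (lookup v)) ≡
  ∑ (subsets n) (λ v → φ (ones v) * (⅙ * (size v * (cosize v * (cosize v + cosize v + 1ℚ)))))
average-fixedAbove² zero    φ = average-zero φ _ (λ k m → ⅙ * (k * (m * (m + m + 1ℚ)))) (∑-allFin-0 _)
  (solve 0 (con ⅙ ⊗ (con 0ℚ ⊗ (con 0ℚ ⊗ (con 0ℚ ⊕ con 0ℚ ⊕ con 1ℚ))) ⊜ con 0ℚ) refl)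
average-fixedAbove² (suc n) φ = average-suc n φ (λ v → fixedAbove² (lookup v))
  (λ v → 0ℚ * (cosize v * cosize v) + ⅙ * (size v * (cosize v * (cosize v + cosize v + 1ℚ))))
      (λ v → 1ℚ * (cosize v * cosize v) + ⅙ * (size v * (cosize v * (cosize v + cosize v + 1ℚ))))
  -- From k (m + 1) (2m + 3) / 6 - k m (2m + 1) / 6 = k / 2 + 2 k m / 3.
  (λ k m → ⅙ * (k * (m * (m + m + 1ℚ)))) ½ ⅔
  (average-+ _ _ (λ v → fixedAbove²-suc (lookup (false ∷ v))) (average-fixedAbove² n φ))
  (average-+ _ _ (λ v → fixedAbove²-suc (lookup (true ∷ v))) (average-fixedAbove² n (φ ∘ suc)))
  (λ v → solve 2 (λ k m → con ⅙ ⊗ (k ⊗ ((con 1ℚ ⊕ m) ⊗ (con 1ℚ ⊕ m ⊕ (con 1ℚ ⊕ m) ⊕ con 1ℚ))) ⊜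
      con 0ℚ ⊗ (m ⊗ m) ⊕ con ⅙ ⊗ (k ⊗ (m ⊗ (m ⊕ m ⊕ con 1ℚ))) ⊕ (con ½ ⊗ k ⊕ con ⅔ ⊗ (k ⊗ m)))
          refl (size v) (cosize v))
  (λ v → solve 2 (λ k m → con 1ℚ ⊗ (m ⊗ m) ⊕ con ⅙ ⊗ (k ⊗ (m ⊗ (m ⊕ m ⊕ con 1ℚ))) ⊜
      con ⅙ ⊗ ((con 1ℚ ⊕ k) ⊗ (m ⊗ (m ⊕ m ⊕ con 1ℚ))) ⊕ (con ½ ⊗ m ⊕ con ⅔ ⊗ (m ⊗ (m ⊖ con 1ℚ))))
          refl (size v) (cosize v))

-- Sums over initial segments of the naturals.

σ : ℕ → (ℕ → ℚ) → ℚ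
σ zero    f = 0ℚ
σ (suc n) f = σ n f + f n

sumBetween-σ : ∀ lo hi f → sumBetween lo hi f ≡ σ (hi ∸ lo) (λ k → f (lo ℕ.+ k))
sumBetween-σ lo hi f = trans recursion (unique go refl (λ _ → refl) (hi ∸ lo))
  where
  -- The local function of sumBetween, which has no name outside it, is found by unification.
  go : ℕ → ℚ
  go = _
  recursion : sumBetween lo hi f ≡ go (hi ∸ lo)
  recursion with hi ∸ lo
  ... | n = refl
  unique : (g : ℕ → ℚ) → g 0 ≡ 0ℚ → (∀ k → g (suc k) ≡ g k ℚ.+ f (lo ℕ.+ k)) →
           ∀ k → g k ≡ σ k (λ k → f (lo ℕ.+ k))
  unique g g0 gs zero    = g0
  unique g g0 gs (suc k) = trans (gs k) (trans (ℚ+ (g k) _) (cong (_+ f (lo ℕ.+ k)) (unique g g0 gs k)))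

σ-cong : ∀ n {f g : ℕ → ℚ} → (∀ k → k < n → f k ≡ g k) → σ n f ≡ σ n g
σ-cong zero    e = refl
σ-cong (suc n) e = cong₂ _+_ (σ-cong n (λ k k<n → e k (ℕₚ.m<n⇒m<1+n k<n))) (e n ℕₚ.≤-refl)

σ-+ : ∀ n (f g : ℕ → ℚ) → σ n (λ k → f k + g k) ≡ σ n f + σ n g
σ-+ zero    f g = sym (R.+-identityʳ 0ℚ)
σ-+ (suc n) f g = trans (cong (_+ (f n + g n)) (σ-+ n f g))
  (solve 4 (λ a b c d → a ⊕ b ⊕ (c ⊕ d) ⊜ a ⊕ c ⊕ (b ⊕ d)) refl (σ n f) (σ n g) (f n) (g n))

σ-*ˡ : ∀ n c (f : ℕ → ℚ) → σ n (λ k → c * f k) ≡ c * σ n f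
σ-*ˡ zero    c f = sym (R.zeroʳ c)
σ-*ˡ (suc n) c f = trans (cong (_+ c * f n) (σ-*ˡ n c f)) (sym (R.distribˡ c _ _))

σ-0 : ∀ n {f : ℕ → ℚ} → (∀ k → f k ≡ 0ℚ) → σ n f ≡ 0ℚ
σ-0 zero    e = refl
σ-0 (suc n) e = trans (cong₂ _+_ (σ-0 n e) (e n)) (R.+-identityʳ 0ℚ)

σ-sucˡ : ∀ n (f : ℕ → ℚ) → σ (suc n) f ≡ f 0 + σ n (f ∘ suc)
σ-sucˡ zero    f = R.+-comm 0ℚ (f 0)
σ-sucˡ (suc n) f = trans (cong (_+ f (suc n)) (σ-sucˡ n f)) (R.+-assoc (f 0) _ _)

σ-∑ : ∀ n (xs : List A) (f : ℕ → A → ℚ) → σ n (λ k → ∑ xs (f k)) ≡ ∑ xs (λ x → σ n (λ k → f k x))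
σ-∑ zero    xs f = sym (∑-0 xs (λ _ → refl))
σ-∑ (suc n) xs f = trans (cong (_+ ∑ xs (f n)) (σ-∑ n xs f)) (sym (∑-+ xs _ _))

∑-subsets-ones : (n : ℕ) (φ : ℕ → ℚ) → ∑ (subsets n) (λ v → φ (ones v)) ≡ σ (suc n) (λ k → # (n C k) * φ k)
∑-subsets-ones zero    φ = trans (∑-words-0 bools _)
    (sym (trans (R.+-identityˡ _) (trans (cong (_* φ 0) #-1) (R.*-identityˡ _))))
∑-subsets-ones (suc n) φ = begin
  ∑ (subsets (suc n)) (λ v → φ (ones v))
    ≡⟨ ∑-subsets-suc n _ ⟩
  ∑ (subsets n) (λ v → φ (ones v)) + ∑ (subsets n) (λ v → φ (suc (ones v)))
    ≡⟨ cong₂ _+_ (trans (∑-subsets-ones n φ) (trans (sym extend) (σ-sucˡ (suc n) _))) (∑-subsets-ones n (φ ∘ suc)) ⟩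
  # (n C 0) * φ 0 + σ (suc n) (λ k → # (n C suc k) * φ (suc k)) + σ (suc n) (λ k → # (n C k) * φ (suc k))
    ≡⟨ R.+-assoc _ _ _ ⟩
  # (n C 0) * φ 0 + (σ (suc n) (λ k → # (n C suc k) * φ (suc k)) + σ (suc n) (λ k → # (n C k) * φ (suc k)))
    ≡⟨ cong (# (n C 0) * φ 0 +_) (trans (sym (σ-+ (suc n) _ _)) (σ-cong (suc n) (λ k _ → begin
         # (n C suc k) * φ (suc k) + # (n C k) * φ (suc k)  ≡⟨ R.distribʳ (φ (suc k)) _ _ ⟨
         (# (n C suc k) + # (n C k)) * φ (suc k)            ≡⟨ cong (_* φ (suc k)) (#-+ (n C suc k) (n C k)) ⟨
         # (n C suc k ℕ.+ n C k) * φ (suc k)                ≡⟨ cong (λ x → # x * φ (suc k))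
                                                                 (trans (ℕₚ.+-comm (n C suc k) (n C k))
                                                                     (nCk+nC[k+1]≡[n+1]C[k+1] n k)) ⟩
         # (suc n C suc k) * φ (suc k)                      ∎))) ⟩
  # (suc n C 0) * φ 0 + σ (suc n) (λ k → # (suc n C suc k) * φ (suc k))
    ≡⟨ σ-sucˡ (suc n) _ ⟨
  σ (suc (suc n)) (λ k → # (suc n C k) * φ k) ∎
  where
  -- Adding the zero term k = n + 1 lets the sum be split at k = 0, so that Pascal's rule applies
  -- termwise.
  extend : σ (suc (suc n)) (λ k → # (n C k) * φ k) ≡ σ (suc n) (λ k → # (n C k) * φ k)
  extend = trans (R.+-congˡ (trans (cong (λ x → # x * φ (suc n)) (k>n⇒nCk≡0 (ℕₚ.n<1+n n)))
    (trans (cong (_* φ (suc n)) #-0) (R.zeroˡ _)))) (R.+-identityʳ _)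

-- The total of the colors by power series.

Seq : Set
Seq = ℕ → ℚ

-- Sequences are read as formal power series: delay multiplies by x, partials by 1/(1-x).
delay partials : Seq → Seq
delay f zero    = 0ℚ
delay f (suc i) = f i
partials f zero    = f 0
partials f (suc i) = partials f i + f (suc i)

shiftBy iterPartials : ℕ → Seq → Seq
shiftBy zero    f = f
shiftBy (suc k) f = delay (shiftBy k f)
iterPartials zero    f = f
iterPartials (suc m) f = partials (iterPartials m f)

δ : Seq
δ zero    = 1ℚ
δ (suc i) = 0ℚ

delay-cong : {f g : Seq} → f ≗ g → delay f ≗ delay g
delay-cong e zero    = refl
delay-cong e (suc i) = e i

partials-cong : {f g : Seq} → f ≗ g → partials f ≗ partials g
partials-cong e zero    = e 0
partials-cong e (suc i) = cong₂ _+_ (partials-cong e i) (e (suc i))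

shiftBy-cong : (k : ℕ) {f g : Seq} → f ≗ g → shiftBy k f ≗ shiftBy k g
shiftBy-cong zero    e = e
shiftBy-cong (suc k) e = delay-cong (shiftBy-cong k e)

shiftBy-+ : (a b : ℕ) (f : Seq) → shiftBy (a ℕ.+ b) f ≗ shiftBy a (shiftBy b f)
shiftBy-+ zero    b f i = refl
shiftBy-+ (suc a) b f i = delay-cong (shiftBy-+ a b f) i

partials-delay : (f : Seq) → partials (delay f) ≗ delay (partials f)
partials-delay f zero          = refl
partials-delay f (suc zero)    = R.+-identityˡ (f 0)
partials-delay f (suc (suc i)) = cong (_+ f (suc i)) (partials-delay f (suc i))

partials-shiftBy : (k : ℕ) (f : Seq) → partials (shiftBy k f) ≗ shiftBy k (partials f)
partials-shiftBy zero    f i = refl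
partials-shiftBy (suc k) f i = trans (partials-delay (shiftBy k f) i) (delay-cong (partials-shiftBy k f) i)

iterPartials-shiftBy : (m k : ℕ) (f : Seq) → iterPartials m (shiftBy k f) ≗ shiftBy k (iterPartials m f)
iterPartials-shiftBy zero    k f i = refl
iterPartials-shiftBy (suc m) k f i = trans (partials-cong (iterPartials-shiftBy m k f) i) (partials-shiftBy k _ i)

shiftBy-linear : (k : ℕ) (xs : List A) (f : A → Seq) →
  shiftBy k (λ i → ∑ xs (λ x → f x i)) ≗ (λ i → ∑ xs (λ x → shiftBy k (f x) i))
shiftBy-linear zero    xs f i       = refl
shiftBy-linear (suc k) xs f zero    = sym (∑-0 xs (λ _ → refl))
shiftBy-linear (suc k) xs f (suc i) = shiftBy-linear k xs f i

delay-minus : (f g : Seq) (i : ℕ) → delay (λ i → f i - g i) i ≡ delay f i - delay g i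
delay-minus f g zero    = solve 0 (con 0ℚ ⊜ con 0ℚ ⊖ con 0ℚ) refl
delay-minus f g (suc i) = refl

shiftBy-minus : (k : ℕ) (f g : Seq) (i : ℕ) → shiftBy k (λ i → f i - g i) i ≡ shiftBy k f i - shiftBy k g i
shiftBy-minus zero    f g i = refl
shiftBy-minus (suc k) f g i = trans (delay-cong (shiftBy-minus k f g) i) (delay-minus _ _ i)

-- (1 - x^c)/(1 - x) = 1 + x + ... + x^(c-1)
window : (c : ℕ) (f : Seq) (i : ℕ) →
  partials f i - shiftBy c (partials f) i ≡ ∑ (allFin c) (λ x → shiftBy (toℕ x) f i)
window zero    f i = trans (R.-‿inverseʳ _) (sym (∑-allFin-0 _))
window (suc c) f i = begin
  partials f i - delay (shiftBy c (partials f)) i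
    ≡⟨ cong (_- delay (shiftBy c (partials f)) i) (unfold i) ⟩
  f i + delay (partials f) i - delay (shiftBy c (partials f)) i
    ≡⟨ trans (R.+-assoc _ _ _) (cong (f i +_) (sym (delay-minus (partials f) (shiftBy c (partials f)) i))) ⟩
  f i + delay (λ i → partials f i - shiftBy c (partials f) i) i
    ≡⟨ cong (f i +_) (trans (delay-cong (window c f) i) (shiftBy-linear 1 (allFin c) (λ x → shiftBy (toℕ x) f) i)) ⟩
  f i + ∑ (allFin c) (λ x → shiftBy (suc (toℕ x)) f i)
    ≡⟨ ∑-allFin-suc {c} (λ x → shiftBy (toℕ x) f i) ⟨
  _ ∎
  where
  unfold : ∀ i → partials f i ≡ f i + delay (partials f) i
  unfold zero    = sym (R.+-identityʳ _)
  unfold (suc i) = R.+-comm _ _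

weight : {c k : ℕ} → Vec (Fin c) k → ℕ
weight []      = 0
weight (x ∷ w) = toℕ x ℕ.+ weight w

-- This is (1 - x^c)^m times f, expanded over subsets instead of binomials so that one factor splits
-- off at the first letter.
alternating : (c m : ℕ) → Seq → Seq
alternating c m f i = ∑ (subsets m) (λ v → sgn (ones v) * shiftBy (c ℕ.* ones v) f i)

alternating-suc : (c m : ℕ) (f : Seq) (i : ℕ) →
  alternating c (suc m) f i ≡ alternating c m (λ i → f i - shiftBy c f i) i
alternating-suc c m f i = begin
  alternating c (suc m) f i
    ≡⟨ ∑-subsets-suc m _ ⟩
  ∑ X (λ v → sgn (ones v) * shiftBy (c ℕ.* ones v) f i) +
      ∑ X (λ v → sgn (suc (ones v)) * shiftBy (c ℕ.* suc (ones v)) f i)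
    ≡⟨ ∑-+ X _ _ ⟨
  ∑ X (λ v → sgn (ones v) * shiftBy (c ℕ.* ones v) f i + sgn (suc (ones v)) * shiftBy (c ℕ.* suc (ones v)) f i)
    ≡⟨ ∑-cong X (λ v → trans
         (cong₂ (λ a b → sgn (ones v) * shiftBy (c ℕ.* ones v) f i + a * b) (sgn-suc (ones v)) (trans
           (cong (λ k → shiftBy k f i) (trans (ℕₚ.*-suc c (ones v)) (ℕₚ.+-comm c _)))
               (shiftBy-+ (c ℕ.* ones v) c f i)))
         (trans (solve 3 (λ s a b → s ⊗ a ⊕ (⊝ s) ⊗ b ⊜ s ⊗ (a ⊖ b)) refl
                  (sgn (ones v)) (shiftBy (c ℕ.* ones v) f i) (shiftBy (c ℕ.* ones v) (shiftBy c f) i))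
           (cong (sgn (ones v) *_) (sym (shiftBy-minus (c ℕ.* ones v) f (shiftBy c f) i))))) ⟩
  alternating c m (λ i → f i - shiftBy c f i) i ∎
  where X = subsets m

-- The coefficients of ((1 - x^c)/(1 - x))^m count the words of length m over {0, …, c-1} by weight.
alternating-words : (c m : ℕ) (f : Seq) (i : ℕ) →
  alternating c m (iterPartials m f) i ≡ ∑ (allWords (allFin c) m) (λ w → shiftBy (weight w) f i)
alternating-words c zero    f i = trans (∑-words-0 bools _) (trans (R.*-identityˡ _)
  (trans (cong (λ k → shiftBy k f i) (ℕₚ.*-zeroʳ c)) (sym (∑-words-0 (allFin c) _))))
alternating-words c (suc m) f i = begin
  alternating c (suc m) (iterPartials (suc m) f) i
    ≡⟨ alternating-suc c m _ i ⟩
  alternating c m (λ i → iterPartials (suc m) f i - shiftBy c (iterPartials (suc m) f) i) i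
    -- `window` turns one factor into the sum of x^a over the letters a; x^a is then moved into f,
    -- which is why f is arbitrary.
    ≡⟨ ∑-cong X (λ v → cong (sgn (ones v) *_) (trans
         (shiftBy-cong (c ℕ.* ones v) (λ i → trans (window c (iterPartials m f) i)
           (∑-cong Y (λ x → sym (iterPartials-shiftBy m (toℕ x) f i)))) i)
         (shiftBy-linear (c ℕ.* ones v) Y _ i))) ⟩
  ∑ X (λ v → sgn (ones v) * ∑ Y (λ x → shiftBy (c ℕ.* ones v) (iterPartials m (shiftBy (toℕ x) f)) i))
    ≡⟨ trans (∑-cong X (λ v → sym (∑-*ˡ (sgn (ones v)) Y _))) (∑-swap X Y _) ⟩
  ∑ Y (λ x → alternating c m (iterPartials m (shiftBy (toℕ x) f)) i)
    ≡⟨ ∑-cong Y (λ x → alternating-words c m (shiftBy (toℕ x) f) i) ⟩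
  ∑ Y (λ x → ∑ (allWords Y m) (λ w → shiftBy (weight w) (shiftBy (toℕ x) f) i))
    ≡⟨ ∑-cong Y (λ x → ∑-cong (allWords Y m) (λ w → trans (sym (shiftBy-+ (weight w) (toℕ x) f i))
         (cong (λ k → shiftBy k f i) (ℕₚ.+-comm (weight w) (toℕ x))))) ⟩
  ∑ Y (λ x → ∑ (allWords Y m) (λ w → shiftBy (toℕ x ℕ.+ weight w) f i))
    ≡⟨ ∑-words-suc Y m _ ⟨
  _ ∎
  where
  X = subsets m
  Y = allFin c

-- `shiftBy s δ` is the monomial x^s, and the range must reach its exponent.
σ-δ : (N s : ℕ) (g : ℕ → ℚ) → s ≤ N → σ (suc N) (λ i → g i * shiftBy s δ i) ≡ g s
σ-δ N zero g _ = begin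
  σ (suc N) (λ i → g i * δ i)            ≡⟨ σ-sucˡ N _ ⟩
  g 0 * 1ℚ + σ N (λ i → g (suc i) * 0ℚ)  ≡⟨ cong₂ _+_ (R.*-identityʳ _) (σ-0 N (λ i → R.zeroʳ _)) ⟩
  g 0 + 0ℚ                               ≡⟨ R.+-identityʳ _ ⟩
  g 0                                    ∎
σ-δ (suc N) (suc s) g (s≤s s≤N) = begin
  σ (suc (suc N)) (λ i → g i * shiftBy (suc s) δ i)             ≡⟨ σ-sucˡ (suc N) _ ⟩
  g 0 * 0ℚ + σ (suc N) (λ i → g (suc i) * shiftBy s δ i)        ≡⟨ cong₂ _+_ (R.zeroʳ _) (σ-δ N s (g ∘ suc) s≤N) ⟩
  0ℚ + g (suc s)                                                ≡⟨ R.+-identityˡ _ ⟩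
  g (suc s)                                                     ∎

-- The coefficients of 1 / (1 - x)^(p + 1); partial sums follow Pascal's rule.
iterPartials-δ : (p i : ℕ) → iterPartials (suc p) δ i ≡ # ((i ℕ.+ p) C p)
iterPartials-δ zero    zero    = sym #-1
iterPartials-δ zero    (suc i) = trans (R.+-identityʳ _) (iterPartials-δ zero i)
iterPartials-δ (suc p) zero    = trans (iterPartials-δ p 0) (cong # (trans (nCn≡1 p) (sym (nCn≡1 (suc p)))))
iterPartials-δ (suc p) (suc i) = begin
  iterPartials (suc (suc p)) δ i + iterPartials (suc p) δ (suc i)
    ≡⟨ cong₂ _+_ (iterPartials-δ (suc p) i) (iterPartials-δ p (suc i)) ⟩
  # ((i ℕ.+ suc p) C suc p) + # ((suc i ℕ.+ p) C p)
    ≡⟨ trans (R.+-comm _ _) (cong (λ k → # (k C p) + # ((i ℕ.+ suc p) C suc p)) (sym (ℕₚ.+-suc i p))) ⟩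
  # ((i ℕ.+ suc p) C p) + # ((i ℕ.+ suc p) C suc p)
    ≡⟨ trans (sym (#-+ ((i ℕ.+ suc p) C p) _)) (cong # (nCk+nC[k+1]≡[n+1]C[k+1] (i ℕ.+ suc p) p)) ⟩
  # ((suc i ℕ.+ suc p) C suc p) ∎

shiftBy-≥ : (k x : ℕ) (f : Seq) → shiftBy k f (k ℕ.+ x) ≡ f x
shiftBy-≥ zero    x f = refl
shiftBy-≥ (suc k) x f = shiftBy-≥ k x f

shiftBy-< : (k i : ℕ) (f : Seq) → i < k → shiftBy k f i ≡ 0ℚ
shiftBy-< (suc k) zero    f _         = refl
shiftBy-< (suc k) (suc i) f (s≤s i<k) = shiftBy-< k i f i<k

binomℤ-< : (z : ℤ) (p : ℕ) → z ℤ.< ℤ.+ p → binomℤ z (ℤ.+ p) ≡ 0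
binomℤ-< (ℤ.+ a)  p (ℤ.+<+ a<p) = k>n⇒nCk≡0 a<p
binomℤ-< -[1+ a ] p _           = refl

-- For i < q the upper index i - q + p is below p, possibly negative, and both sides vanish.
-- Otherwise this is a shifted coefficient of 1 / (1 - x)^(p + 1).
binomℤ-shiftBy : (i q p : ℕ) →
  # (binomℤ (ℤ.+ i ℤ.- ℤ.+ q ℤ.+ ℤ.+ suc p ℤ.- ℤ.+ 1) (ℤ.+ suc p ℤ.- ℤ.+ 1)) ≡ shiftBy q (iterPartials (suc p) δ) i
binomℤ-shiftBy i q p = trans (cong (λ z → # (binomℤ z (ℤ.+ p))) drop) cases
  where
  drop : ℤ.+ i ℤ.- ℤ.+ q ℤ.+ ℤ.+ suc p ℤ.- ℤ.+ 1 ≡ i ℤ.⊖ q ℤ.+ ℤ.+ p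
  drop = trans (ℤₚ.+-assoc (ℤ.+ i ℤ.- ℤ.+ q) (ℤ.+ suc p) (ℤ.- ℤ.+ 1)) (cong (ℤ._+ ℤ.+ p) (ℤₚ.m-n≡m⊖n i q))
  cases : # (binomℤ (i ℤ.⊖ q ℤ.+ ℤ.+ p) (ℤ.+ p)) ≡ shiftBy q (iterPartials (suc p) δ) i
  cases with q ℕ.≤? i
  ... | yes q≤i = begin
    # (binomℤ (i ℤ.⊖ q ℤ.+ ℤ.+ p) (ℤ.+ p))
        ≡⟨ cong (λ z → # (binomℤ (z ℤ.+ ℤ.+ p) (ℤ.+ p))) (ℤₚ.⊖-≥ q≤i) ⟩
    # ((i ∸ q ℕ.+ p) C p)                                ≡⟨ iterPartials-δ p (i ∸ q) ⟨
    iterPartials (suc p) δ (i ∸ q)                       ≡⟨ shiftBy-≥ q (i ∸ q) _ ⟨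
    shiftBy q (iterPartials (suc p) δ) (q ℕ.+ (i ∸ q))   ≡⟨ cong (shiftBy q _) (ℕₚ.m+[n∸m]≡n q≤i) ⟩
    shiftBy q (iterPartials (suc p) δ) i                 ∎
  ... | no  q≰i = trans (cong # (binomℤ-< _ p small)) (trans #-0 (sym (shiftBy-< q i _ (ℕₚ.≰⇒> q≰i))))
    where
    small : i ℤ.⊖ q ℤ.+ ℤ.+ p ℤ.< ℤ.+ p
    small = subst (i ℤ.⊖ q ℤ.+ ℤ.+ p ℤ.<_) (ℤₚ.+-identityˡ (ℤ.+ p))
      (ℤₚ.+-monoˡ-< (ℤ.+ p) (subst (i ℤ.⊖ q ℤ.<_) (ℤₚ.n⊖n≡0 q) (ℤₚ.⊖-monoˡ-< q (ℕₚ.≰⇒> q≰i))))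

weight-≤ : (d : ℕ) {k : ℕ} (w : Vec (Fin (suc d)) k) → weight w ≤ k ℕ.* d
weight-≤ d []      = z≤n
weight-≤ d (x ∷ w) = ℕₚ.+-mono-≤ (toℕ≤pred[n] x) (weight-≤ d w)

#-weight : {c k : ℕ} (w : Vec (Fin c) k) → # (weight w) ≡ ∑ (allFin k) (λ j → # (toℕ (lookup w j)))
#-weight []      = trans #-0 (sym (∑-allFin-0 _))
#-weight (x ∷ w) = trans (#-+ (toℕ x) (weight w)) (trans (cong (# (toℕ x) +_) (#-weight w)) (sym (∑-allFin-suc _)))

cnt-none : (n : ℕ) → cnt {n} (λ _ → false) ≡ n
cnt-none zero    = refl
cnt-none (suc n) = cong suc (cnt-none n)

-- The color sum with no position prescribed: every letter has mean d / 2.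
∑-weight : (d m : ℕ) → ∑ (allWords (allFin (suc d)) m) (λ w → # (weight w)) ≡ # (suc d ℕ.^ m) * (½ * (# m * # d))
∑-weight d m = begin
  ∑ W (λ w → # (weight w))
    ≡⟨ ∑-cong W (λ w → trans (#-weight w) (sym
        (trans (cong (_* (0ℚ + ∑ F (λ j → # (toℕ (lookup w j))))) (∏-1 {m} (λ _ → refl)))
         (trans (R.*-identityˡ _) (R.+-identityˡ _))))) ⟩
  ∑ W (λ w → uncoloured (λ _ → false) w * (0ℚ + ∑ F (λ j → # (toℕ (lookup w j)))))
    ≡⟨ colour-sum d m (λ _ → false) 0ℚ (λ _ x → # (toℕ x)) (λ _ → ½ * # d) (λ _ → #-0) (λ _ → total) ⟩
  # (suc d ℕ.^ cnt {m} (λ _ → false)) * (0ℚ + ∑ F (λ _ → 1ℚ * (½ * # d)))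
    ≡⟨ cong₂ (λ x y → # (suc d ℕ.^ x) * (0ℚ + y)) (cnt-none m) (∑-const m _) ⟩
  # (suc d ℕ.^ m) * (0ℚ + # m * (1ℚ * (½ * # d)))
    ≡⟨ cong (# (suc d ℕ.^ m) *_) (solve 2 (λ m d → con 0ℚ ⊕ m ⊗ (con 1ℚ ⊗ (con ½ ⊗ d)) ⊜ con ½ ⊗ (m ⊗ d))
        refl (# m) (# d)) ⟩
  # (suc d ℕ.^ m) * (½ * (# m * # d)) ∎
  where
  W = allWords (allFin (suc d)) m
  F = allFin m
  total : ∑ (allFin (suc d)) (λ x → # (toℕ x)) ≡ # (suc d) * (½ * # d)
  total = trans (∑-toℕ (suc d)) (trans (cong (λ y → ½ * (# (suc d) * (y - 1ℚ))) (#-suc d))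
    (solve 2 (λ c d → con ½ ⊗ (c ⊗ (con 1ℚ ⊕ d ⊖ con 1ℚ)) ⊜ c ⊗ (con ½ ⊗ d)) refl (# (suc d)) (# d)))

-- The inner sum counts the words of length m and weight i, so the whole adds up their weights; m d
-- is the largest weight.
weighted-binomial-sum : (d m : ℕ) →
  σ (suc (m ℕ.* d)) (λ i → # i * σ (suc m) (λ j → sgn j * # (m C j) *
    # (binomℤ (ℤ.+ i ℤ.- ℤ.+ (suc d ℕ.* j) ℤ.+ ℤ.+ m ℤ.- ℤ.+ 1) (ℤ.+ m ℤ.- ℤ.+ 1)))) ≡
  # (suc d ℕ.^ m) * (½ * (# m * # d))
-- At m = 0 the lower index is -1, but the only summand is i = 0, killed by the factor i.
weighted-binomial-sum d zero = trans (trans (R.+-identityˡ _) (trans (R.*-congʳ #-0) (R.zeroˡ _)))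
  (sym (trans (cong (λ x → # 1 * (½ * (x * # d))) #-0) (solve 2 (λ a d → a ⊗ (con ½ ⊗ (con 0ℚ ⊗ d)) ⊜ con 0ℚ)
      refl (# 1) (# d))))
weighted-binomial-sum d m@(suc p) = begin
  _ ≡⟨ σ-cong (suc (m ℕ.* d)) (λ i _ → cong (# i *_) (begin
         σ (suc m) (λ j → sgn j * # (m C j) * #
             (binomℤ (ℤ.+ i ℤ.- ℤ.+ (c ℕ.* j) ℤ.+ ℤ.+ m ℤ.- ℤ.+ 1) (ℤ.+ m ℤ.- ℤ.+ 1)))
           ≡⟨ σ-cong (suc m) (λ j _ → trans (cong (sgn j * # (m C j) *_) (binomℤ-shiftBy i (c ℕ.* j) p))
                (solve 3 (λ s b x → s ⊗ b ⊗ x ⊜ b ⊗ (s ⊗ x))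
                    refl (sgn j) (# (m C j)) (shiftBy (c ℕ.* j) (iterPartials m δ) i))) ⟩
         σ (suc m) (λ j → # (m C j) * (sgn j * shiftBy (c ℕ.* j) (iterPartials m δ) i))
           ≡⟨ ∑-subsets-ones m (λ j → sgn j * shiftBy (c ℕ.* j) (iterPartials m δ) i) ⟨
         alternating c m (iterPartials m δ) i
           ≡⟨ alternating-words c m δ i ⟩
         ∑ W (λ w → shiftBy (weight w) δ i) ∎)) ⟩
  σ (suc (m ℕ.* d)) (λ i → # i * ∑ W (λ w → shiftBy (weight w) δ i))
    ≡⟨ trans (σ-cong (suc (m ℕ.* d)) (λ i _ → sym (∑-*ˡ (# i) W _))) (σ-∑ (suc (m ℕ.* d)) W _) ⟩
  ∑ W (λ w → σ (suc (m ℕ.* d)) (λ i → # i * shiftBy (weight w) δ i))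
    ≡⟨ ∑-cong W (λ w → σ-δ (m ℕ.* d) (weight w) # (weight-≤ d w)) ⟩
  ∑ W (λ w → # (weight w))
    ≡⟨ ∑-weight d m ⟩
  _ ∎
  where
  c = suc d
  W = allWords (allFin c) m

-- Factorials and binomial coefficients.

¼ : ℚ
¼ = ℤ.+ 1 ℚ./ 4

-- The cancellation (m - 2)! m (m - 1) = m! fails for m < 2 under truncated subtraction; there the
-- second factor m (m - 1) makes both sides 0.
pairs-of-positions : (m : ℕ) → # ((m ∸ 2) !) * (# m * (# m - 1ℚ)) * (# m * (# m - 1ℚ)) ≡ # (m !) * (# m * (# m - 1ℚ))
pairs-of-positions 0 = trans (cong (λ x → # 1 * (x * (x - 1ℚ)) * (x * (x - 1ℚ))) #-0) (trans
  (solve 1 (λ a → a ⊗ (con 0ℚ ⊗ (con 0ℚ ⊖ con 1ℚ)) ⊗ (con 0ℚ ⊗ (con 0ℚ ⊖ con 1ℚ)) ⊜ a ⊗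
      (con 0ℚ ⊗ (con 0ℚ ⊖ con 1ℚ))) refl (# 1))
  (sym (cong (λ x → # 1 * (x * (x - 1ℚ))) #-0)))
pairs-of-positions 1 = trans (cong (λ x → x * (x * (x - 1ℚ)) * (x * (x - 1ℚ))) #-1) (trans
  (solve 0 (con 1ℚ ⊗ (con 1ℚ ⊗ (con 1ℚ ⊖ con 1ℚ)) ⊗ (con 1ℚ ⊗ (con 1ℚ ⊖ con 1ℚ)) ⊜ con 1ℚ ⊗
      (con 1ℚ ⊗ (con 1ℚ ⊖ con 1ℚ))) refl)
  (sym (cong (λ x → x * (x * (x - 1ℚ))) #-1)))
pairs-of-positions m@(suc (suc p)) = cong (_* (# m * (# m - 1ℚ))) (begin
  # (p !) * (# m * (# m - 1ℚ))
    ≡⟨ cong (λ x → # (p !) * (# m * (x - 1ℚ))) (#-suc (suc p)) ⟩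
  # (p !) * (# m * (1ℚ + # (suc p) - 1ℚ))
    ≡⟨ solve 3 (λ f m q → f ⊗ (m ⊗ (con 1ℚ ⊕ q ⊖ con 1ℚ)) ⊜ m ⊗ (q ⊗ f)) refl (# (p !)) (# m) (# (suc p)) ⟩
  # m * (# (suc p) * # (p !))
    ≡⟨ trans (cong (# m *_) (sym (#-* (suc p) (p !)))) (sym (#-* m (suc p !))) ⟩
  # (m !) ∎)

#-C2 : (m : ℕ) → # (m C 2) ≡ ½ * (# m * (# m - 1ℚ))
#-C2 zero    = trans #-0 (trans (solve 0 (con 0ℚ ⊜ con ½ ⊗ (con 0ℚ ⊗ (con 0ℚ ⊖ con 1ℚ))) refl)
  (sym (cong (λ x → ½ * (x * (x - 1ℚ))) #-0)))
#-C2 (suc m) = begin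
  # (suc m C 2)
    ≡⟨ cong # (nCk+nC[k+1]≡[n+1]C[k+1] m 1) ⟨
  # (m C 1 ℕ.+ m C 2)
    ≡⟨ trans (#-+ (m C 1) (m C 2)) (cong₂ _+_ (cong # (nC1≡n m)) (#-C2 m)) ⟩
  # m + ½ * (# m * (# m - 1ℚ))
    ≡⟨ solve 1 (λ m → m ⊕ con ½ ⊗ (m ⊗ (m ⊖ con 1ℚ)) ⊜ con ½ ⊗ ((con 1ℚ ⊕ m) ⊗ (con 1ℚ ⊕ m ⊖ con 1ℚ))) refl (# m) ⟩
  ½ * ((1ℚ + # m) * (1ℚ + # m - 1ℚ))
    ≡⟨ cong (λ x → ½ * (x * (x - 1ℚ))) (#-suc m) ⟨
  ½ * (# (suc m) * (# (suc m) - 1ℚ)) ∎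

inv!-suc : ∀ k → inv! k ≡ # (suc k) * inv! (suc k)
inv!-suc k = begin
  inv! k
    ≡⟨ trans (cong (inv! k *_) (inv!-inverse (suc k))) (R.*-identityʳ _) ⟨
  inv! k * (inv! (suc k) * # (suc k !))
    ≡⟨ cong (λ x → inv! k * (inv! (suc k) * x)) (#-* (suc k) (k !)) ⟩
  inv! k * (inv! (suc k) * (# (suc k) * # (k !)))
    ≡⟨ solve 4 (λ a b c d → a ⊗ (b ⊗ (c ⊗ d)) ⊜ a ⊗ d ⊗ (c ⊗ b)) refl (inv! k) (inv! (suc k)) (# (suc k)) (# (k !)) ⟩
  inv! k * # (k !) * (# (suc k) * inv! (suc k))
    ≡⟨ trans (cong (_* (# (suc k) * inv! (suc k))) (inv!-inverse k)) (R.*-identityˡ _) ⟩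
  # (suc k) * inv! (suc k) ∎

#-binomial : {n k : ℕ} → k ≤ n → # (n C k) * # ((n ∸ k) !) ≡ # (n !) * inv! k
#-binomial {n} {k} k≤n = begin
  # (n C k) * # ((n ∸ k) !)
    ≡⟨ trans (sym (R.*-identityʳ _)) (cong (# (n C k) * # ((n ∸ k) !) *_) (sym (inv!-inverse k))) ⟩
  # (n C k) * # ((n ∸ k) !) * (inv! k * # (k !))
    ≡⟨ solve 4 (λ a b c d → a ⊗ b ⊗ (c ⊗ d) ⊜ a ⊗ (d ⊗ b) ⊗ c) refl (# (n C k)) (# ((n ∸ k) !)) (inv! k) (# (k !)) ⟩
  # (n C k) * (# (k !) * # ((n ∸ k) !)) * inv! k
    ≡⟨ cong (_* inv! k) (trans (cong (# (n C k) *_) (sym (#-* (k !) _))) (sym (#-* (n C k) _))) ⟩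
  # ((n C k) ℕ.* (k ! ℕ.* (n ∸ k) !)) * inv! k
    ≡⟨ cong (λ x → # x * inv! k) (trans (cong (ℕ._* (k ! ℕ.* (n ∸ k) !)) (nCk≡n!/k![n-k]! k≤n))
        (m/n*n≡m (k![n∸k]!∣n! k≤n))) ⟩
  # (n !) * inv! k ∎
  where instance _ = k !* (n ∸ k) !≢0

-- Summation over the sets by size.

module _ (d n : ℕ) where
  private
    c = suc d
    D = # d
    X = subsets n
    cᵐ : Vec Bool n → ℚ
    cᵐ v = # (c ℕ.^ cnt (lookup v))

  -- The sum over S is moved outermost; inside it the colors are summed for each word, then the
  -- words.
  t-expansion : # (t n c) ≡ ∑ X (λ v → sgn (ones v) *
    (cᵐ v * (½ * (# (cnt (lookup v)) * D) * # (cnt (lookup v) !) + ∑fixing (lookup v) (pairSum d (lookup v)))))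
  t-expansion = begin
    # (t n c)
      ≡⟨ trans (#-sum Ws _) (∑-cong Ws (λ w → trans (#-sum Cs _) (∑-cong Cs (λ col →
           trans (#-if (isPerm w ∧ isColDerangement w col) (invc c w col))
             (cong (_* I w col) (trans (ι-∧ (isPerm w) (isColDerangement w col))
               (cong (ι (isPerm w) *_) (derangement-expansion w col)))))))) ⟩
    ∑ Ws (λ w → ∑ Cs (λ col → ι (isPerm w) * ∑ X (λ v → sgn (ones v) * (fix (lookup v) w * U v col)) * I w col))
      ≡⟨ ∑-cong Ws (λ w → trans (∑-cong Cs (λ col → trans
             (solve 3 (λ p s i → p ⊗ s ⊗ i ⊜ p ⊗ i ⊗ s) refl (ι (isPerm w)) _ (I w col))
             (sym (∑-*ˡ (ι (isPerm w) * I w col) X _))))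
           (∑-swap Cs X _)) ⟩
    ∑ Ws (λ w → ∑ X (λ v → ∑ Cs (λ col → ι (isPerm w) * I w col * (sgn (ones v) * (fix (lookup v) w * U v col)))))
      ≡⟨ ∑-swap Ws X _ ⟩
    ∑ X (λ v → ∑ Ws (λ w → ∑ Cs (λ col → ι (isPerm w) * I w col * (sgn (ones v) * (fix (lookup v) w * U v col)))))
      ≡⟨ ∑-cong X (λ v → trans (∑-cong Ws (λ w → trans
             (∑-cong Cs (λ col → solve 5 (λ p i s f u → p ⊗ i ⊗ (s ⊗ (f ⊗ u)) ⊜ s ⊗ (p ⊗ f) ⊗ (u ⊗ i)) refl
               (ι (isPerm w)) (I w col) (sgn (ones v)) (fix (lookup v) w) (U v col)))
             (trans (∑-*ˡ (sgn (ones v) * (ι (isPerm w) * fix (lookup v) w)) Cs _)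
               (trans (cong (sgn (ones v) * (ι (isPerm w) * fix (lookup v) w) *_) (invc-colour-sum d (lookup v) w))
                   (R.*-assoc _ _ _)))))
           (∑-*ˡ (sgn (ones v)) Ws _)) ⟩
    ∑ X (λ v → sgn (ones v) * ∑fixing (lookup v)
        (λ w → cᵐ v * (½ * (# (cnt (lookup v)) * D) + pairSum d (lookup v) w)))
      ≡⟨ ∑-cong X (λ v → cong (sgn (ones v) *_) (trans (∑fixing-*ˡ (lookup v) (cᵐ v) _) (cong (cᵐ v *_)
           (trans (∑fixing-+ (lookup v) (λ _ → ½ * (# (cnt (lookup v)) * D)) (pairSum d (lookup v)))
             (cong (_+ ∑fixing (lookup v) (pairSum d (lookup v))) (trans
               (∑fixing-cong (lookup v) (λ w → sym (R.*-identityʳ _)))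
               (trans (∑fixing-*ˡ (lookup v) (½ * (# (cnt (lookup v)) * D)) (λ _ → 1ℚ))
                 (cong (½ * (# (cnt (lookup v)) * D) *_) (∑fixing-1 (cnt (lookup v)) (lookup v) refl))))))))) ⟩
    _ ∎
    where
    Ws = allWords (allFin n) n
    Cs = allWords (allFin c) n
    I : Vec (Fin n) n → Vec (Fin c) n → ℚ
    I w col = # (invc c w col)
    U : Vec Bool n → Vec (Fin c) n → ℚ
    U v col = uncoloured (lookup v) col

  private
    μ κ′ : ℕ → ℚ
    μ k = # (n ∸ k)
    κ′ k = # k
    pow : ℕ → ℚ
    pow k = # (c ℕ.^ (n ∸ k))
    -- Mean cost per permutation: m free colors of mean d / 2, and m (m - 1) / 2 pairs of free
    -- positions, of mean cost (1 + d) / 2 each.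
    free : ℕ → ℚ
    free k = ½ * (μ k * D) + ¼ * ((1ℚ + D) * (μ k * (μ k - 1ℚ)))
    E V : ℕ → ℚ
    E k = ⅙ * (κ′ k * (μ k * (μ k - 1ℚ)))
    V k = ⅙ * (κ′ k * (μ k * (μ k + μ k + 1ℚ)))
    -- `φA` is the part that depends on S only through its size; `φB` is the weight of the two
    -- statistics that `E` and `V` average.
    φA φB : ℕ → ℚ
    φA k = sgn k * pow k * (# ((n ∸ k) !) * free k)
    φB k = sgn k * pow k * # ((n ∸ k ∸ 1) !)

    cnt≡ : (v : Vec Bool n) → cnt (lookup v) ≡ n ∸ ones v
    cnt≡ v = trans (sym (ℕₚ.m+n∸m≡n (ones v) (cnt (lookup v)))) (cong (_∸ ones v) (ones+cnt v))

  subset-term : (v : Vec Bool n) →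
    sgn (ones v) * (cᵐ v * (½ * (# (cnt (lookup v)) * D) * # (cnt (lookup v) !) +
        ∑fixing (lookup v) (pairSum d (lookup v)))) ≡
    φA (ones v) + (φB (ones v) * fixedBetween (lookup v) + φB (ones v) * fixedBetween (lookup v) + D *
        (φB (ones v) * fixedAbove² (lookup v)))
  subset-term v = begin
    s * (cᵐ v * (½ * (# m * D) * # (m !) + ∑fixing S (pairSum d S)))
      ≡⟨ cong (λ x → s * (cᵐ v * (½ * (# m * D) * # (m !) + x))) (trans (∑fixing-pairSum d S)
           (cong (λ p → # ((m ∸ 2) !) * ((1ℚ + D) * (p * p)) + # ((m ∸ 1) !) * (e + e + D * w)) (freePairs-cnt S))) ⟩
    s * (cᵐ v * (½ * (# m * D) * # (m !) + (# ((m ∸ 2) !) * ((1ℚ + D) * (½ * q * (½ * q))) + # ((m ∸ 1) !) *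
        (e + e + D * w))))
      ≡⟨ solve 10 (λ s a m d f g h q e w →
           s ⊗ (a ⊗ (con ½ ⊗ (m ⊗ d) ⊗ f ⊕ (g ⊗ ((con 1ℚ ⊕ d) ⊗ (con ½ ⊗ q ⊗ (con ½ ⊗ q))) ⊕ h ⊗ (e ⊕ e ⊕ d ⊗ w)))) ⊜
           s ⊗ a ⊗ (f ⊗ (con ½ ⊗ (m ⊗ d)) ⊕ (con 1ℚ ⊕ d) ⊗ con ¼ ⊗ (g ⊗ q ⊗ q)) ⊕
             (s ⊗ a ⊗ h ⊗ e ⊕ s ⊗ a ⊗ h ⊗ e ⊕ d ⊗ (s ⊗ a ⊗ h ⊗ w))) refl
           s (cᵐ v) (# m) D (# (m !)) (# ((m ∸ 2) !)) (# ((m ∸ 1) !)) q e w ⟩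
    s * cᵐ v * (# (m !) * (½ * (# m * D)) + (1ℚ + D) * ¼ * (# ((m ∸ 2) !) * q * q)) + rest m
      ≡⟨ cong (λ x → s * cᵐ v * (# (m !) * (½ * (# m * D)) + (1ℚ + D) * ¼ * x) + rest m) (pairs-of-positions m) ⟩
    s * cᵐ v * (# (m !) * (½ * (# m * D)) + (1ℚ + D) * ¼ * (# (m !) * q)) + rest m
      ≡⟨ cong (_+ rest m) (solve 6 (λ s a f m d q → s ⊗ a ⊗ (f ⊗ (con ½ ⊗ (m ⊗ d)) ⊕ (con 1ℚ ⊕ d) ⊗ con ¼ ⊗ (f ⊗ q)) ⊜
           s ⊗ a ⊗ (f ⊗ (con ½ ⊗ (m ⊗ d) ⊕ con ¼ ⊗ ((con 1ℚ ⊕ d) ⊗ q)))) refl s (cᵐ v) (# (m !)) (# m) D q) ⟩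
    s * # (c ℕ.^ m) * (# (m !) * (½ * (# m * D) + ¼ * ((1ℚ + D) * (# m * (# m - 1ℚ))))) + rest m
      ≡⟨ cong (λ m → s * # (c ℕ.^ m) * (# (m !) * (½ * (# m * D) + ¼ * ((1ℚ + D) * (# m * (# m - 1ℚ))))) +
          rest m) (cnt≡ v) ⟩
    _ ∎
    where
    S = lookup v
    s = sgn (ones v)
    m = cnt S
    e = fixedBetween S
    w = fixedAbove² S
    q = # m * (# m - 1ℚ)
    rest : ℕ → ℚ
    rest m = s * # (c ℕ.^ m) * # ((m ∸ 1) !) * e + s * # (c ℕ.^ m) * # ((m ∸ 1) !) * e + D *
        (s * # (c ℕ.^ m) * # ((m ∸ 1) !) * w)

  t-by-size : # (t n c) ≡ σ (suc n) (λ k → # (n C k) * (φA k + φB k * (E k + E k + D * V k)))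
  t-by-size = begin
    # (t n c)
      ≡⟨ trans t-expansion (∑-cong X subset-term) ⟩
    ∑ X (λ v → φA (ones v) + (φB (ones v) * fixedBetween (lookup v) + φB (ones v) * fixedBetween (lookup v) + D *
        (φB (ones v) * fixedAbove² (lookup v))))
      ≡⟨ split _ _ _ ⟩
    ∑ X (λ v → φA (ones v)) + (∑ X (λ v → φB (ones v) * fixedBetween (lookup v)) +
        ∑ X (λ v → φB (ones v) * fixedBetween (lookup v)) + D * ∑ X (λ v → φB (ones v) * fixedAbove² (lookup v)))
      ≡⟨ cong₂ (λ x y → ∑ X (λ v → φA (ones v)) + (x + x + D * y))
           (trans (average-fixedBetween n φB) (∑-cong X
               (λ v → cong (λ m → φB (ones v) * (⅙ * (# (ones v) * (# m * (# m - 1ℚ))))) (cnt≡ v))))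
           (trans (average-fixedAbove² n φB) (∑-cong X
               (λ v → cong (λ m → φB (ones v) * (⅙ * (# (ones v) * (# m * (# m + # m + 1ℚ))))) (cnt≡ v)))) ⟩
    ∑ X (λ v → φA (ones v)) + (∑ X (λ v → φB (ones v) * E (ones v)) + ∑ X (λ v → φB (ones v) * E (ones v)) + D *
        ∑ X (λ v → φB (ones v) * V (ones v)))
      ≡⟨ split _ _ _ ⟨
    ∑ X (λ v → φA (ones v) + (φB (ones v) * E (ones v) + φB (ones v) * E (ones v) + D * (φB (ones v) * V (ones v))))
      ≡⟨ ∑-cong X (λ v → solve 5 (λ a b e d w → a ⊕ (b ⊗ e ⊕ b ⊗ e ⊕ d ⊗ (b ⊗ w)) ⊜ a ⊕ b ⊗ (e ⊕ e ⊕ d ⊗ w)) refl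
           (φA (ones v)) (φB (ones v)) (E (ones v)) D (V (ones v))) ⟩
    ∑ X (λ v → φA (ones v) + φB (ones v) * (E (ones v) + E (ones v) + D * V (ones v)))
      ≡⟨ ∑-subsets-ones n (λ k → φA k + φB k * (E k + E k + D * V k)) ⟩
    _ ∎
    where
    split : (x y z : Vec Bool n → ℚ) → ∑ X (λ v → x v + (y v + y v + D * z v)) ≡ ∑ X x + (∑ X y + ∑ X y + D * ∑ X z)
    split x y z = trans (∑-+ X _ _) (cong (∑ X x +_) (trans (∑-+ X _ _) (cong₂ _+_ (∑-+ X _ _) (∑-*ˡ D X _))))

  private
    summand : ℕ → ℚ
    summand k = sgn k * pow k * inv! k *
      (free k + κ′ k * (⅙ * (μ k - 1ℚ + (μ k - 1ℚ)) + D * (⅙ * (μ k + μ k + 1ℚ))))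

    μ-n : μ n ≡ 0ℚ
    μ-n = trans (cong # (ℕₚ.n∸n≡0 n)) #-0

    -- At k = n the left side would be 0! times 0 and the right side 0! = 1, so that summand has to
    -- be split off beforehand.
    fac-μ : ∀ {k} → k < n → # ((n ∸ k ∸ 1) !) * μ k ≡ # ((n ∸ k) !)
    fac-μ {k} k<n with n ∸ k | ℕₚ.m<n⇒0<n∸m k<n
    ... | suc m | _ = trans (R.*-comm _ _) (sym (#-* (suc m) (m !)))

  t-sum : # (t n c) ≡ # (n !) * σ n summand
  t-sum = begin
    # (t n c)
      ≡⟨ t-by-size ⟩
    σ n (λ k → # (n C k) * (φA k + φB k * (E k + E k + D * V k))) + # (n C n) * (φA n + φB n * (E n + E n + D * V n))
      ≡⟨ cong₂ _+_ (σ-cong n (λ k k<n → begin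
           # (n C k) * (sgn k * pow k * (# ((n ∸ k) !) * free k) + sgn k * pow k * # ((n ∸ k ∸ 1) !) *
               (E k + E k + D * V k))
             ≡⟨ solve 9 (λ b s a f r h k u d →
                  b ⊗ (s ⊗ a ⊗ (f ⊗ r) ⊕ s ⊗ a ⊗ h ⊗
                      (con ⅙ ⊗ (k ⊗ (u ⊗ (u ⊖ con 1ℚ))) ⊕ con ⅙ ⊗ (k ⊗ (u ⊗ (u ⊖ con 1ℚ))) ⊕
                    d ⊗ (con ⅙ ⊗ (k ⊗ (u ⊗ (u ⊕ u ⊕ con 1ℚ)))))) ⊜
                  b ⊗ s ⊗ a ⊗ (f ⊗ r ⊕ h ⊗ u ⊗
                      (k ⊗ (con ⅙ ⊗ (u ⊖ con 1ℚ ⊕ (u ⊖ con 1ℚ)) ⊕ d ⊗ (con ⅙ ⊗ (u ⊕ u ⊕ con 1ℚ)))))) refl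
                  (# (n C k)) (sgn k) (pow k) (# ((n ∸ k) !)) (free k) (# ((n ∸ k ∸ 1) !)) (κ′ k) (μ k) D ⟩
           # (n C k) * sgn k * pow k * (# ((n ∸ k) !) * free k + # ((n ∸ k ∸ 1) !) * μ k * tail k)
             ≡⟨ cong (λ x → # (n C k) * sgn k * pow k * (# ((n ∸ k) !) * free k + x * tail k)) (fac-μ k<n) ⟩
           # (n C k) * sgn k * pow k * (# ((n ∸ k) !) * free k + # ((n ∸ k) !) * tail k)
             ≡⟨ solve 6 (λ b s a f r t → b ⊗ s ⊗ a ⊗ (f ⊗ r ⊕ f ⊗ t) ⊜ b ⊗ f ⊗ (s ⊗ a ⊗ (r ⊕ t))) refl
                  (# (n C k)) (sgn k) (pow k) (# ((n ∸ k) !)) (free k) (tail k) ⟩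
           # (n C k) * # ((n ∸ k) !) * (sgn k * pow k * (free k + tail k))
             ≡⟨ cong (_* (sgn k * pow k * (free k + tail k))) (#-binomial (ℕₚ.<⇒≤ k<n)) ⟩
           # (n !) * inv! k * (sgn k * pow k * (free k + tail k))
             ≡⟨ solve 5 (λ f i s a r → f ⊗ i ⊗ (s ⊗ a ⊗ r) ⊜ f ⊗ (s ⊗ a ⊗ i ⊗ r))
                 refl (# (n !)) (inv! k) (sgn k) (pow k) (free k + tail k) ⟩
           # (n !) * summand k ∎))
         -- At k = n nothing is free and the whole summand is 0, before any factorial is cancelled.
         (trans (cong₂ (λ r y → # (n C n) * (sgn n * pow n * (# ((n ∸ n) !) * r) + φB n * y)) free-n rest-n)
           (solve 4 (λ b a f h → b ⊗ (a ⊗ (f ⊗ con 0ℚ) ⊕ h ⊗ con 0ℚ) ⊜ con 0ℚ)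
               refl (# (n C n)) (sgn n * pow n) (# ((n ∸ n) !)) (φB n))) ⟩
    σ n (λ k → # (n !) * summand k) + 0ℚ
      ≡⟨ trans (R.+-identityʳ _) (σ-*ˡ n (# (n !)) summand) ⟩
    # (n !) * σ n summand ∎
    where
    tail : ℕ → ℚ
    tail k = κ′ k * (⅙ * (μ k - 1ℚ + (μ k - 1ℚ)) + D * (⅙ * (μ k + μ k + 1ℚ)))
    free-n : free n ≡ 0ℚ
    free-n = trans (cong (λ u → ½ * (u * D) + ¼ * ((1ℚ + D) * (u * (u - 1ℚ)))) μ-n)
      (solve 1 (λ d → con ½ ⊗ (con 0ℚ ⊗ d) ⊕ con ¼ ⊗ ((con 1ℚ ⊕ d) ⊗ (con 0ℚ ⊗ (con 0ℚ ⊖ con 1ℚ))) ⊜ con 0ℚ) refl D)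
    rest-n : E n + E n + D * V n ≡ 0ℚ
    rest-n = trans (cong (λ u → ⅙ * (κ′ n * (u * (u - 1ℚ))) + ⅙ * (κ′ n * (u * (u - 1ℚ))) + D *
        (⅙ * (κ′ n * (u * (u + u + 1ℚ))))) μ-n)
      (solve 2 (λ k d → con ⅙ ⊗ (k ⊗ (con 0ℚ ⊗ (con 0ℚ ⊖ con 1ℚ))) ⊕ con ⅙ ⊗ (k ⊗ (con 0ℚ ⊗ (con 0ℚ ⊖ con 1ℚ))) ⊕
        d ⊗ (con ⅙ ⊗ (k ⊗ (con 0ℚ ⊗ (con 0ℚ ⊕ con 0ℚ ⊕ con 1ℚ)))) ⊜ con 0ℚ) refl (κ′ n) D)

  -- Matching the four terms of the formula.

  private
    nf = # (n !)
    #n : ∀ {k} → k < n → # n ≡ κ′ k + μ k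
    #n {k} k<n = trans (cong # (sym (ℕₚ.m+[n∸m]≡n (ℕₚ.<⇒≤ k<n)))) (#-+ k (n ∸ k))
    #3 : # 3 ≡ 1ℚ + (1ℚ + 1ℚ)
    #3 = trans (#-suc 2) (cong (1ℚ +_) (trans (#-suc 1) (cong (1ℚ +_) #-1)))
    #2 : # 2 ≡ 1ℚ + 1ℚ
    #2 = trans (#-suc 1) (cong (1ℚ +_) #-1)
    c-1 : # c - 1ℚ ≡ D
    c-1 = trans (cong (_- 1ℚ) (#-suc d)) (solve 1 (λ d → con 1ℚ ⊕ d ⊖ con 1ℚ ⊜ d) refl D)

    drop-last : (f : ℕ → ℚ) → f n ≡ 0ℚ → σ (suc n) f ≡ σ n f
    drop-last f e = trans (cong (σ n f +_) e) (R.+-identityʳ _)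

  -- With m = n - k, 3n + k = 3m + 4k, so the coefficient is m (m - 1) / 4 + k (m - 1) / 3: the
  -- inversions between free positions and those involving a fixed one.
  term₁-σ : term₁ n c ≡ nf * σ n (λ k → sgn k * pow k * inv! k *
      ((ℤ.+ 1 ℚ./ 12) * ((μ k - 1ℚ) * (μ k + μ k + μ k + (κ′ k + κ′ k + κ′ k + κ′ k)))))
  term₁-σ = begin
    nf * (ℤ.+ 1 ℚ./ 12) * sumBetween 0 n _
      ≡⟨ cong (nf * (ℤ.+ 1 ℚ./ 12) *_) (sumBetween-σ 0 n _) ⟩
    nf * (ℤ.+ 1 ℚ./ 12) * σ n _
      ≡⟨ trans (R.*-assoc _ _ _) (cong (nf *_) (sym (σ-*ˡ n _ _))) ⟩
    nf * σ n (λ k → (ℤ.+ 1 ℚ./ 12) * (sgn k * pow k * (# n - κ′ k - 1ℚ) * (# 3 * # n + κ′ k) * inv! k))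
      ≡⟨ cong (nf *_) (σ-cong n (λ k k<n → trans
           (cong₂ (λ x y → (ℤ.+ 1 ℚ./ 12) * (sgn k * pow k * (x - κ′ k - 1ℚ) * (y * x + κ′ k) * inv! k)) (#n k<n) #3)
           (solve 6 (λ q s a k u i → q ⊗ (s ⊗ a ⊗ (k ⊕ u ⊖ k ⊖ con 1ℚ) ⊗
               ((con 1ℚ ⊕ (con 1ℚ ⊕ con 1ℚ)) ⊗ (k ⊕ u) ⊕ k) ⊗ i) ⊜
             s ⊗ a ⊗ i ⊗ (q ⊗ ((u ⊖ con 1ℚ) ⊗ (u ⊕ u ⊕ u ⊕ (k ⊕ k ⊕ k ⊕ k)))))
                 refl (ℤ.+ 1 ℚ./ 12) (sgn k) (pow k) (κ′ k) (μ k) (inv! k)))) ⟩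
    _ ∎

  term₂-σ : term₂ n c ≡ nf * σ n (λ k → sgn k * pow k * inv! k * (½ * (μ k * D)))
  term₂-σ = cong (nf *_) (begin
    sumBetween 0 (suc n) _
      ≡⟨ trans (sumBetween-σ 0 (suc n) _) (σ-cong (suc n) (λ k _ → trans (cong (sgn k * inv! k *_) (inner k))
           (solve 4 (λ s i a x → s ⊗ i ⊗ (a ⊗ x) ⊜ s ⊗ a ⊗ i ⊗ x) refl (sgn k) (inv! k) (pow k) (½ * (μ k * D))))) ⟩
    σ (suc n) (λ k → sgn k * pow k * inv! k * (½ * (μ k * D)))
      ≡⟨ drop-last _ (trans (cong (λ u → sgn n * pow n * inv! n * (½ * (u * D))) μ-n)
           (solve 2 (λ a d → a ⊗ (con ½ ⊗ (con 0ℚ ⊗ d)) ⊜ con 0ℚ) refl (sgn n * pow n * inv! n) D)) ⟩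
    _ ∎)
    where
    inner : ∀ k → sumBetween 0 (suc ((n ∸ k) ℕ.* d)) (λ i → # i *
      sumBetween 0 (suc (n ∸ k)) (λ j → sgn j * # ((n ∸ k) C j) *
        # (binomℤ (ℤ.+ i ℤ.- ℤ.+ (c ℕ.* j) ℤ.+ ℤ.+ (n ∸ k) ℤ.- ℤ.+ 1) (ℤ.+ (n ∸ k) ℤ.- ℤ.+ 1)))) ≡ pow k *
            (½ * (μ k * D))
    inner k = trans (sumBetween-σ 0 (suc ((n ∸ k) ℕ.* d)) _) (trans
      (σ-cong (suc ((n ∸ k) ℕ.* d)) (λ i _ → cong (# i *_) (sumBetween-σ 0 (suc (n ∸ k)) _)))
      (weighted-binomial-sum d (n ∸ k)))

  term₃-σ : term₃ n c ≡ nf * σ n (λ k → sgn k * pow k * inv! k * (¼ * (D * (μ k * (μ k - 1ℚ)))))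
  term₃-σ = begin
    nf * (# c - 1ℚ) * (ℤ.+ 1 ℚ./ 2) * sumBetween 0 (suc n) _
      ≡⟨ cong₂ (λ x y → nf * x * ½ * y) c-1 (sumBetween-σ 0 (suc n) _) ⟩
    nf * D * ½ * σ (suc n) _
      ≡⟨ trans (solve 4 (λ f d h x → f ⊗ d ⊗ h ⊗ x ⊜ f ⊗ (d ⊗ h ⊗ x))
          refl nf D ½ _) (cong (nf *_) (sym (σ-*ˡ (suc n) _ _))) ⟩
    nf * σ (suc n) (λ k → D * ½ * (sgn k * pow k * inv! k * # ((n ∸ k) C 2)))
      ≡⟨ cong (nf *_) (σ-cong (suc n) (λ k _ →
          trans (cong (λ x → D * ½ * (sgn k * pow k * inv! k * x)) (#-C2 (n ∸ k)))
           (solve 3 (λ d a x → d ⊗ con ½ ⊗ (a ⊗ (con ½ ⊗ x)) ⊜ a ⊗ (con ¼ ⊗ (d ⊗ x)))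
               refl D (sgn k * pow k * inv! k) (μ k * (μ k - 1ℚ))))) ⟩
    nf * σ (suc n) (λ k → sgn k * pow k * inv! k * (¼ * (D * (μ k * (μ k - 1ℚ)))))
      ≡⟨ cong (nf *_) (drop-last _ (trans (cong (λ u → sgn n * pow n * inv! n * (¼ * (D * (u * (u - 1ℚ))))) μ-n)
           (solve 2 (λ a d → a ⊗ (con ¼ ⊗ (d ⊗ (con 0ℚ ⊗ (con 0ℚ ⊖ con 1ℚ)))) ⊜ con 0ℚ)
               refl (sgn n * pow n * inv! n) D))) ⟩
    _ ∎

  -- 1 / (k - 1)! is rewritten as k / k!. In this form the summand k = 0 is 0, so the range may
  -- start there.
  term₄-σ : term₄ n c ≡ nf * σ n (λ k → sgn k * pow k * inv! k * (⅙ * (D * (κ′ k * (μ k + μ k + 1ℚ)))))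
  term₄-σ = begin
    nf * (# c - 1ℚ) * ⅙ * sumBetween 1 n _
      ≡⟨ cong₂ (λ x y → nf * x * ⅙ * y) c-1 (trans (sumBetween-σ 1 n _) (σ-cong (n ∸ 1) (λ k _ → trans
           (cong₂ (λ x y → sgn (suc k) * pow (suc k) * (x * μ (suc k) + 1ℚ) * y) #2 (inv!-suc k))
           (solve 5 (λ s a u k i → s ⊗ a ⊗ ((con 1ℚ ⊕ con 1ℚ) ⊗ u ⊕ con 1ℚ) ⊗ (k ⊗ i) ⊜ s ⊗ a ⊗ i ⊗
               (k ⊗ (u ⊕ u ⊕ con 1ℚ))) refl
             (sgn (suc k)) (pow (suc k)) (μ (suc k)) (# (suc k)) (inv! (suc k)))))) ⟩
    nf * D * ⅙ * σ (n ∸ 1) (λ k → g (suc k))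
      ≡⟨ cong (nf * D * ⅙ *_) (from-1 n) ⟩
    nf * D * ⅙ * σ n g
      ≡⟨ trans (solve 4 (λ f d h x → f ⊗ d ⊗ h ⊗ x ⊜ f ⊗ (d ⊗ h ⊗ x))
          refl nf D ⅙ _) (cong (nf *_) (sym (σ-*ˡ n _ _))) ⟩
    nf * σ n (λ k → D * ⅙ * g k)
      ≡⟨ cong (nf *_) (σ-cong n (λ k _ → solve 4 (λ d h a x → d ⊗ h ⊗ (a ⊗ x) ⊜ a ⊗ (h ⊗ (d ⊗ x))) refl
           D ⅙ (sgn k * pow k * inv! k) (κ′ k * (μ k + μ k + 1ℚ)))) ⟩
    _ ∎
    where
    g : ℕ → ℚ
    g k = sgn k * pow k * inv! k * (κ′ k * (μ k + μ k + 1ℚ))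
    from-1 : ∀ m → σ (m ∸ 1) (λ k → g (suc k)) ≡ σ m g
    from-1 zero    = refl
    from-1 (suc m) = sym (trans (σ-sucˡ m g) (trans (R.+-congʳ (trans
      (cong (λ x → sgn 0 * pow 0 * inv! 0 * (x * (μ 0 + μ 0 + 1ℚ))) #-0)
      (solve 2 (λ a x → a ⊗ (con 0ℚ ⊗ x) ⊜ con 0ℚ) refl (sgn 0 * pow 0 * inv! 0) (μ 0 + μ 0 + 1ℚ))))
          (R.+-identityˡ _)))

  t≡rhs : # (t n c) ≡ rhs n c
  t≡rhs = begin
    # (t n c)
      ≡⟨ t-sum ⟩
    nf * σ n summand
      -- For each k, after the common weight is set aside, a polynomial identity in k, m and d
      -- remains.
      ≡⟨ cong (nf *_) (σ-cong n (λ k _ → solve 4 (λ w k u d →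
           w ⊗ (con ½ ⊗ (u ⊗ d) ⊕ con ¼ ⊗ ((con 1ℚ ⊕ d) ⊗ (u ⊗ (u ⊖ con 1ℚ))) ⊕
             k ⊗ (con ⅙ ⊗ (u ⊖ con 1ℚ ⊕ (u ⊖ con 1ℚ)) ⊕ d ⊗ (con ⅙ ⊗ (u ⊕ u ⊕ con 1ℚ)))) ⊜
           w ⊗ (con (ℤ.+ 1 ℚ./ 12) ⊗ ((u ⊖ con 1ℚ) ⊗ (u ⊕ u ⊕ u ⊕ (k ⊕ k ⊕ k ⊕ k)))) ⊕ w ⊗ (con ½ ⊗ (u ⊗ d)) ⊕
             w ⊗ (con ¼ ⊗ (d ⊗ (u ⊗ (u ⊖ con 1ℚ)))) ⊕ w ⊗ (con ⅙ ⊗ (d ⊗ (k ⊗ (u ⊕ u ⊕ con 1ℚ))))) refl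
           (sgn k * pow k * inv! k) (κ′ k) (μ k) D)) ⟩
    nf * σ n (λ k → _ + _ + _ + _)
      ≡⟨ cong (nf *_) (trans (σ-+ n _ _) (R.+-congʳ (trans (σ-+ n _ _) (R.+-congʳ (σ-+ n _ _))))) ⟩
    nf * (σ n _ + σ n _ + σ n _ + σ n _)
      ≡⟨ solve 5 (λ f a b c d → f ⊗ (a ⊕ b ⊕ c ⊕ d) ⊜ f ⊗ a ⊕ f ⊗ b ⊕ f ⊗ c ⊕ f ⊗ d) refl nf _ _ _ _ ⟩
    nf * σ n _ + nf * σ n _ + nf * σ n _ + nf * σ n _
      ≡⟨ cong₂ _+_ (cong₂ _+_ (cong₂ _+_ term₁-σ term₂-σ) term₃-σ) term₄-σ ⟨
    term₁ n c + term₂ n c + term₃ n c + term₄ n c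
      ≡⟨ rhs-terms n c ⟨
    rhs n c ∎

theorem4p2 : (n c : ℕ) → 1 ≤ c → ℕ→ℚ (t n c) ≡ rhs n c
theorem4p2 n (suc d) _ = trans (#≡ (t n (suc d))) (t≡rhs d n)
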